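{- Let $G$ be a connected distance hereditary graph. The following are equivalent: (1) $G$ is a permutation graph; (2) $G$ is AT-free; (3) the pruned decomposition tree of $G$ is a path.
   Context: A graph $G$ is distance hereditary if for every connected induced subgraph $H$ of $G$, the distance between every two vertices of $H$ is the same in $H$ as in $G$. A permutation graph is an intersection graph of straight segments joining two parallel lines. An asteroidal triple is a set of three vertices such that each two of them are joined by a path avoiding the closed neighbourhood of the third; $G$ is AT-free if it has no asteroidal triple. A split of $G=(V,E)$ is a partition $\{V_1,V_2\}$ of $V$ with $|V_1|,|V_2|>1$ such that the edges between $V_1$ and $V_2$ are exactly $\{xy: x\in N(V_2), y\in N(V_1)\}$ (where $N(W)$ is the set of vertices outside $W$ adjacent to $W$); $G$ is prime if it has no split. A simple split decomposition replaces $G$ by $G[V_1]+v$ with $N(v)=N_G(V_2)$ and $G[V_2]+v$ with $N(v)=N_G(V_1)$, $v$ a new marker vertex. A split decomposition is obtained by repeating this on the pieces; it is a tree whose nodes are graphs, adjacent iff they share a marker. The standard split decomposition tree $T_G$ of a connected graph $G$ is its unique split decomposition whose nodes are all prime graphs, cliques or stars and which is not a strict refinement of another such decomposition. The pruned decomposition tree is obtained from $T_G$ by repeatedly removing a leaf node whose marker vertex is universal in that leaf's graph (the other copy of the marker becoming an ordinary vertex) until no such leaf remains. -}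

module Defs where

open import Data.Bool using (Bool; true; false; not; if_then_else_; _∧_)
open import Data.Nat using (ℕ; zero; suc; _≤_; _<_; _≡ᵇ_)
open import Data.Fin using (Fin; toℕ)
import Data.Fin as F
open import Data.Fin.Subset using (Subset; _∈_)
open import Data.List using (List; []; _∷_; _++_; [_]; map; allFin; filterᵇ; length; lookup)
open import Data.Bool.ListAction using (any)
import Data.List.Membership.Propositional as LM
open import Data.List.Relation.Unary.All using (All)
open import Data.List.Relation.Unary.Any using (Any)
open import Data.Maybe using (Maybe; just; nothing)
open import Data.Product using (Σ; ∃; ∃₂; _×_; _,_)
open import Data.Sum using (_⊎_)
open import Data.Unit using (⊤)
open import Relation.Nullary using (¬_)
open import Relation.Binary.PropositionalEquality using (_≡_; _≢_)
open import Relation.Binary.Construct.Closure.ReflexiveTransitive using (Star)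

record Graph : Set where
  field
    n      : ℕ
    adj    : Fin n → Fin n → Bool
    sym    : ∀ u v → adj u v ≡ adj v u
    irrefl : ∀ u → adj u u ≡ false
open Graph public

module _ (G : Graph) where

  data WalkIn (P : Fin (n G) → Set) : Fin (n G) → Fin (n G) → ℕ → Set where
    here : ∀ {u} → P u → WalkIn P u u 0
    step : ∀ {u w v k} → P u → adj G u w ≡ true → WalkIn P w v k → WalkIn P u v (suc k)

  Everything : Fin (n G) → Set
  Everything _ = ⊤

  Connected : Set
  Connected = ∀ u v → ∃ λ k → WalkIn Everything u v k

  ConnectedIn : Subset (n G) → Set
  ConnectedIn S = ∀ u v → u ∈ S → v ∈ S → ∃ λ k → WalkIn (_∈ S) u v k

  DistIn : (Fin (n G) → Set) → Fin (n G) → Fin (n G) → ℕ → Set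
  DistIn P u v d = WalkIn P u v d × (∀ k → WalkIn P u v k → d ≤ k)

  DistanceHereditary : Set
  DistanceHereditary =
    ∀ (S : Subset (n G)) → ConnectedIn S →
    ∀ u v → u ∈ S → v ∈ S → ∀ d →
    (DistIn Everything u v d → DistIn (_∈ S) u v d) ×
    (DistIn (_∈ S) u v d → DistIn Everything u v d)

  -- segment of vertex v joins point top v on one line to point bot v on
  -- the other; two segments intersect iff they do not "cross strictly in order"
  SegmentsIntersect : (Fin (n G) → ℕ) → (Fin (n G) → ℕ) → Fin (n G) → Fin (n G) → Set
  SegmentsIntersect top bot u v =
    ¬ ((top u < top v × bot u < bot v) ⊎ (top v < top u × bot v < bot u))

  PermutationGraph : Set
  PermutationGraph =
    Σ (Fin (n G) → ℕ) λ top → Σ (Fin (n G) → ℕ) λ bot →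
      ∀ u v → u ≢ v →
        (adj G u v ≡ true → SegmentsIntersect top bot u v) ×
        (SegmentsIntersect top bot u v → adj G u v ≡ true)

  AvoidN : Fin (n G) → Fin (n G) → Set
  AvoidN z w = w ≢ z × adj G z w ≡ false

  AsteroidalTriple : Fin (n G) → Fin (n G) → Fin (n G) → Set
  AsteroidalTriple x y z =
    x ≢ y × y ≢ z × x ≢ z ×
    (∃ λ k → WalkIn (AvoidN z) x y k) ×
    (∃ λ k → WalkIn (AvoidN x) y z k) ×
    (∃ λ k → WalkIn (AvoidN y) x z k)

  ATFree : Set
  ATFree = ∀ x y z → ¬ AsteroidalTriple x y z

record LGraph : Set where
  field
    V    : List ℕ
    ladj : ℕ → ℕ → Bool
open LGraph public

_∈V_ : ℕ → LGraph → Set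
x ∈V H = x LM.∈ V H

V₁ V₂ : LGraph → (ℕ → Bool) → List ℕ
V₁ H side = filterᵇ side (V H)
V₂ H side = filterᵇ (λ x → not (side x)) (V H)

adjTo : LGraph → List ℕ → ℕ → Bool
adjTo H W y = any (ladj H y) W

IsSplit : LGraph → (ℕ → Bool) → Set
IsSplit H side =
  2 ≤ length (V₁ H side) × 2 ≤ length (V₂ H side) ×
  (∀ x y → x LM.∈ V₁ H side → y LM.∈ V₂ H side →
     (ladj H x y ≡ true → adjTo H (V₂ H side) x ≡ true × adjTo H (V₁ H side) y ≡ true) ×
     (adjTo H (V₂ H side) x ≡ true × adjTo H (V₁ H side) y ≡ true → ladj H x y ≡ true))

Prime : LGraph → Set
Prime H = ¬ Σ (ℕ → Bool) λ side → IsSplit H side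

Clique : LGraph → Set
Clique H = ∀ x y → x ∈V H → y ∈V H → x ≢ y → ladj H x y ≡ true

IsStar : LGraph → Set
IsStar H = ∃ λ c → c ∈V H × (∀ x y → x ∈V H → y ∈V H → x ≢ y →
  (ladj H x y ≡ true → x ≡ c ⊎ y ≡ c) × (x ≡ c ⊎ y ≡ c → ladj H x y ≡ true))

withMarker : LGraph → List ℕ → List ℕ → ℕ → LGraph
withMarker H W W' m = record
  { V = m ∷ W
  ; ladj = λ x y → if x ≡ᵇ m then (if y ≡ᵇ m then false else adjTo H W' y)
                   else (if y ≡ᵇ m then adjTo H W' x else ladj H x y) }

piece₁ piece₂ : LGraph → (ℕ → Bool) → ℕ → LGraph
piece₁ H side m = withMarker H (V₁ H side) (V₂ H side) m
piece₂ H side m = withMarker H (V₂ H side) (V₁ H side) m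

Occurs : ℕ → List LGraph → Set
Occurs x D = Any (λ H → x ∈V H) D

data Step : List LGraph → List LGraph → Set where
  split : ∀ pre post H (side : ℕ → Bool) m →
          IsSplit H side → ¬ Occurs m (pre ++ H ∷ post) →
          Step (pre ++ H ∷ post) (pre ++ piece₁ H side m ∷ piece₂ H side m ∷ post)

_≅_ : LGraph → LGraph → Set
H ≅ H' = (∀ x → x ∈V H → x ∈V H') × (∀ x → x ∈V H' → x ∈V H) ×
         (∀ x y → x ∈V H → y ∈V H → ladj H x y ≡ ladj H' x y)

data _≈D_ : List LGraph → List LGraph → Set where
  []   : [] ≈D []
  cons : ∀ {H H' D D₁ D₂} → H ≅ H' → D ≈D (D₁ ++ D₂) → (H ∷ D) ≈D (D₁ ++ H' ∷ D₂)

toFin? : (k : ℕ) → ℕ → Maybe (Fin k)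
toFin? zero    _       = nothing
toFin? (suc k) zero    = just F.zero
toFin? (suc k) (suc x) with toFin? k x
... | just i  = just (F.suc i)
... | nothing = nothing

base : Graph → LGraph
base G = record
  { V = map toℕ (allFin (n G))
  ; ladj = λ x y → f (toFin? (n G) x) (toFin? (n G) y) }
  where
  f : Maybe (Fin (n G)) → Maybe (Fin (n G)) → Bool
  f (just u) (just v) = adj G u v
  f _ _ = false

-- D is a split decomposition of G (nodes = list of labelled graphs;
-- tree adjacency = sharing a marker label)
SplitDecomposition : Graph → List LGraph → Set
SplitDecomposition G D = ∃ λ D₀ → Star Step [ base G ] D₀ × D₀ ≈D D

NiceNodes : List LGraph → Set
NiceNodes D = All (λ H → Prime H ⊎ Clique H ⊎ IsStar H) D

StrictRefinement : List LGraph → List LGraph → Set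
StrictRefinement D D' = ∃₂ λ D₁ D₂ → Step D' D₁ × Star Step D₁ D₂ × D₂ ≈D D

IsStandard : Graph → List LGraph → Set
IsStandard G D =
  SplitDecomposition G D × NiceNodes D ×
  ¬ (∃ λ D' → SplitDecomposition G D' × NiceNodes D' × StrictRefinement D D')

LeafUniversal : LGraph → List LGraph → Set
LeafUniversal L rest =
  ∃ λ m → m ∈V L × Occurs m rest ×
    (∀ x → x ∈V L → Occurs x rest → x ≡ m) ×
    (∀ y → y ∈V L → y ≢ m → ladj L m y ≡ true)

PruneStep : List LGraph → List LGraph → Set
PruneStep D D' = ∃ λ L → D ≈D (L ∷ D') × LeafUniversal L D'

IsPruning : List LGraph → List LGraph → Set
IsPruning D P = Star PruneStep D P × ¬ (∃ λ P' → PruneStep P P')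

TreeAdj : (Q : List LGraph) → Fin (length Q) → Fin (length Q) → Set
TreeAdj Q i j = i ≢ j × ∃ λ x → x ∈V lookup Q i × x ∈V lookup Q j

Consecutive : ∀ {k} → Fin k → Fin k → Set
Consecutive i j = suc (toℕ i) ≡ toℕ j ⊎ suc (toℕ j) ≡ toℕ i

IsPathTree : List LGraph → Set
IsPathTree P = ∃ λ Q → P ≈D Q × (∀ i j →
  (TreeAdj Q i j → Consecutive i j) × (Consecutive i j → TreeAdj Q i j))

PrunedTreeIsPath : Graph → Set
PrunedTreeIsPath G = ∀ D P → IsStandard G D → IsPruning D P → IsPathTree P

-- (1) ⇒ (2): a walk avoiding the neighbourhood of z stays on one side of the segment of z.
--
-- (2) ⇒ (3): a distance hereditary graph that is neither a clique nor a star has a split, found by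
-- inspecting the last distance layer, so all nodes of the decomposition are cliques or stars. A tree
-- that is not a path has three leaves. After pruning, such a leaf is a star whose marker is not the
-- centre, and so it contains a pendant vertex. Since the decomposition is not a refinement of a coarser one, the node next
-- to the leaf is not a star centred at their common marker; hence the graph stays connected without the
-- leaf, and the three pendant vertices form an asteroidal triple.
--
-- (3) ⇒ (1): along the path, a diagram is built in which the marker to the next node ends last on one of
-- the two lines; twins and pendant vertices of such a vertex can be added, and pendant vertices inherit
-- the property. Undoing a pruning step only adds twins. The standard decomposition is obtained only under a
-- double negation, which is removed because there are finitely many candidate models.

module Submission where

open import Defs
open import Data.Product using (_×_)
open import Function.Bundles using (_⇔_)
open import Data.Bool using (Bool; true; false; not; if_then_else_; _∧_; T; T?)
import Data.Bool.Properties as Boolₚ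
open import Data.Empty using (⊥; ⊥-elim)
open import Data.Fin using (Fin; toℕ; fromℕ<; finToFun; funToFin)
import Data.Fin as Fin
import Data.Fin.Properties as Finₚ
import Data.Fin.Subset as Subset
open import Data.List using (List; []; _∷_; _++_; [_]; map; allFin; filter; filterᵇ; length; lookup; reverse; initLast; _∷ʳ′_)
import Data.List.Properties as Listₚ
open import Data.List.Membership.Propositional using (_∈_)
open import Data.List.Membership.Propositional.Properties using (∈-map⁺; ∈-map⁻; ∈-++⁺ˡ; ∈-++⁺ʳ; ∈-++⁻; ∈-filter⁺; ∈-filter⁻; ∈-allFin; ∈-∃++)
open import Data.List.Relation.Unary.All using (All; []; _∷_)
import Data.List.Relation.Unary.All as All
import Data.List.Relation.Unary.All.Properties as Allₚ
open import Data.List.Relation.Unary.Any using (Any; here; there)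
import Data.List.Relation.Unary.Any as Any
import Data.List.Relation.Unary.Any.Properties as Anyₚ
open import Data.List.Relation.Unary.Unique.Propositional using (Unique)
import Data.List.Relation.Unary.Unique.Propositional.Properties as Uniqueₚ
open import Data.List.Relation.Unary.AllPairs using ([]; _∷_)
open import Data.List.Relation.Binary.Pointwise using (Pointwise; []; _∷_; Pointwise-length)
import Data.List.Relation.Binary.Pointwise as Pointwise
open import Data.List.Relation.Binary.Permutation.Propositional using (_↭_; ↭-refl; ↭-sym; ↭-trans; prep; swap)
import Data.List.Relation.Binary.Permutation.Propositional as Perm
open import Data.List.Relation.Binary.Permutation.Propositional.Properties using (Any-resp-↭; All-resp-↭; ∈-resp-↭; ↭-length; ↭-empty-inv; ↭-singleton-inv; shift; drop-∷; ↭-reverse)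
import Data.List.Relation.Binary.Permutation.Propositional.Properties as Permₚ
open import Data.Maybe using (just)
open import Data.Nat using (ℕ; zero; suc; _+_; _^_; _∸_; _≤_; _<_; _≡ᵇ_; _≟_; _<?_; z≤n; s≤s)
import Data.Nat.Properties as ℕₚ
open import Data.Product using (Σ; ∃; ∃₂; _,_; proj₁; proj₂) renaming (swap to swap-×)
open import Data.Sum using (_⊎_; inj₁; inj₂; [_,_]′)
import Data.Sum as Sum
open import Data.Unit using (tt)
open import Function using (_∘_; id; case_of_)
open import Function.Bundles using (mk⇔)
open import Relation.Nullary using (¬_; Dec; yes; no; does; ¬?)
open import Relation.Nullary.Decidable using (dec-true; dec-false; ¬¬-excluded-middle; decidable-stable; _→-dec_; _×-dec_; _⊎-dec_)
open import Relation.Binary.PropositionalEquality using (_≡_; _≢_; refl; trans; cong; cong₂; subst) renaming (sym to ≡-sym)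
open import Relation.Binary.Construct.Closure.ReflexiveTransitive using (Star; ε; _◅_; _◅◅_)
import Relation.Binary.Construct.Closure.ReflexiveTransitive as Star
open import Data.List.Membership.DecPropositional _≟_ using (_∈?_)
import Data.Vec as Vec
import Data.Vec.Properties as Vecₚ

-- Labelled graphs joined along a marker

-- `PrunedTreeIsPath` speaks of every standard decomposition and every pruning, so (2) ⇒ (3) starts
-- from an arbitrary sequence of `Step`, while (3) ⇒ (1) has to produce a decomposition. Two
-- operations shape the proof: taking off an arbitrary leaf of the tree (`detach`), and merging two
-- adjacent nodes in order to contradict minimality (`merge`). Neither respects the order in which
-- the splits were made. Decompositions are therefore translated into `Rep` and back
-- (`decomposition-rep`, `rep-decomposition`); the freshness of markers becomes the condition that
-- the two sides of a join share no label but its marker. Primality and distances are never decided.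
-- In (2) ⇒ (3) this costs nothing: the alternative between a path and three leaves is found
-- constructively, and classical facts enter only to refute three leaves.

true≢false : ∀ {b} → b ≡ true → b ≡ false → ⊥
true≢false refl ()

≢true : ∀ {b} → ¬ b ≡ true → b ≡ false
≢true {false} _ = refl
≢true {true}  h = ⊥-elim (h refl)

≢false : ∀ {b} → ¬ b ≡ false → b ≡ true
≢false {true}  _ = refl
≢false {false} h = ⊥-elim (h refl)

∧-true⁻ : ∀ {a b} → a ∧ b ≡ true → a ≡ true × b ≡ true
∧-true⁻ {true} {true} _ = refl , refl

bool-ext : ∀ {a b} → (a ≡ true → b ≡ true) → (b ≡ true → a ≡ true) → a ≡ b
bool-ext {true}  {b}     f _ = ≡-sym (f refl)
bool-ext {false} {false} _ _ = refl
bool-ext {false} {true}  _ g = g refl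

record EdgeOn (H : LGraph) (P : ℕ → Set) (x y : ℕ) : Set where
  constructor edge
  field
    src : P x
    tgt : P y
    isE : ladj H x y ≡ true

ConnOn : LGraph → (ℕ → Set) → Set
ConnOn H P = ∀ {x y} → P x → P y → Star (EdgeOn H P) x y

record Good (H : LGraph) : Set where
  field
    gsym  : ∀ {x y} → x ∈V H → y ∈V H → ladj H x y ≡ ladj H y x
    girr  : ∀ {x} → x ∈V H → ladj H x x ≡ false
    gconn : ConnOn H (_∈V H)
open Good public

-- A piece of a split has two vertices besides its marker. Three distinct vertices express this
-- without naming the marker, so the property survives joins along any marker.
record Big (H : LGraph) : Set where
  constructor big
  field
    {b₁ b₂ b₃} : ℕ
    b₁∈ : b₁ ∈V H
    b₂∈ : b₂ ∈V H
    b₃∈ : b₃ ∈V H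
    b₁≢b₂ : b₁ ≢ b₂
    b₁≢b₃ : b₁ ≢ b₃
    b₂≢b₃ : b₂ ≢ b₃

record TwoBut (H : LGraph) (m : ℕ) : Set where
  constructor twoBut
  field
    {c₁ c₂} : ℕ
    c₁∈ : c₁ ∈V H
    c₂∈ : c₂ ∈V H
    c₁≢m : c₁ ≢ m
    c₂≢m : c₂ ≢ m
    c₁≢c₂ : c₁ ≢ c₂

big-but : ∀ {H} → Big H → ∀ m → TwoBut H m
big-but (big {x} {y} {z} x∈ y∈ z∈ xy xz yz) m with x ≟ m | y ≟ m
... | no x≢ | no y≢ = twoBut x∈ y∈ x≢ y≢ xy
... | no x≢ | yes refl = twoBut x∈ z∈ x≢ (yz ∘ ≡-sym) xz
... | yes refl | no y≢ = twoBut y∈ z∈ y≢ (xz ∘ ≡-sym) yz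
... | yes refl | yes refl = ⊥-elim (xy refl)

-- H has a split whose simple decomposition consists of A and B, with marker m in both.
record IsJoin (m : ℕ) (H A B : LGraph) : Set where
  field
    mA  : m ∈V A
    mB  : m ∈V B
    sep : ∀ {x} → x ∈V A → x ∈V B → x ≡ m
    inA : ∀ {x} → x ∈V A → x ≢ m → x ∈V H
    inB : ∀ {x} → x ∈V B → x ≢ m → x ∈V H
    out : ∀ {x} → x ∈V H → (x ∈V A × x ≢ m) ⊎ (x ∈V B × x ≢ m)
    adjA  : ∀ {x y} → x ∈V A → x ≢ m → y ∈V A → y ≢ m → ladj H x y ≡ ladj A x y
    adjB  : ∀ {x y} → x ∈V B → x ≢ m → y ∈V B → y ≢ m → ladj H x y ≡ ladj B x y
    adjAB : ∀ {x y} → x ∈V A → x ≢ m → y ∈V B → y ≢ m → ladj H x y ≡ ladj A x m ∧ ladj B m y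
    adjBA : ∀ {x y} → x ∈V B → x ≢ m → y ∈V A → y ≢ m → ladj H x y ≡ ladj B x m ∧ ladj A m y

  out≢ : ∀ {x} → x ∈V H → x ≢ m
  out≢ x∈ = [ proj₂ , proj₂ ]′ (out x∈)

join-swap : ∀ {m H A B} → IsJoin m H A B → IsJoin m H B A
join-swap j = record
  { mA = mB ; mB = mA ; sep = λ a b → sep b a ; inA = inB ; inB = inA ; out = Sum.swap ∘ out
  ; adjA = adjB ; adjB = adjA ; adjAB = adjBA ; adjBA = adjAB }
  where open IsJoin j

-- The graph determined by two pieces. Reassociation needs it, because the intermediate graph is
-- then not given in advance.
joinL : ℕ → LGraph → LGraph → LGraph
joinL m A B = record
  { V = filter (λ x → ¬? (x ≟ m)) (V A ++ V B)
  ; ladj = λ x y →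
      if does (x ∈? V A)
      then (if does (y ∈? V A) then ladj A x y else ladj A x m ∧ ladj B m y)
      else (if does (y ∈? V A) then ladj B x m ∧ ladj A m y else ladj B x y) }

joinL-isJoin : ∀ {m A B} → m ∈V A → m ∈V B → (∀ {x} → x ∈V A → x ∈V B → x ≡ m) →
               IsJoin m (joinL m A B) A B
joinL-isJoin {m} {A} {B} mA mB sp = record
  { mA = mA ; mB = mB ; sep = sp
  ; inA = λ x∈ x≢ → ∈-filter⁺ (λ x → ¬? (x ≟ m)) (∈-++⁺ˡ x∈) x≢
  ; inB = λ x∈ x≢ → ∈-filter⁺ (λ x → ¬? (x ≟ m)) (∈-++⁺ʳ (V A) x∈) x≢
  ; out = λ x∈ → let (a , b) = ∈-filter⁻ (λ x → ¬? (x ≟ m)) {xs = V A ++ V B} x∈ in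
                 Sum.map (_, b) (_, b) (∈-++⁻ (V A) a)
  ; adjA = aA ; adjB = aB ; adjAB = aAB ; adjBA = aBA }
  where
  no-A : ∀ {x} → x ∈V B → x ≢ m → ¬ x ∈V A
  no-A xB x≢ xA = x≢ (sp xA xB)
  aA : ∀ {x y} → x ∈V A → x ≢ m → y ∈V A → y ≢ m → ladj (joinL m A B) x y ≡ ladj A x y
  aA {x} {y} xA _ yA _ rewrite dec-true (x ∈? V A) xA | dec-true (y ∈? V A) yA = refl
  aB : ∀ {x y} → x ∈V B → x ≢ m → y ∈V B → y ≢ m → ladj (joinL m A B) x y ≡ ladj B x y
  aB {x} {y} xB x≢ yB y≢
    rewrite dec-false (x ∈? V A) (no-A xB x≢) | dec-false (y ∈? V A) (no-A yB y≢) = refl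
  aAB : ∀ {x y} → x ∈V A → x ≢ m → y ∈V B → y ≢ m →
        ladj (joinL m A B) x y ≡ ladj A x m ∧ ladj B m y
  aAB {x} {y} xA _ yB y≢
    rewrite dec-true (x ∈? V A) xA | dec-false (y ∈? V A) (no-A yB y≢) = refl
  aBA : ∀ {x y} → x ∈V B → x ≢ m → y ∈V A → y ≢ m →
        ladj (joinL m A B) x y ≡ ladj B x m ∧ ladj A m y
  aBA {x} {y} xB x≢ yA _
    rewrite dec-false (x ∈? V A) (no-A xB x≢) | dec-true (y ∈? V A) yA = refl

-- As m lies in `A₂`, the pieces `A₁`, `A₂`, `B` form a path. An edge from `A₁` to `B` requires an
-- edge at m' in `A₁`, the edge m'm in `A₂` and an edge at m in `B`; the two bracketings of this
-- conjunction are the two joins.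
join-assoc : ∀ {m m' H A B A₁ A₂ C} → IsJoin m H A B → IsJoin m' A A₁ A₂ → m ∈V A₂ →
             ¬ m' ∈V B → IsJoin m C A₂ B → IsJoin m' H A₁ C
join-assoc {m} {m'} {H} {A} {B} {A₁} {A₂} {C} j k m∈A₂ m'∉B c = record
  { mA = k.mA ; mB = m'∈C ; sep = sp ; inA = iA ; inB = iB ; out = ot
  ; adjA = λ x∈ x≢ y∈ y≢ → trans (j.adjA (k.inA x∈ x≢) (A₁≢m x∈) (k.inA y∈ y≢) (A₁≢m y∈))
                                 (k.adjA x∈ x≢ y∈ y≢)
  ; adjB = aB ; adjAB = aAB ; adjBA = aBA }
  where
  module j = IsJoin j
  module k = IsJoin k
  module c = IsJoin c
  m≢m' : m ≢ m'
  m≢m' = k.out≢ j.mA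
  m'≢m : m' ≢ m
  m'≢m = m≢m' ∘ ≡-sym
  m'∈C : m' ∈V C
  m'∈C = c.inA k.mB m'≢m
  A₁≢m : ∀ {x} → x ∈V A₁ → x ≢ m
  A₁≢m x∈ refl = m≢m' (k.sep x∈ m∈A₂)
  B≢m' : ∀ {x} → x ∈V B → x ≢ m'
  B≢m' x∈ refl = m'∉B x∈
  sp : ∀ {x} → x ∈V A₁ → x ∈V C → x ≡ m'
  sp {x} x∈ xC with x ≟ m' | c.out xC
  ... | yes e | _ = e
  ... | no x≢ | inj₁ (x2 , _) = k.sep x∈ x2
  ... | no x≢ | inj₂ (xB , x≢m) = ⊥-elim (x≢m (j.sep (k.inA x∈ x≢) xB))
  iA : ∀ {x} → x ∈V A₁ → x ≢ m' → x ∈V H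
  iA x∈ x≢ = j.inA (k.inA x∈ x≢) (A₁≢m x∈)
  iB : ∀ {x} → x ∈V C → x ≢ m' → x ∈V H
  iB xC x≢ with c.out xC
  ... | inj₁ (x2 , x≢m) = j.inA (k.inB x2 x≢) x≢m
  ... | inj₂ (xB , x≢m) = j.inB xB x≢m
  ot : ∀ {x} → x ∈V H → (x ∈V A₁ × x ≢ m') ⊎ (x ∈V C × x ≢ m')
  ot xH with j.out xH
  ... | inj₂ (xB , x≢m) = inj₂ (c.inB xB x≢m , B≢m' xB)
  ... | inj₁ (xA , x≢m) with k.out xA
  ... | inj₁ (x1 , x≢) = inj₁ (x1 , x≢)
  ... | inj₂ (x2 , x≢) = inj₂ (c.inA x2 x≢m , x≢)
  aB : ∀ {x y} → x ∈V C → x ≢ m' → y ∈V C → y ≢ m' → ladj H x y ≡ ladj C x y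
  aB x∈ x≢ y∈ y≢ with c.out x∈ | c.out y∈
  ... | inj₁ (x2 , xm) | inj₁ (y2 , ym) =
    trans (j.adjA (k.inB x2 x≢) xm (k.inB y2 y≢) ym)
          (trans (k.adjB x2 x≢ y2 y≢) (≡-sym (c.adjA x2 xm y2 ym)))
  ... | inj₁ (x2 , xm) | inj₂ (yB , ym) =
    trans (j.adjAB (k.inB x2 x≢) xm yB ym)
          (trans (cong (_∧ ladj B m _) (k.adjB x2 x≢ m∈A₂ m≢m')) (≡-sym (c.adjAB x2 xm yB ym)))
  ... | inj₂ (xB , xm) | inj₁ (y2 , ym) =
    trans (j.adjBA xB xm (k.inB y2 y≢) ym)
          (trans (cong (ladj B _ m ∧_) (k.adjB m∈A₂ m≢m' y2 y≢)) (≡-sym (c.adjBA xB xm y2 ym)))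
  ... | inj₂ (xB , xm) | inj₂ (yB , ym) = trans (j.adjB xB xm yB ym) (≡-sym (c.adjB xB xm yB ym))
  aAB : ∀ {x y} → x ∈V A₁ → x ≢ m' → y ∈V C → y ≢ m' → ladj H x y ≡ ladj A₁ x m' ∧ ladj C m' y
  aAB x∈ x≢ y∈ y≢ with c.out y∈
  ... | inj₁ (y2 , ym) =
    trans (j.adjA (k.inA x∈ x≢) (A₁≢m x∈) (k.inB y2 y≢) ym)
          (trans (k.adjAB x∈ x≢ y2 y≢) (cong (ladj A₁ _ m' ∧_) (≡-sym (c.adjA k.mB m'≢m y2 ym))))
  ... | inj₂ (yB , ym) =
    trans (j.adjAB (k.inA x∈ x≢) (A₁≢m x∈) yB ym)
      (trans (cong (_∧ ladj B m _) (k.adjAB x∈ x≢ m∈A₂ m≢m'))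
        (trans (Boolₚ.∧-assoc (ladj A₁ _ m') _ _)
               (cong (ladj A₁ _ m' ∧_) (≡-sym (c.adjAB k.mB m'≢m yB ym)))))
  aBA : ∀ {x y} → x ∈V C → x ≢ m' → y ∈V A₁ → y ≢ m' → ladj H x y ≡ ladj C x m' ∧ ladj A₁ m' y
  aBA x∈ x≢ y∈ y≢ with c.out x∈
  ... | inj₁ (x2 , xm) =
    trans (j.adjA (k.inB x2 x≢) xm (k.inA y∈ y≢) (A₁≢m y∈))
          (trans (k.adjBA x2 x≢ y∈ y≢) (cong (_∧ ladj A₁ m' _) (≡-sym (c.adjA x2 xm k.mB m'≢m))))
  ... | inj₂ (xB , xm) =
    trans (j.adjBA xB xm (k.inA y∈ y≢) (A₁≢m y∈))
      (trans (cong (ladj B _ m ∧_) (k.adjBA m∈A₂ m≢m' y∈ y≢))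
        (trans (≡-sym (Boolₚ.∧-assoc (ladj B _ m) _ _))
               (cong (_∧ ladj A₁ m' _) (≡-sym (c.adjBA xB xm k.mB m'≢m)))))

big-join : ∀ {m H A B} → IsJoin m H A B → Big A → Big B → Big H
big-join {m} {H} {A} {B} j bA bB with big-but bA m | big-but bB m
... | twoBut x y x≢ y≢ xy | twoBut z w z≢ w≢ zw =
  big (inA x x≢) (inA y y≢) (inB z z≢) xy (disj x z z≢) (disj y z z≢)
  where
  open IsJoin j
  disj : ∀ {u v} → u ∈V A → v ∈V B → v ≢ m → u ≢ v
  disj u∈ v∈ v≢ refl = v≢ (sep u∈ v∈)

-- An induced subgraph up to renaming. Distance heredity and the absence of asteroidal triples are
-- both passed from `H` to `A` along it.
record Emb (A H : LGraph) : Set where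
  field
    f     : ℕ → ℕ
    f∈    : ∀ {x} → x ∈V A → f x ∈V H
    f-inj : ∀ {x y} → x ∈V A → y ∈V A → f x ≡ f y → x ≡ y
    f-adj : ∀ {x y} → x ∈V A → y ∈V A → ladj H (f x) (f y) ≡ ladj A x y

emb-trans : ∀ {A B C} → Emb A B → Emb B C → Emb A C
emb-trans a b = record
  { f = b.f ∘ a.f ; f∈ = b.f∈ ∘ a.f∈
  ; f-inj = λ x y e → a.f-inj x y (b.f-inj (a.f∈ x) (a.f∈ y) e)
  ; f-adj = λ x y → trans (b.f-adj (a.f∈ x) (a.f∈ y)) (a.f-adj x y) }
  where
  module a = Emb a
  module b = Emb b

emb-≅ : ∀ {A B} → A ≅ B → Emb A B
emb-≅ (to , _ , e) = record
  { f = id ; f∈ = to _ ; f-inj = λ _ _ → id ; f-adj = λ x y → ≡-sym (e _ _ x y) }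

emb-star : ∀ {A H} (e : Emb A H) (P Q : ℕ → Set) → (∀ {x} → P x → x ∈V A) →
           (∀ {x} → P x → Q (Emb.f e x)) →
           ∀ {x y} → Star (EdgeOn A P) x y → Star (EdgeOn H Q) (Emb.f e x) (Emb.f e y)
emb-star e P Q inV pq ε = ε
emb-star e P Q inV pq (edge a b c ◅ s) =
  edge (pq a) (pq b) (trans (Emb.f-adj e (inV a) (inV b)) c) ◅ emb-star e P Q inV pq s

neighbour : ∀ {H P a b} → ConnOn H P → P a → P b → a ≢ b → ∃ λ c → P c × ladj H a c ≡ true
neighbour {H} {P} conn pa pb a≢b with conn pa pb
... | ε = ⊥-elim (a≢b refl)
... | edge _ pc e ◅ _ = _ , pc , e

adj⇒≢ : ∀ {H x y} → Good H → x ∈V H → ladj H x y ≡ true → x ≢ y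
adj⇒≢ {H} g x∈ e refl = true≢false e (girr g x∈)

ifDec : ∀ {P A : Set} → Dec P → A → A → A
ifDec (yes _) a b = a
ifDec (no  _) a b = b

swapAt : ℕ → ℕ → ℕ → ℕ
swapAt m t x = ifDec (x ≟ m) t x

swapAt-m : ∀ m t → swapAt m t m ≡ t
swapAt-m m t with m ≟ m
... | yes _ = refl
... | no h  = ⊥-elim (h refl)

swapAt-≢ : ∀ {m t x} → x ≢ m → swapAt m t x ≡ x
swapAt-≢ {m} {t} {x} h with x ≟ m
... | yes e = ⊥-elim (h e)
... | no _  = refl

-- A neighbour of the marker on one side plays the role of the marker for the other side.
joinEmb : ∀ {m H A B t} → IsJoin m H A B → Good A → Good B → t ∈V B → ladj B m t ≡ true → Emb A H
joinEmb {m} {H} {A} {B} {t} j gA gB t∈ mt = record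
  { f = swapAt m t ; f∈ = f∈' ; f-inj = inj ; f-adj = pres }
  where
  open IsJoin j
  t≢m : t ≢ m
  t≢m refl = true≢false mt (girr gB t∈)
  tm : ladj B t m ≡ true
  tm = trans (gsym gB t∈ mB) mt
  f∈' : ∀ {x} → x ∈V A → swapAt m t x ∈V H
  f∈' {x} x∈ with x ≟ m
  ... | yes refl = inB t∈ t≢m
  ... | no x≢ = inA x∈ x≢
  inj : ∀ {x y} → x ∈V A → y ∈V A → swapAt m t x ≡ swapAt m t y → x ≡ y
  inj {x} {y} x∈ y∈ e with x ≟ m | y ≟ m
  ... | yes refl | yes refl = refl
  ... | yes refl | no y≢ = ⊥-elim (t≢m (sep (subst (_∈V A) (≡-sym e) y∈) t∈))
  ... | no x≢ | yes refl = ⊥-elim (t≢m (sep (subst (_∈V A) e x∈) t∈))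
  ... | no _ | no _ = e
  pres : ∀ {x y} → x ∈V A → y ∈V A → ladj H (swapAt m t x) (swapAt m t y) ≡ ladj A x y
  pres {x} {y} x∈ y∈ with x ≟ m | y ≟ m
  ... | yes refl | yes refl = trans (adjB t∈ t≢m t∈ t≢m) (trans (girr gB t∈) (≡-sym (girr gA x∈)))
  ... | yes refl | no y≢ = trans (adjBA t∈ t≢m y∈ y≢) (cong (_∧ ladj A m y) tm)
  ... | no x≢ | yes refl = trans (adjAB x∈ x≢ t∈ t≢m)
                             (trans (cong (ladj A x m ∧_) mt) (Boolₚ.∧-identityʳ _))
  ... | no x≢ | no y≢ = adjA x∈ x≢ y∈ y≢

-- Walks through the marker are rerouted: in `A` a neighbour t of m in `B` replaces m, and in `B` a
-- neighbour s of m in `P` does. A general `P` allows a vertex of `A` to be deleted, as in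
-- `minus-side`.
join-conn : ∀ {m H A B} (P : ℕ → Set) → IsJoin m H A B → Good A → Good B → (∀ {x} → P x → x ∈V A) →
            P m → (∃ λ s → P s × s ≢ m) → ConnOn A P → Big B →
            ConnOn H (λ x → (P x × x ≢ m) ⊎ (x ∈V B × x ≢ m))
join-conn {m} {H} {A} {B} P j gA gB inP pm (s₀ , ps₀ , s₀≢m) conn bB = go
  where
  open IsJoin j
  Q : ℕ → Set
  Q x = (P x × x ≢ m) ⊎ (x ∈V B × x ≢ m)
  nbB = neighbour {B} (gconn gB) mB (TwoBut.c₁∈ (big-but bB m)) (TwoBut.c₁≢m (big-but bB m) ∘ ≡-sym)
  nbA = neighbour conn pm ps₀ (s₀≢m ∘ ≡-sym)
  t = proj₁ nbB
  s = proj₁ nbA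
  t∈ = proj₁ (proj₂ nbB)
  s∈ = proj₁ (proj₂ nbA)
  t≢m : t ≢ m
  t≢m e = adj⇒≢ gB mB (proj₂ (proj₂ nbB)) (≡-sym e)
  s≢m : s ≢ m
  s≢m e = adj⇒≢ gA mA (proj₂ (proj₂ nbA)) (≡-sym e)
  eA = joinEmb j gA gB t∈ (proj₂ (proj₂ nbB))
  eB = joinEmb (join-swap j) gB gA (inP s∈) (proj₂ (proj₂ nbA))
  toQA : ∀ {x} → P x → Q (Emb.f eA x)
  toQA {x} px with x ≟ m
  ... | yes refl = inj₂ (t∈ , t≢m)
  ... | no x≢ = inj₁ (px , x≢)
  toQB : ∀ {x} → x ∈V B → Q (Emb.f eB x)
  toQB {x} px with x ≟ m
  ... | yes refl = inj₁ (s∈ , s≢m)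
  ... | no x≢ = inj₂ (px , x≢)
  viaA : ∀ {x y} → P x → x ≢ m → P y → y ≢ m → Star (EdgeOn H Q) x y
  viaA px x≢ py y≢ with emb-star eA P Q inP toQA (conn px py)
  ... | r rewrite swapAt-≢ {m} {t} x≢ | swapAt-≢ {m} {t} y≢ = r
  viaB : ∀ {x y} → x ∈V B → x ≢ m → y ∈V B → y ≢ m → Star (EdgeOn H Q) x y
  viaB px x≢ py y≢ with emb-star eB (_∈V B) Q id toQB (gconn gB px py)
  ... | r rewrite swapAt-≢ {m} {s} x≢ | swapAt-≢ {m} {s} y≢ = r
  toS : ∀ {x} → x ∈V B → x ≢ m → Star (EdgeOn H Q) x s
  toS px x≢ with emb-star eB (_∈V B) Q id toQB (gconn gB px mB)
  ... | r rewrite swapAt-≢ {m} {s} x≢ | swapAt-m m s = r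
  fromS : ∀ {x} → x ∈V B → x ≢ m → Star (EdgeOn H Q) s x
  fromS px x≢ with emb-star eB (_∈V B) Q id toQB (gconn gB mB px)
  ... | r rewrite swapAt-≢ {m} {s} x≢ | swapAt-m m s = r
  go : ConnOn H Q
  go (inj₁ (px , x≢)) (inj₁ (py , y≢)) = viaA px x≢ py y≢
  go (inj₁ (px , x≢)) (inj₂ (py , y≢)) = viaA px x≢ s∈ s≢m ◅◅ fromS py y≢
  go (inj₂ (px , x≢)) (inj₁ (py , y≢)) = toS px x≢ ◅◅ viaA s∈ s≢m py y≢
  go (inj₂ (px , x≢)) (inj₂ (py , y≢)) = viaB px x≢ py y≢

star-mono : ∀ {H P Q x y} → (∀ {z} → P z → Q z) → Star (EdgeOn H P) x y → Star (EdgeOn H Q) x y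
star-mono pq ε = ε
star-mono pq (edge a b c ◅ s) = edge (pq a) (pq b) c ◅ star-mono pq s

good-join : ∀ {m H A B} → IsJoin m H A B → Good A → Good B → Big A → Big B → Good H
good-join {m} {H} {A} {B} j gA gB bA bB = record { gsym = sy ; girr = ir ; gconn = cn }
  where
  open IsJoin j
  sy : ∀ {x y} → x ∈V H → y ∈V H → ladj H x y ≡ ladj H y x
  sy x∈ y∈ with out x∈ | out y∈
  ... | inj₁ (x , x≢) | inj₁ (y , y≢) =
    trans (adjA x x≢ y y≢) (trans (gsym gA x y) (≡-sym (adjA y y≢ x x≢)))
  ... | inj₂ (x , x≢) | inj₂ (y , y≢) =
    trans (adjB x x≢ y y≢) (trans (gsym gB x y) (≡-sym (adjB y y≢ x x≢)))
  ... | inj₁ (x , x≢) | inj₂ (y , y≢) =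
    trans (adjAB x x≢ y y≢) (trans (cong₂ _∧_ (gsym gA x mA) (gsym gB mB y))
      (trans (Boolₚ.∧-comm (ladj A m _) _) (≡-sym (adjBA y y≢ x x≢))))
  ... | inj₂ (x , x≢) | inj₁ (y , y≢) =
    trans (adjBA x x≢ y y≢) (trans (cong₂ _∧_ (gsym gB x mB) (gsym gA mA y))
      (trans (Boolₚ.∧-comm (ladj B m _) _) (≡-sym (adjAB y y≢ x x≢))))
  ir : ∀ {x} → x ∈V H → ladj H x x ≡ false
  ir x∈ with out x∈
  ... | inj₁ (x , x≢) = trans (adjA x x≢ x x≢) (girr gA x)
  ... | inj₂ (x , x≢) = trans (adjB x x≢ x x≢) (girr gB x)
  cn : ConnOn H (_∈V H)
  cn x∈ y∈ =
    let open TwoBut (big-but bA m) in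
    star-mono [ (λ p → inA (proj₁ p) (proj₂ p)) , (λ p → inB (proj₁ p) (proj₂ p)) ]′
      (join-conn (_∈V A) j gA gB id mA (_ , c₁∈ , c₁≢m) (gconn gA) bB (out x∈) (out y∈))

good-≅ : ∀ {A B} → A ≅ B → Good A → Good B
good-≅ {A} {B} (to , from , e) g = record
  { gsym = λ x y → trans (≡-sym (e _ _ (from _ x) (from _ y)))
                     (trans (gsym g (from _ x) (from _ y)) (e _ _ (from _ y) (from _ x)))
  ; girr = λ x → trans (≡-sym (e _ _ (from _ x) (from _ x))) (girr g (from _ x))
  ; gconn = λ x y → emb-star (emb-≅ {A} {B} (to , from , e)) (_∈V A) (_∈V B) id (to _)
                      (gconn g (from _ x) (from _ y)) }

≅-refl : ∀ {A} → A ≅ A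
≅-refl = (λ _ → id) , (λ _ → id) , λ _ _ _ _ → refl

≅-sym : ∀ {A B} → A ≅ B → B ≅ A
≅-sym (to , from , e) = from , to , λ x y p q → ≡-sym (e x y (from x p) (from y q))

≅-trans : ∀ {A B C} → A ≅ B → B ≅ C → A ≅ C
≅-trans (t₁ , f₁ , e₁) (t₂ , f₂ , e₂) =
  (λ x → t₂ x ∘ t₁ x) , (λ x → f₁ x ∘ f₂ x) , λ x y p q → trans (e₁ x y p q) (e₂ x y (t₁ x p) (t₁ y q))

big-≅ : ∀ {A B} → A ≅ B → Big A → Big B
big-≅ (to , _) (big x y z p q r) = big (to _ x) (to _ y) (to _ z) p q r

join-≅ : ∀ {m H A B A'} → IsJoin m H A B → A ≅ A' → IsJoin m H A' B
join-≅ {m} {H} {A} {B} {A'} j (to , from , e) = record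
  { mA = to _ mA ; mB = mB ; sep = λ x → sep (from _ x) ; inA = λ x → inA (from _ x) ; inB = inB
  ; out = λ x → Sum.map (λ p → to _ (proj₁ p) , proj₂ p) id (out x)
  ; adjA = λ x x≢ y y≢ → trans (adjA (from _ x) x≢ (from _ y) y≢) (e _ _ (from _ x) (from _ y))
  ; adjB = adjB
  ; adjAB = λ x x≢ y y≢ → trans (adjAB (from _ x) x≢ y y≢) (cong (_∧ ladj B m _) (e _ _ (from _ x) mA))
  ; adjBA = λ x x≢ y y≢ → trans (adjBA x x≢ (from _ y) y≢) (cong (ladj B _ m ∧_) (e _ _ mA (from _ y))) }
  where open IsJoin j

join-≅H : ∀ {m H H' A B} → H ≅ H' → IsJoin m H A B → IsJoin m H' A B
join-≅H {m} {H} {H'} {A} {B} (to , from , e) j = record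
  { mA = mA ; mB = mB ; sep = sep ; inA = λ x x≢ → to _ (inA x x≢) ; inB = λ x x≢ → to _ (inB x x≢)
  ; out = λ x → out (from _ x)
  ; adjA = λ x x≢ y y≢ → trans (≡-sym (e _ _ (inA x x≢) (inA y y≢))) (adjA x x≢ y y≢)
  ; adjB = λ x x≢ y y≢ → trans (≡-sym (e _ _ (inB x x≢) (inB y y≢))) (adjB x x≢ y y≢)
  ; adjAB = λ x x≢ y y≢ → trans (≡-sym (e _ _ (inA x x≢) (inB y y≢))) (adjAB x x≢ y y≢)
  ; adjBA = λ x x≢ y y≢ → trans (≡-sym (e _ _ (inB x x≢) (inA y y≢))) (adjBA x x≢ y y≢) }
  where open IsJoin j

-- Decompositions as trees of joins

-- A binary tree of joins with the list of its leaves: a split decomposition of H, kept in a form that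
-- can be reassociated, whereas a derivation by Step fixes the order of the splits.
data Rep : LGraph → List LGraph → Set where
  leaf : ∀ {H K} → Good K → H ≅ K → Rep H [ K ]
  join : ∀ {m H A B D E F} → IsJoin m H A B → Big A → Big B → Rep A D → Rep B E →
         (∀ {x} → Occurs x D → Occurs x E → x ≡ m) → F ↭ D ++ E → Rep H F

rep-perm : ∀ {H D D'} → D ↭ D' → Rep H D → Rep H D'
rep-perm p (leaf g e) with ↭-singleton-inv (↭-sym p)
... | refl = leaf g e
rep-perm p (join j a b r s sp q) = join j a b r s sp (↭-trans (↭-sym p) q)

rep-good : ∀ {H D} → Rep H D → Good H
rep-good {H} (leaf {K = K} g e) = good-≅ {K} {H} (≅-sym {H} {K} e) g
rep-good (join j a b r s sp q) = good-join j (rep-good r) (rep-good s) a b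

rep-V : ∀ {H D x} → Rep H D → x ∈V H → Occurs x D
rep-V (leaf g (to , _)) x∈ = here (to _ x∈)
rep-V (join j a b r s sp q) x∈ with IsJoin.out j x∈
... | inj₁ (xA , _) = Any-resp-↭ (↭-sym q) (Anyₚ.++⁺ˡ (rep-V r xA))
... | inj₂ (xB , _) = Any-resp-↭ (↭-sym q) (Anyₚ.++⁺ʳ _ (rep-V s xB))

rep-allGood : ∀ {H D} → Rep H D → All Good D
rep-allGood (leaf g _) = g ∷ []
rep-allGood (join j a b r s sp q) = All-resp-↭ (↭-sym q) (Allₚ.++⁺ (rep-allGood r) (rep-allGood s))

rep-nonempty : ∀ {H D} → Rep H D → 1 ≤ length D
rep-nonempty (leaf _ _) = s≤s z≤n
rep-nonempty (join {D = D} {E} j a b r s sp q) rewrite ↭-length q | Listₚ.length-++ D {E} =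
  ℕₚ.≤-trans (rep-nonempty r) (ℕₚ.m≤m+n _ _)

rep-single : ∀ {H D L} → Rep H D → D ↭ [ L ] → H ≅ L
rep-single (leaf g e) p with ↭-singleton-inv (↭-sym p)
... | refl = e
rep-single (join {D = D} {E} j a b r s sp q) p with ↭-length (↭-trans (↭-sym p) q)
... | e rewrite Listₚ.length-++ D {E} =
  ⊥-elim (ℕₚ.<-irrefl e (ℕₚ.+-mono-≤ (rep-nonempty r) (rep-nonempty s)))

pick : ∀ {A : Set} {L : A} {R} D {E} → L ∷ R ↭ D ++ E →
       (∃ λ D' → D ↭ L ∷ D' × R ↭ D' ++ E) ⊎ (∃ λ E' → E ↭ L ∷ E' × R ↭ D ++ E')
pick {L = L} {R} D {E} p with ∈-++⁻ D (∈-resp-↭ p (here refl))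
... | inj₁ L∈ with ∈-∃++ L∈
... | X , Y , refl = inj₁ (X ++ Y , shift L X Y , drop-∷ (↭-trans p (Permₚ.++⁺ʳ E (shift L X Y))))
pick {L = L} {R} D {E} p | inj₂ L∈ with ∈-∃++ L∈
... | X , Y , refl = inj₂ (X ++ Y , shift L X Y ,
  drop-∷ (↭-trans p (↭-trans (Permₚ.++⁺ˡ D (shift L X Y)) (shift L D (X ++ Y)))))

data Pick₂ (A B : LGraph) (R D E : List LGraph) : Set where
  both₁ : ∀ D' → D ↭ A ∷ B ∷ D' → R ↭ D' ++ E → Pick₂ A B R D E
  both₂ : ∀ E' → E ↭ A ∷ B ∷ E' → R ↭ E' ++ D → Pick₂ A B R D E
  cross₁ : ∀ D' E' → D ↭ A ∷ D' → E ↭ B ∷ E' → R ↭ D' ++ E' → Pick₂ A B R D E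
  cross₂ : ∀ D' E' → D ↭ B ∷ D' → E ↭ A ∷ E' → R ↭ E' ++ D' → Pick₂ A B R D E

pick₂ : ∀ {A B R} D {E} → A ∷ B ∷ R ↭ D ++ E → Pick₂ A B R D E
pick₂ D {E} p with pick D p
... | inj₁ (D' , d , q) with pick D' q
...   | inj₁ (D'' , d' , q') = both₁ D'' (↭-trans d (prep _ d')) q'
...   | inj₂ (E' , e , q') = cross₁ D' E' d e q'
pick₂ D {E} p | inj₂ (E' , e , q) with pick D q
...   | inj₁ (D' , d , q') = cross₂ D' E' d e (↭-trans q' (Permₚ.++-comm D' E'))
...   | inj₂ (E'' , e' , q') = both₂ E'' (↭-trans e (prep _ e')) (↭-trans q' (Permₚ.++-comm D E''))

occ-pick : ∀ {x} {D : List LGraph} → Occurs x D → ∃₂ λ K R → D ↭ K ∷ R × x ∈V K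
occ-pick {D = K ∷ D} (here x∈) = K , D , ↭-refl , x∈
occ-pick {D = K ∷ D} (there o) with occ-pick o
... | L , R , p , x∈ = L , K ∷ R , ↭-trans (prep K p) (swap K L ↭-refl) , x∈

occ-perm : ∀ {x} {D E : List LGraph} → D ↭ E → Occurs x D → Occurs x E
occ-perm = Any-resp-↭

occˡ : ∀ {x} {D E R : List LGraph} → R ↭ D ++ E → Occurs x D → Occurs x R
occˡ p o = occ-perm (↭-sym p) (Anyₚ.++⁺ˡ o)

occʳ : ∀ {x} D {E R : List LGraph} → R ↭ D ++ E → Occurs x E → Occurs x R
occʳ D p o = occ-perm (↭-sym p) (Anyₚ.++⁺ʳ D o)

swap-++ : ∀ {F} D {E : List LGraph} → F ↭ D ++ E → F ↭ E ++ D
swap-++ D {E} q = ↭-trans q (Permₚ.++-comm D E)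

¬two : ∀ {A : Set} {X Y Z : A} {R} → ¬ ([ X ] ↭ Y ∷ Z ∷ R)
¬two p with ↭-length p
... | ()

record Glue (m : ℕ) (H A B : LGraph) (D E : List LGraph) : Set where
  constructor glue
  field
    j  : IsJoin m H A B
    ba : Big A
    bb : Big B
    r  : Rep A D
    s  : Rep B E
    sp : ∀ {x} → Occurs x D → Occurs x E → x ≡ m
  open IsJoin j public

glue-swap : ∀ {m H A B D E} → Glue m H A B D E → Glue m H B A E D
glue-swap (glue j a b r s sp) = glue (join-swap j) b a s r (λ o o' → sp o' o)

unique-side : ∀ {m H A B D E D' K R x} → Glue m H A B D E → (x ∈V A → ¬ Occurs x D') →
              D ↭ K ∷ D' → R ↭ D' ++ E → x ∈V H → x ∈V K → ¬ Occurs x R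
unique-side {D' = D'} g ih d q x∈ xK o with Glue.out g x∈ | Anyₚ.++⁻ D' (occ-perm q o)
... | inj₂ (xB , x≢) | _ = x≢ (Glue.sp g (occ-perm (↭-sym d) (here xK)) (rep-V (Glue.s g) xB))
... | inj₁ (xA , x≢) | inj₁ o' = ih xA o'
... | inj₁ (xA , x≢) | inj₂ o' = x≢ (Glue.sp g (occ-perm (↭-sym d) (here xK)) o')

-- The two sides of a join share only its marker, and the marker is not a vertex of the joined
-- graph.
rep-unique : ∀ {H D K R x} → Rep H D → D ↭ K ∷ R → x ∈V H → x ∈V K → ¬ Occurs x R
rep-unique (leaf g e) p x∈ xK o with ↭-singleton-inv (↭-sym p)
rep-unique (leaf g e) p x∈ xK () | refl
rep-unique (join {D = D} j a b r s sp q) p x∈ xK with pick D (↭-trans (↭-sym p) q)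
... | inj₁ (D' , d , q') = unique-side (glue j a b r s sp) (λ xA → rep-unique r d xA xK) d q' x∈ xK
... | inj₂ (E' , d , q') =
  unique-side (glue-swap (glue j a b r s sp)) (λ xA → rep-unique s d xA xK) d (swap-++ D q') x∈ xK

-- `L` is a leaf of the decomposition tree whose other nodes are `R`.
record Attached (L : LGraph) (R : List LGraph) : Set where
  constructor attached
  field
    {at} : ℕ
    at∈  : at ∈V L
    occ  : Occurs at R
    only : ∀ {x} → x ∈V L → Occurs x R → x ≡ at

attached-perm : ∀ {L R R'} → R ↭ R' → Attached L R → Attached L R'
attached-perm p (attached m o u) = attached m (occ-perm p o) (λ x o' → u x (occ-perm (↭-sym p) o'))

share-side : ∀ {m H A B D E D' L R} → Glue m H A B D E →
             (∀ {K D''} → D' ≡ K ∷ D'' → ∃ λ x → x ∈V L × Occurs x D') →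
             D ↭ L ∷ D' → R ↭ D' ++ E → ∃ λ x → x ∈V L × Occurs x R
share-side {D' = []} g ih d q =
  _ , proj₁ (rep-single (Glue.r g) d) _ (Glue.mA g) , occ-perm (↭-sym q) (rep-V (Glue.s g) (Glue.mB g))
share-side {D' = K ∷ D'} g ih d q with ih refl
... | x , x∈ , o = x , x∈ , occˡ q o

-- The tree is connected: when `L` is a whole side of a join, the marker of that join is shared, and
-- otherwise the induction stays on the side of `L`.
share : ∀ {H D L K R} → Rep H D → D ↭ L ∷ K ∷ R → ∃ λ x → x ∈V L × Occurs x (K ∷ R)
share (leaf g e) p = ⊥-elim (¬two p)
share (join {D = D} j a b r s sp q) p with pick D (↭-trans (↭-sym p) q)
... | inj₁ (D' , d , q') = share-side (glue j a b r s sp) (λ { refl → share r d }) d q'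
... | inj₂ (E' , d , q') =
  share-side (glue-swap (glue j a b r s sp)) (λ { refl → share s d }) d (swap-++ D q')

node-big-side : ∀ {m H A B D E D' L} → Glue m H A B D E → (∀ {K D''} → D' ≡ K ∷ D'' → Big L) →
                D ↭ L ∷ D' → Big L
node-big-side {A = A} {D' = []} {L} g ih d = big-≅ {A} {L} (rep-single (Glue.r g) d) (Glue.ba g)
node-big-side {D' = K ∷ D'} g ih d = ih refl

node-big : ∀ {H D L K R} → Rep H D → D ↭ L ∷ K ∷ R → Big L
node-big (leaf g e) p = ⊥-elim (¬two p)
node-big (join {D = D} j a b r s sp q) p with pick D (↭-trans (↭-sym p) q)
... | inj₁ (D' , d , q') = node-big-side (glue j a b r s sp) (λ { refl → node-big r d }) d
... | inj₂ (E' , d , q') = node-big-side (glue-swap (glue j a b r s sp)) (λ { refl → node-big s d }) d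

occ-here : ∀ {x K} {D R : List LGraph} → D ↭ K ∷ R → x ∈V K → Occurs x D
occ-here p x∈ = occ-perm (↭-sym p) (here x∈)

occ-there : ∀ {x K} {D R : List LGraph} → D ↭ K ∷ R → Occurs x R → Occurs x D
occ-there p o = occ-perm (↭-sym p) (there o)

share-one : ∀ {H D A B R x y} → Rep H D → D ↭ A ∷ B ∷ R →
            x ∈V A → x ∈V B → y ∈V A → y ∈V B → x ≡ y
share-one (leaf g e) p = ⊥-elim (¬two p)
share-one (join {D = D} j a b r s sp q) p xA xB yA yB with pick₂ D (↭-trans (↭-sym p) q)
... | both₁ _ d _ = share-one r d xA xB yA yB
... | both₂ _ d _ = share-one s d xA xB yA yB
... | cross₁ _ _ d e _ = trans (sp (occ-here d xA) (occ-here e xB)) (≡-sym (sp (occ-here d yA) (occ-here e yB)))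
... | cross₂ _ _ d e _ = trans (sp (occ-here d xB) (occ-here e xA)) (≡-sym (sp (occ-here d yB) (occ-here e yA)))

marker-twice-both : ∀ {m H A B D E D' K L R x} → Glue m H A B D E → ¬ Occurs x D' →
                    D ↭ K ∷ L ∷ D' → R ↭ D' ++ E → x ∈V K → x ∈V L → ¬ Occurs x R
marker-twice-both {D' = D'} g ih d q xK xL o with Anyₚ.++⁻ D' (occ-perm q o)
... | inj₁ o' = ih o'
... | inj₂ o' with Glue.sp g (occ-here d xK) o'
... | refl = rep-unique (Glue.r g) d (Glue.mA g) xK (here xL)

marker-twice-cross : ∀ {m H A B D E D' E' K L R x} → Glue m H A B D E →
                     D ↭ K ∷ D' → E ↭ L ∷ E' → R ↭ D' ++ E' → x ∈V K → x ∈V L → ¬ Occurs x R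
marker-twice-cross {D' = D'} g d e q xK xL o with Glue.sp g (occ-here d xK) (occ-here e xL)
... | refl with Anyₚ.++⁻ D' (occ-perm q o)
... | inj₁ o' = rep-unique (Glue.r g) d (Glue.mA g) xK o'
... | inj₂ o' = rep-unique (Glue.s g) e (Glue.mB g) xL o'

-- Where the two nodes are separated by a join, x is its marker; x is then a vertex of both joined
-- graphs, and `rep-unique` applies on each side.
marker-twice : ∀ {H D A B R x} → Rep H D → D ↭ A ∷ B ∷ R → x ∈V A → x ∈V B → ¬ Occurs x R
marker-twice (leaf g e) p = ⊥-elim (¬two p)
marker-twice (join {D = D} j a b r s sp q) p xA xB with pick₂ D (↭-trans (↭-sym p) q)
... | both₁ _ d q' = marker-twice-both (glue j a b r s sp) (marker-twice r d xA xB) d q' xA xB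
... | both₂ _ d q' = marker-twice-both (glue-swap (glue j a b r s sp)) (marker-twice s d xA xB) d q' xA xB
... | cross₁ D' E' d e q' = marker-twice-cross (glue j a b r s sp) d e q' xA xB
... | cross₂ D' E' d e q' =
  marker-twice-cross (glue j a b r s sp) d e (↭-trans q' (Permₚ.++-comm E' D')) xB xA

record Detached (m : ℕ) (H L : LGraph) (R : List LGraph) : Set where
  field
    {rest} : LGraph
    isJoin : IsJoin m H L rest
    rep    : Rep rest R
    bigL   : Big L
    bigR   : Big rest

-- If `L` is all of its side, the join at hand is the one wanted, and its marker must be the label
-- at which `L` is attached. Otherwise `L` is detached inside `A`, and `join-assoc` moves `B` over
-- to what remains of `A`.
detach-side : ∀ {m H A B D E D' L R} → Glue m H A B D E → (l : Attached L R) →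
              (∀ {K D''} → D' ≡ K ∷ D'' → (l' : Attached L D') → Detached (Attached.at l') A L D') →
              (∀ {K D''} → D' ≡ K ∷ D'' → ∃ λ x → x ∈V L × Occurs x D') →
              D ↭ L ∷ D' → R ↭ D' ++ E → Detached (Attached.at l) H L R
detach-side {m} {A = A} {D' = []} {L} g (attached m∈ o only) ih sh d q
  with only (proj₁ (rep-single g.r d) _ g.mA) (occ-perm (↭-sym q) (rep-V g.s g.mB))
  where module g = Glue g
... | refl = record
  { isJoin = join-≅ g.j (rep-single g.r d) ; rep = rep-perm (↭-sym q) g.s
  ; bigL = big-≅ {A} {L} (rep-single g.r d) g.ba ; bigR = g.bb }
  where module g = Glue g
detach-side {m} {H} {A} {B} {D' = K ∷ D'} {L} g (attached {m'} m∈ o only) ih sh d q = record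
  { isJoin = join-assoc g.j k m∈A' m'∉B c
  ; rep = join c Det.bigR g.bb Det.rep g.s (λ o → g.sp (occ-there d o)) q
  ; bigL = Det.bigL
  ; bigR = big-join c Det.bigR g.bb }
  where
  module g = Glue g
  occ' : Occurs m' (K ∷ D')
  occ' with sh refl
  ... | x , x∈ , ox with only x∈ (occˡ q ox)
  ... | refl = ox
  module Det = Detached (ih refl (attached m∈ occ' (λ x o → only x (occˡ q o))))
  k : IsJoin m' A L Det.rest
  k = Det.isJoin
  m≢m' : m ≢ m'
  m≢m' = IsJoin.out≢ k g.mA
  m∈A' : m ∈V Det.rest
  m∈A' with IsJoin.out k g.mA
  ... | inj₂ (z , _) = z
  ... | inj₁ (z , _) = ⊥-elim (m≢m' (only z (occʳ (K ∷ D') q (rep-V g.s g.mB))))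
  m'∉B : ¬ m' ∈V B
  m'∉B z = m≢m' (≡-sym (g.sp (occ-here d m∈) (rep-V g.s z)))
  sp : ∀ {x} → x ∈V Det.rest → x ∈V B → x ≡ m
  sp {x} x∈ xB = g.sep (IsJoin.inB k x∈ (λ { refl → m'∉B xB })) xB
  c = joinL-isJoin {m} {Det.rest} {B} m∈A' g.mB sp

-- Reassociating the joins, a leaf of the tree can be joined last.
detach : ∀ {H D L R} → Rep H D → D ↭ L ∷ R → (l : Attached L R) → Detached (Attached.at l) H L R
detach (leaf g e) p l with ↭-singleton-inv (↭-sym p)
detach (leaf g e) p (attached _ () _) | refl
detach (join {D = D} j a b r s sp q) p l with pick D (↭-trans (↭-sym p) q)
... | inj₁ (D' , d , q') =
  detach-side (glue j a b r s sp) l (λ { refl → detach r d }) (λ { refl → share r d }) d q'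
... | inj₂ (E' , d , q') =
  detach-side (glue-swap (glue j a b r s sp)) l (λ { refl → detach s d }) (λ { refl → share s d }) d
    (swap-++ D q')

HasLeafAvoiding : ℕ → List LGraph → Set
HasLeafAvoiding x F = ∃₂ λ L R → F ↭ L ∷ R × Attached L R × ¬ x ∈V L

leaf-side : ∀ {m H A B D E F x} → Glue m H A B D E → F ↭ D ++ E → x ∈V A → x ≢ m →
            (2 ≤ length E → HasLeafAvoiding m E) → HasLeafAvoiding x F
leaf-side {E = []} g q xA x≢ ih = ⊥-elim (case rep-nonempty (Glue.s g) of λ ())
leaf-side {D = D} {L ∷ []} g q xA x≢ ih =
  L , D , swap-++ D q ,
  attached (proj₁ (rep-single g.s ↭-refl) _ g.mB) (rep-V g.r g.mA) (λ y o → g.sp o (here y)) ,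
  λ xL → x≢ (g.sp (rep-V g.r xA) (here xL))
  where module g = Glue g
leaf-side {m} {D = D} {E@(_ ∷ _ ∷ _)} {x = x} g q xA x≢ ih with ih (s≤s (s≤s z≤n))
... | L , E' , e , attached {y} y∈ o u , m∉ =
  L , D ++ E' , ↭-trans q (↭-trans (Permₚ.++⁺ˡ D e) (shift L D E')) ,
  attached y∈ (Anyₚ.++⁺ʳ D o)
    (λ z∈ → [ (λ oD → ⊥-elim (m∉ (subst (_∈V L) (g.sp oD (occ-here e z∈)) z∈))) , u z∈ ]′ ∘ Anyₚ.++⁻ D) ,
  λ xL → x≢ (g.sp (rep-V g.r xA) (occ-here e xL))
  where module g = Glue g

-- Avoiding x is what makes the induction work: on the side without x one asks for a leaf that
-- avoids the marker of the join, so that gluing the other side back does not touch it.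
leaf-avoiding : ∀ {H D x} → Rep H D → 2 ≤ length D → x ∈V H → HasLeafAvoiding x D
leaf-avoiding (leaf _ _) (s≤s ()) _
leaf-avoiding (join {D = D} j a b r s sp q) l x∈ with IsJoin.out j x∈
... | inj₁ (xA , x≢) = leaf-side g q xA x≢ (λ l → leaf-avoiding s l (IsJoin.mB j))
  where g = glue j a b r s sp
... | inj₂ (xB , x≢) = leaf-side g (swap-++ D q) xB x≢ (λ l → leaf-avoiding r l (IsJoin.mA j))
  where g = glue-swap (glue j a b r s sp)

rep-has-vertex : ∀ {H D} → Rep H D → 2 ≤ length D → ∃ λ x → x ∈V H
rep-has-vertex (leaf _ _) (s≤s ())
rep-has-vertex (join j a b _ _ _ _) _ = _ , Big.b₁∈ (big-join j a b)

refine-side : ∀ {m H A B D E F D' K K₁ K₂ R x} → Glue m H A B D E → IsJoin x K K₁ K₂ →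
              ¬ Occurs x F → F ↭ D ++ E → D ↭ K ∷ D' → R ↭ D' ++ E → Rep A (K₁ ∷ K₂ ∷ D') →
              Rep H (K₁ ∷ K₂ ∷ R)
refine-side {m} {D = D} {E} {D' = D'} {K} {K₁} {K₂} {x = x} g k fr q d q' rep =
  join g.j g.ba g.bb rep g.s sp (prep _ (prep _ q'))
  where
  module g = Glue g
  piece : ∀ {y} → Occurs y E → (y ≢ x → y ∈V K) → y ≡ m
  piece {y} o f with y ≟ x
  ... | yes refl = ⊥-elim (fr (occʳ D q o))
  ... | no y≢ = g.sp (occ-here d (f y≢)) o
  sp : ∀ {y} → Occurs y (K₁ ∷ K₂ ∷ D') → Occurs y E → y ≡ m
  sp (here y∈) o = piece o (IsJoin.inA k y∈)
  sp (there (here y∈)) o = piece o (IsJoin.inB k y∈)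
  sp (there (there o')) o = g.sp (occ-there d o') o

-- The effect of one `Step`: the leaf of the tree of joins that holds `K` becomes a join. As x is
-- fresh, the joins above still separate their labels.
refine : ∀ {H D K K₁ K₂ R x} → Rep H D → D ↭ K ∷ R → IsJoin x K K₁ K₂ → Big K₁ → Big K₂ →
         Good K₁ → Good K₂ → ¬ Occurs x D → Rep H (K₁ ∷ K₂ ∷ R)
refine {H} {K = K} (leaf g e) p k b₁ b₂ g₁ g₂ fr with ↭-singleton-inv (↭-sym p)
... | refl = join (join-≅H (≅-sym {H} {K} e) k) b₁ b₂ (leaf g₁ ≅-refl) (leaf g₂ ≅-refl)
                  (λ { (here y) (here z) → IsJoin.sep k y z }) ↭-refl
refine (join {D = D} j a b r s sp q) p k b₁ b₂ g₁ g₂ fr with pick D (↭-trans (↭-sym p) q)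
... | inj₁ (D' , d , q') = refine-side (glue j a b r s sp) k fr q d q'
        (refine r d k b₁ b₂ g₁ g₂ (fr ∘ occˡ q))
... | inj₂ (E' , d , q') = refine-side (glue-swap (glue j a b r s sp)) k fr (swap-++ D q) d (swap-++ D q')
        (refine s d k b₁ b₂ g₁ g₂ (fr ∘ occʳ D q))

join-functional : ∀ {m H H' A B} → IsJoin m H A B → IsJoin m H' A B → H ≅ H'
join-functional {m} {H} {H'} {A} {B} j k = (λ _ → to j k) , (λ _ → to k j) , adjEq
  where
  to : ∀ {H H'} → IsJoin m H A B → IsJoin m H' A B → ∀ {x} → x ∈V H → x ∈V H'
  to j k x∈ with IsJoin.out j x∈
  ... | inj₁ (a , n) = IsJoin.inA k a n
  ... | inj₂ (b , n) = IsJoin.inB k b n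
  adjEq : ∀ x y → x ∈V H → y ∈V H → ladj H x y ≡ ladj H' x y
  adjEq x y x∈ y∈ with IsJoin.out j x∈ | IsJoin.out j y∈
  ... | inj₁ (a , n) | inj₁ (b , n') = trans (IsJoin.adjA j a n b n') (≡-sym (IsJoin.adjA k a n b n'))
  ... | inj₁ (a , n) | inj₂ (b , n') = trans (IsJoin.adjAB j a n b n') (≡-sym (IsJoin.adjAB k a n b n'))
  ... | inj₂ (a , n) | inj₁ (b , n') = trans (IsJoin.adjBA j a n b n') (≡-sym (IsJoin.adjBA k a n b n'))
  ... | inj₂ (a , n) | inj₂ (b , n') = trans (IsJoin.adjB j a n b n') (≡-sym (IsJoin.adjB k a n b n'))

-- Y is to be joined along m with a graph having A as a node: the join is pushed down to A, where it
-- is assumed to decompose into K and RY. The labels DY bound those of Y and of its decomposition.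
record Pushing (m : ℕ) (A Y K : LGraph) (RY DY : List LGraph) : Set where
  field
    m∈A   : m ∈V A
    bigY  : Big Y
    baseRep : ∀ C → IsJoin m C A Y → Rep C (K ∷ RY)
    bound : ∀ {x} → Occurs x (K ∷ RY) → x ∈V A ⊎ Occurs x DY
    Y⊆DY  : ∀ {x} → x ∈V Y → Occurs x DY

push-side : ∀ {m m₂ A Y K RY DY D E D' H X X₁ X₂ R} → Pushing m A Y K RY DY → Glue m₂ X X₁ X₂ D E →
            D ↭ A ∷ D' → R ↭ D' ++ E →
            (∀ {x} → Occurs x D ⊎ Occurs x E → Occurs x DY → x ≡ m) → IsJoin m H X Y →
            (∀ C → m ∈V X₁ → IsJoin m C X₁ Y → Rep C (K ∷ (D' ++ RY))) → Rep H (K ∷ (R ++ RY))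
push-side {m} {m₂} {A} {Y} {K} {RY} {DY} {D} {E} {D'} {X₁ = X₁} P g d q spY j ih =
  join (join-swap (join-assoc j (join-swap g.j) m∈X₁ m₂∉Y c)) (big-join c g.ba P.bigY) g.bb
       (ih _ m∈X₁ c) g.s sp
       (prep K (↭-trans (Permₚ.++⁺ʳ RY q)
         (↭-trans (Permₚ.++-assoc D' E RY)
           (↭-trans (Permₚ.++⁺ˡ D' (Permₚ.++-comm E RY)) (↭-sym (Permₚ.++-assoc D' RY E))))))
  where
  module P = Pushing P
  module g = Glue g
  module j = IsJoin j
  m≢m₂ : m ≢ m₂
  m≢m₂ = g.out≢ j.mA
  m∈X₁ : m ∈V X₁
  m∈X₁ with g.out j.mA
  ... | inj₁ (z , _) = z
  ... | inj₂ (z , n) = ⊥-elim (n (g.sp (occ-here d P.m∈A) (rep-V g.s z)))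
  m₂∉Y : ¬ m₂ ∈V Y
  m₂∉Y z = m≢m₂ (≡-sym (spY (inj₁ (rep-V g.r g.mA)) (P.Y⊆DY z)))
  sepY : ∀ {x} → x ∈V X₁ → x ∈V Y → x ≡ m
  sepY x∈ xY = j.sep (g.inA x∈ (λ { refl → m₂∉Y xY })) xY
  c = joinL-isJoin {m} {X₁} {Y} m∈X₁ j.mB sepY
  fromY : ∀ {x} → Occurs x DY → Occurs x E → x ≡ m₂
  fromY o o' with spY (inj₂ o') o
  ... | refl = g.sp (occ-here d P.m∈A) o'
  fromK : ∀ {x} → Occurs x (K ∷ RY) → Occurs x E → x ≡ m₂
  fromK o o' with P.bound o
  ... | inj₁ xA = g.sp (occ-here d xA) o'
  ... | inj₂ oY = fromY oY o'
  sp : ∀ {x} → Occurs x (K ∷ (D' ++ RY)) → Occurs x E → x ≡ m₂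
  sp (here z) o = fromK (here z) o
  sp (there o') o with Anyₚ.++⁻ D' o'
  ... | inj₁ z = g.sp (occ-there d z) o
  ... | inj₂ z = fromK (there z) o

-- Induction on the joins of `X` above `A`. At each of them `join-assoc` sets the side without `A`
-- apart, and `Y` moves on into the side with `A`, which contains m.
push : ∀ {m A Y K RY DY DX RX H X} → Pushing m A Y K RY DY → Rep X DX → DX ↭ A ∷ RX →
       (∀ {x} → Occurs x DX → Occurs x DY → x ≡ m) → IsJoin m H X Y → Rep H (K ∷ (RX ++ RY))
push P (leaf g e) p spY j with ↭-singleton-inv (↭-sym p)
... | refl = Pushing.baseRep P _ (join-≅ j e)
push {RY = RY} P (join {D = D} {E} i a b r s sp q) p spY j with pick D (↭-trans (↭-sym p) q)
... | inj₁ (D' , d , q') =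
  push-side P (glue i a b r s sp) d q' (λ { (inj₁ o) → spY (occˡ q o) ; (inj₂ o) → spY (occʳ D q o) }) j
    (λ C m∈ c → push P r d (spY ∘ occˡ q) c)
... | inj₂ (E' , d , q') =
  push-side P (glue-swap (glue i a b r s sp)) d (swap-++ D q')
    (λ { (inj₁ o) → spY (occʳ D q o) ; (inj₂ o) → spY (occˡ q o) }) j
    (λ C m∈ c → push P s d (spY ∘ occʳ D q) c)

-- Two pushes, one inside the other: `P₁` takes the whole of `Y` down through `X` to the node `A`;
-- there `P₂` takes `A` down through `Y` to the node `B`, where the two join to `K`.
merge-cross : ∀ {m H A B X Y D E D' E' K} → Glue m H X Y D E → D ↭ A ∷ D' → E ↭ B ∷ E' →
              m ∈V A → m ∈V B → Big A → Big B → Good A → Good B → IsJoin m K A B →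
              Rep H (K ∷ (D' ++ E'))
merge-cross {m} {A = A} {B} {X} {Y} {D} {E} {D'} {E'} {K} g d e mA mB bA bB gA gB k =
  push P₁ g.r d g.sp g.j
  where
  module g = Glue g
  P₂ : Pushing m B A K [] [ A ]
  P₂ = record
    { m∈A = mB ; bigY = bA
    ; baseRep = λ C c → leaf (good-join k gA gB bA bB) (join-functional (join-swap c) k)
    ; bound = λ { (here x) → [ (λ p → inj₂ (here (proj₁ p))) , inj₁ ∘ proj₁ ]′ (IsJoin.out k x) }
    ; Y⊆DY = here }
  P₁ : Pushing m A Y K E' E
  P₁ = record
    { m∈A = mA ; bigY = g.bb
    ; baseRep = λ C c → subst (λ Z → Rep C (K ∷ Z)) (Listₚ.++-identityʳ E')
               (push P₂ g.s e (λ { o (here x) → g.sp (occ-here d x) o }) (join-swap c))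
    ; bound = λ { (here x) → [ inj₁ ∘ proj₁ , (λ p → inj₂ (occ-here e (proj₁ p))) ]′ (IsJoin.out k x)
                ; (there o) → inj₂ (occ-there e o) }
    ; Y⊆DY = rep-V g.s }

merge-both : ∀ {m H A B X Y D E D' R K} → Glue m H X Y D E → D ↭ A ∷ B ∷ D' → R ↭ D' ++ E →
             ∀ {x} → IsJoin x K A B → Rep X (K ∷ D') → Rep H (K ∷ R)
merge-both {m} {D = D} {E} {D'} {K = K} g d q k rep = join g.j g.ba g.bb rep g.s sp (prep K q)
  where
  module g = Glue g
  sp : ∀ {y} → Occurs y (K ∷ D') → Occurs y E → y ≡ m
  sp (there o') o = g.sp (occ-perm (↭-sym d) (there (there o'))) o
  sp (here y∈) o with IsJoin.out k y∈
  ... | inj₁ (z , _) = g.sp (occ-here d z) o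
  ... | inj₂ (z , _) = g.sp (occ-perm (↭-sym d) (there (here z))) o

merge : ∀ {H D A B R K m} → Rep H D → D ↭ A ∷ B ∷ R → m ∈V A → m ∈V B → Big A → Big B →
        Good A → Good B → IsJoin m K A B → Rep H (K ∷ R)
merge (leaf g e) p = ⊥-elim (¬two p)
merge {K = K} (join {D = D} j a b r s sp q) p mA mB bA bB gA gB k with pick₂ D (↭-trans (↭-sym p) q)
... | both₁ _ d q' = merge-both (glue j a b r s sp) d q' k (merge r d mA mB bA bB gA gB k)
... | both₂ _ d q' = merge-both (glue-swap (glue j a b r s sp)) d q' k (merge s d mA mB bA bB gA gB k)
... | cross₁ D' E' d e q' with sp (occ-here d mA) (occ-here e mB)
...   | refl = rep-perm (prep K (↭-sym q')) (merge-cross (glue j a b r s sp) d e mA mB bA bB gA gB k)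
merge {K = K} (join {D = D} j a b r s sp q) p mA mB bA bB gA gB k | cross₂ D' E' d e q'
  with sp (occ-here d mB) (occ-here e mA)
... | refl = rep-perm (prep K (↭-sym q'))
               (merge-cross (glue-swap (glue j a b r s sp)) e d mA mB bA bB gA gB k)

-- Simple decompositions are joins

T⇒≡true : ∀ {b} → T b → b ≡ true
T⇒≡true {true} _ = refl

≡true⇒T : ∀ {b} → b ≡ true → T b
≡true⇒T refl = tt

∈-filterᵇ⁺ : ∀ (p : ℕ → Bool) {xs x} → x ∈ xs → p x ≡ true → x ∈ filterᵇ p xs
∈-filterᵇ⁺ p x∈ e = ∈-filter⁺ (T? ∘ p) x∈ (≡true⇒T e)

∈-filterᵇ⁻ : ∀ (p : ℕ → Bool) {xs x} → x ∈ filterᵇ p xs → x ∈ xs × p x ≡ true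
∈-filterᵇ⁻ p {xs} x∈ = let (a , b) = ∈-filter⁻ (T? ∘ p) {xs = xs} x∈ in a , T⇒≡true b

not-true : ∀ {b} → b ≡ false → not b ≡ true
not-true refl = refl

not-true⁻ : ∀ {b} → not b ≡ true → b ≡ false
not-true⁻ {false} _ = refl

adjTo⁺ : ∀ H {W y w} → w ∈ W → ladj H y w ≡ true → adjTo H W y ≡ true
adjTo⁺ H {W = w ∷ _} (here refl) e rewrite e = refl
adjTo⁺ H {W = v ∷ _} {y} (there w∈) e with ladj H y v
... | true = refl
... | false = adjTo⁺ H w∈ e

adjTo⁻ : ∀ H W {y} → adjTo H W y ≡ true → ∃ λ w → w ∈ W × ladj H y w ≡ true
adjTo⁻ H (v ∷ W) {y} e with ladj H y v in eq
... | true = v , here refl , eq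
... | false with adjTo⁻ H W e
... | w , w∈ , e' = w , there w∈ , e'

two-of : ∀ {xs : List ℕ} {x y} → x ∈ xs → y ∈ xs → x ≢ y → 2 ≤ length xs
two-of {_ ∷ []} (here refl) (here refl) n = ⊥-elim (n refl)
two-of {_ ∷ _ ∷ _} _ _ _ = s≤s (s≤s z≤n)

unique-two : ∀ {xs : List ℕ} → Unique xs → 2 ≤ length xs → ∃₂ λ x y → x ∈ xs × y ∈ xs × x ≢ y
unique-two {x ∷ []} _ (s≤s ())
unique-two {x ∷ y ∷ _} ((p ∷ _) ∷ _) _ = x , y , here refl , there (here refl) , p

≡ᵇ-refl : ∀ x → (x ≡ᵇ x) ≡ true
≡ᵇ-refl zero = refl
≡ᵇ-refl (suc x) = ≡ᵇ-refl x

≡ᵇ-≢ : ∀ {x y} → x ≢ y → (x ≡ᵇ y) ≡ false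
≡ᵇ-≢ {zero} {zero} h = ⊥-elim (h refl)
≡ᵇ-≢ {zero} {suc _} h = refl
≡ᵇ-≢ {suc _} {zero} h = refl
≡ᵇ-≢ {suc x} {suc y} h = ≡ᵇ-≢ (h ∘ cong suc)

module _ (H : LGraph) (W W' : List ℕ) (m : ℕ) where
  marker-loop : ladj (withMarker H W W' m) m m ≡ false
  marker-loop rewrite ≡ᵇ-refl m = refl
  marker-row : ∀ {y} → y ≢ m → ladj (withMarker H W W' m) m y ≡ adjTo H W' y
  marker-row h rewrite ≡ᵇ-refl m | ≡ᵇ-≢ h = refl
  marker-column : ∀ {y} → y ≢ m → ladj (withMarker H W W' m) y m ≡ adjTo H W' y
  marker-column h rewrite ≡ᵇ-refl m | ≡ᵇ-≢ h = refl
  unmarked : ∀ {x y} → x ≢ m → y ≢ m → ladj (withMarker H W W' m) x y ≡ ladj H x y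
  unmarked h h' rewrite ≡ᵇ-≢ h | ≡ᵇ-≢ h' = refl

record Parts (H : LGraph) (W W' : List ℕ) : Set where
  field
    W⊆    : ∀ {x} → x ∈ W → x ∈V H
    W'⊆   : ∀ {x} → x ∈ W' → x ∈V H
    cover : ∀ {x} → x ∈V H → x ∈ W ⊎ x ∈ W'
    disj  : ∀ {x} → x ∈ W → ¬ x ∈ W'
    w₀    : ∃ (_∈ W')
    twoW  : ∃₂ λ x y → x ∈ W × y ∈ W × x ≢ y
    uW    : Unique W

module _ {H : LGraph} (good : Good H) {W W' : List ℕ} (P : Parts H W W') {m : ℕ} (m∉ : ¬ m ∈V H) where
  open Parts P
  private
    A = withMarker H W W' m
    ≢m : ∀ {x} → x ∈V H → x ≢ m
    ≢m x∈ refl = m∉ x∈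

  piece-big : Big A
  piece-big = let (_ , _ , x∈ , y∈ , n) = twoW in
    big (here refl) (there x∈) (there y∈) (≢m (W⊆ x∈) ∘ ≡-sym) (≢m (W⊆ y∈) ∘ ≡-sym) n

  piece-unique : Unique (V A)
  piece-unique = All.tabulate (λ x∈ e → m∉ (subst (_∈V H) (≡-sym e) (W⊆ x∈))) ∷ uW

  piece-good : Good A
  piece-good = record { gsym = sy ; girr = ir ; gconn = cn }
    where
    sy : ∀ {x y} → x ∈V A → y ∈V A → ladj A x y ≡ ladj A y x
    sy (here refl) (here refl) = refl
    sy (here refl) (there y∈) =
      trans (marker-row H W W' m (≢m (W⊆ y∈))) (≡-sym (marker-column H W W' m (≢m (W⊆ y∈))))
    sy (there x∈) (here refl) =
      trans (marker-column H W W' m (≢m (W⊆ x∈))) (≡-sym (marker-row H W W' m (≢m (W⊆ x∈))))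
    sy (there x∈) (there y∈) =
      trans (unmarked H W W' m (≢m (W⊆ x∈)) (≢m (W⊆ y∈)))
        (trans (gsym good (W⊆ x∈) (W⊆ y∈)) (≡-sym (unmarked H W W' m (≢m (W⊆ y∈)) (≢m (W⊆ x∈)))))
    ir : ∀ {x} → x ∈V A → ladj A x x ≡ false
    ir (here refl) = marker-loop H W W' m
    ir (there x∈) = trans (unmarked H W W' m (≢m (W⊆ x∈)) (≢m (W⊆ x∈))) (girr good (W⊆ x∈))
    -- Contracting `W'` to the marker turns walks of `H` into walks of the piece, which shows that
    -- the piece is connected.
    data Image : ℕ → ℕ → Set where
      kept : ∀ {x} → x ∈ W → Image x x
      sent : ∀ {x} → x ∈ W' → Image x m
    image : ∀ {x} → x ∈V H → ∃ (Image x)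
    image x∈ = [ (λ p → _ , kept p) , (λ p → _ , sent p) ]′ (cover x∈)
    image-one : ∀ {x y z} → Image x y → Image x z → y ≡ z
    image-one (kept _) (kept _) = refl
    image-one (kept p) (sent q) = ⊥-elim (disj p q)
    image-one (sent p) (kept q) = ⊥-elim (disj q p)
    image-one (sent _) (sent _) = refl
    walk : ∀ {x y x' y'} → Star (EdgeOn H (_∈V H)) x y → Image x x' → Image y y' →
           Star (EdgeOn A (_∈V A)) x' y'
    walk ε i i' with image-one i i'
    ... | refl = ε
    walk (edge a b e ◅ s) (kept p) i' with cover b
    ... | inj₁ q = edge (there p) (there q) (trans (unmarked H W W' m (≢m a) (≢m b)) e) ◅ walk s (kept q) i'
    ... | inj₂ q = edge (there p) (here refl) (trans (marker-column H W W' m (≢m a)) (adjTo⁺ H q e)) ◅ walk s (sent q) i'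
    walk (edge a b e ◅ s) (sent p) i' with cover b
    ... | inj₁ q = edge (here refl) (there q)
                     (trans (marker-row H W W' m (≢m b)) (adjTo⁺ H p (trans (gsym good b a) e))) ◅ walk s (kept q) i'
    ... | inj₂ q = walk s (sent q) i'
    pre : ∀ {x} → x ∈V A → ∃ λ x₀ → x₀ ∈V H × Image x₀ x
    pre (here refl) = proj₁ w₀ , W'⊆ (proj₂ w₀) , sent (proj₂ w₀)
    pre (there x∈) = _ , W⊆ x∈ , kept x∈
    cn : ConnOn A (_∈V A)
    cn x∈ y∈ with pre x∈ | pre y∈
    ... | _ , a , i | _ , b , i' = walk (gconn good a b) i i'

parts-join : ∀ {H W W' m} → Good H → Parts H W W' → Parts H W' W → ¬ m ∈V H →
             (∀ {x y} → x ∈ W → y ∈ W' → ladj H x y ≡ adjTo H W' x ∧ adjTo H W y) →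
             IsJoin m H (withMarker H W W' m) (withMarker H W' W m)
parts-join {H} {W} {W'} {m} good P Q m∉ sp = record
  { mA = here refl ; mB = here refl ; sep = sep'
  ; inA = λ { (here e) n → ⊥-elim (n e) ; (there x∈) _ → W⊆ x∈ }
  ; inB = λ { (here e) n → ⊥-elim (n e) ; (there x∈) _ → W'⊆ x∈ }
  ; out = λ x∈ → Sum.map (λ p → there p , ≢m x∈) (λ p → there p , ≢m x∈) (cover x∈)
  ; adjA = λ _ n _ n' → ≡-sym (unmarked H W W' m n n')
  ; adjB = λ _ n _ n' → ≡-sym (unmarked H W' W m n n')
  ; adjAB = ab ; adjBA = ba }
  where
  open Parts P
  A = withMarker H W W' m
  B = withMarker H W' W m
  ≢m : ∀ {x} → x ∈V H → x ≢ m
  ≢m x∈ refl = m∉ x∈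
  sep' : ∀ {x} → x ∈V A → x ∈V B → x ≡ m
  sep' (here e) _ = e
  sep' (there _) (here e) = e
  sep' (there p) (there q) = ⊥-elim (disj p q)
  ab : ∀ {x y} → x ∈V A → x ≢ m → y ∈V B → y ≢ m → ladj H x y ≡ ladj A x m ∧ ladj B m y
  ab (here e) n _ _ = ⊥-elim (n e)
  ab (there _) _ (here e) n = ⊥-elim (n e)
  ab (there p) n (there q) n' = trans (sp p q) (cong₂ _∧_ (≡-sym (marker-column H W W' m n)) (≡-sym (marker-row H W' W m n')))
  ba : ∀ {x y} → x ∈V B → x ≢ m → y ∈V A → y ≢ m → ladj H x y ≡ ladj B x m ∧ ladj A m y
  ba (here e) n _ _ = ⊥-elim (n e)
  ba (there _) _ (here e) n = ⊥-elim (n e)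
  ba {x} {y} (there p) n (there q) n' =
    trans (gsym good (W'⊆ p) (W⊆ q)) (trans (sp q p)
      (trans (Boolₚ.∧-comm (adjTo H W' y) _) (cong₂ _∧_ (≡-sym (marker-column H W' W m n)) (≡-sym (marker-row H W W' m n')))))

module _ {H : LGraph} (good : Good H) (u : Unique (V H)) {side : ℕ → Bool} (isS : IsSplit H side)
         {m : ℕ} (m∉ : ¬ m ∈V H) where
  private
    W = V₁ H side
    W' = V₂ H side
    len = proj₁ isS
    len' = proj₁ (proj₂ isS)
    cond = proj₂ (proj₂ isS)
    uW : Unique W
    uW = Uniqueₚ.filter⁺ (T? ∘ side) u
    uW' : Unique W'
    uW' = Uniqueₚ.filter⁺ (T? ∘ not ∘ side) u
    cover₁ : ∀ {x} → x ∈V H → x ∈ W ⊎ x ∈ W'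
    cover₁ {x} x∈ with side x in eq
    ... | true = inj₁ (∈-filterᵇ⁺ side x∈ eq)
    ... | false = inj₂ (∈-filterᵇ⁺ (not ∘ side) x∈ (not-true eq))
    disj₁ : ∀ {x} → x ∈ W → ¬ x ∈ W'
    disj₁ p q = true≢false (proj₂ (∈-filterᵇ⁻ side {V H} p)) (not-true⁻ (proj₂ (∈-filterᵇ⁻ (not ∘ side) {V H} q)))
    two = unique-two uW len
    two' = unique-two uW' len'

  split-parts₁ : Parts H W W'
  split-parts₁ = record
    { W⊆ = proj₁ ∘ ∈-filterᵇ⁻ side ; W'⊆ = proj₁ ∘ ∈-filterᵇ⁻ (not ∘ side)
    ; cover = cover₁ ; disj = disj₁ ; w₀ = _ , proj₁ (proj₂ (proj₂ two')) ; twoW = two ; uW = uW }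

  split-parts₂ : Parts H W' W
  split-parts₂ = record
    { W⊆ = proj₁ ∘ ∈-filterᵇ⁻ (not ∘ side) ; W'⊆ = proj₁ ∘ ∈-filterᵇ⁻ side
    ; cover = Sum.swap ∘ cover₁ ; disj = λ p q → disj₁ q p
    ; w₀ = _ , proj₁ (proj₂ (proj₂ two)) ; twoW = two' ; uW = uW' }

  split-join : IsJoin m H (piece₁ H side m) (piece₂ H side m)
  split-join = parts-join good split-parts₁ split-parts₂ m∉ λ {x} {y} p q →
    bool-ext (λ e → let (a , b) = proj₁ (cond x y p q) e in cong₂ _∧_ a b)
             (λ e → proj₂ (cond x y p q) (∧-true⁻ e))

step-rep : ∀ {H D D'} → Rep H D → All (Unique ∘ V) D → Step D D' → Rep H D' × All (Unique ∘ V) D'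
step-rep r us (split pre post K side m isS fr) =
  rep-perm (↭-sym (↭-trans (shift P₁ pre (P₂ ∷ post)) (prep P₁ (shift P₂ pre post))))
    (refine r (shift K pre post) (split-join gK uK isS m∉)
      (piece-big gK S₁ m∉) (piece-big gK S₂ m∉) (piece-good gK S₁ m∉) (piece-good gK S₂ m∉) fr) ,
  Allₚ.++⁺ (Allₚ.++⁻ˡ pre us)
    (piece-unique gK S₁ m∉ ∷ piece-unique gK S₂ m∉ ∷ All.tail (Allₚ.++⁻ʳ pre us))
  where
  P₁ = piece₁ K side m
  P₂ = piece₂ K side m
  gK : Good K
  gK = All.head (Allₚ.++⁻ʳ pre (rep-allGood r))
  uK : Unique (V K)
  uK = All.head (Allₚ.++⁻ʳ pre us)
  m∉ : ¬ m ∈V K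
  m∉ x∈ = fr (Anyₚ.++⁺ʳ pre (here x∈))
  S₁ = split-parts₁ gK uK isS m∉
  S₂ = split-parts₂ gK uK isS m∉

steps-rep : ∀ {H D D'} → Rep H D → All (Unique ∘ V) D → Star Step D D' → Rep H D' × All (Unique ∘ V) D'
steps-rep r us ε = r , us
steps-rep r us (s ◅ ss) = let (r' , us') = step-rep r us s in steps-rep r' us' ss

-- `_≈D_` interleaves replacing nodes and moving them. Here the two are separated, so that facts on
-- isomorphic nodes and facts on permutations apply one after the other.
_≋_ : List LGraph → List LGraph → Set
D ≋ E = ∃ λ X → Pointwise _≅_ D X × X ↭ E

≈D⇒≋ : ∀ {D E} → D ≈D E → D ≋ E
≈D⇒≋ [] = [] , [] , ↭-refl
≈D⇒≋ (cons {H' = H'} {D₁ = D₁} {D₂} e d) with ≈D⇒≋ d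
... | X , p , q = H' ∷ X , e ∷ p , ↭-trans (prep H' q) (↭-sym (shift H' D₁ D₂))

≋⇒≈D : ∀ {D E} → D ≋ E → D ≈D E
≋⇒≈D ([] , [] , q) with ↭-empty-inv (↭-sym q)
... | refl = []
≋⇒≈D {E = E} (K ∷ X , e ∷ p , q) with ∈-∃++ (∈-resp-↭ q (here refl))
... | Y , Z , refl = cons e (≋⇒≈D (X , p , drop-∷ (↭-trans q (shift K Y Z))))

↭⇒≈D : ∀ {D E} → D ↭ E → D ≈D E
↭⇒≈D {D} p = ≋⇒≈D (D , Pointwise.refl (λ {H} → ≅-refl {H}) , p)

≈D-length : ∀ {D E} → D ≈D E → length D ≡ length E
≈D-length d with ≈D⇒≋ d
... | X , p , q = trans (Pointwise-length p) (↭-length q)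

↭-Pointwise : ∀ {D E X} → D ↭ E → Pointwise _≅_ D X → ∃ λ Y → Pointwise _≅_ E Y × X ↭ Y
↭-Pointwise Perm.refl p = _ , p , ↭-refl
↭-Pointwise (prep x q) (e ∷ p) with ↭-Pointwise q p
... | Y , p' , q' = _ , e ∷ p' , prep _ q'
↭-Pointwise (swap x y q) (e ∷ f ∷ p) with ↭-Pointwise q p
... | Y , p' , q' = _ , f ∷ e ∷ p' , swap _ _ q'
↭-Pointwise (Perm.trans q r) p with ↭-Pointwise q p
... | Y , p' , q' with ↭-Pointwise r p'
... | Z , p'' , q'' = Z , p'' , ↭-trans q' q''

Pointwise-++⁻ : ∀ D {E X} → Pointwise _≅_ (D ++ E) X →
                ∃₂ λ Y Z → X ≡ Y ++ Z × Pointwise _≅_ D Y × Pointwise _≅_ E Z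
Pointwise-++⁻ [] p = [] , _ , refl , [] , p
Pointwise-++⁻ (_ ∷ D) (e ∷ p) with Pointwise-++⁻ D p
... | Y , Z , refl , a , b = _ ∷ Y , Z , refl , e ∷ a , b

occ-pointwise : ∀ {D E x} → Pointwise _≅_ D E → Occurs x D → Occurs x E
occ-pointwise (e ∷ p) (here x∈) = here (proj₁ e _ x∈)
occ-pointwise (e ∷ p) (there o) = there (occ-pointwise p o)

pointwise-sym : ∀ {D E} → Pointwise _≅_ D E → Pointwise _≅_ E D
pointwise-sym = Pointwise.symmetric (λ {A} {B} → ≅-sym {A} {B})

occ-≋ : ∀ {D E x} → D ≋ E → Occurs x D → Occurs x E
occ-≋ (X , p , q) o = occ-perm q (occ-pointwise p o)

rep-pointwise : ∀ {H D X} → Rep H D → Pointwise _≅_ D X → Rep H X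
rep-pointwise {H} (leaf {K = K} g e) (_∷_ {y = Y} i []) = leaf (good-≅ {K} {Y} i g) (≅-trans {H} {K} {Y} e i)
rep-pointwise (join {D = D} j a b r s sp q) p with ↭-Pointwise q p
... | Y , p' , q' with Pointwise-++⁻ D p'
... | Y₁ , Y₂ , refl , p₁ , p₂ =
  join j a b (rep-pointwise r p₁) (rep-pointwise s p₂)
    (λ o o' → sp (occ-pointwise (pointwise-sym p₁) o) (occ-pointwise (pointwise-sym p₂) o')) q'

rep-≈D : ∀ {H D E} → Rep H D → D ≈D E → Rep H E
rep-≈D r d with ≈D⇒≋ d
... | X , p , q = rep-perm q (rep-pointwise r p)

-- Decompositions obtained by splitting

-- Half of the split condition is automatic, since an edge across the partition witnesses the
-- frontier membership of both its ends. What remains to be supplied is that frontier vertices are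
-- adjacent.
mk-split : ∀ {H} (side : ℕ → Bool) {a b c d} →
           a ∈V H → side a ≡ true → b ∈V H → side b ≡ true → a ≢ b →
           c ∈V H → side c ≡ false → d ∈V H → side d ≡ false → c ≢ d →
           (∀ {x x' y y'} → x ∈V H → side x ≡ true → x' ∈V H → side x' ≡ true →
              y ∈V H → side y ≡ false → y' ∈V H → side y' ≡ false →
              ladj H x y' ≡ true → ladj H y x' ≡ true → ladj H x y ≡ true) →
           (∀ {x y} → x ∈V H → y ∈V H → ladj H x y ≡ ladj H y x) → IsSplit H side
mk-split {H} side a a! b b! ab c c! d d! cd f symH =
  two-of (in₁ a a!) (in₁ b b!) ab , two-of (in₂ c c!) (in₂ d d!) cd ,
  λ x y x∈ y∈ →
    let (xH , x!) = ∈-filterᵇ⁻ side {V H} x∈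
        (yH , y!) = ∈-filterᵇ⁻ (not ∘ side) {V H} y∈ in
    (λ e → adjTo⁺ H y∈ e , adjTo⁺ H x∈ (trans (symH yH xH) e)) ,
    (λ (p , q) →
      let (y' , y'∈ , e) = adjTo⁻ H (V₂ H side) p
          (x' , x'∈ , e') = adjTo⁻ H (V₁ H side) q
          (xH' , x!') = ∈-filterᵇ⁻ side {V H} x'∈
          (yH' , y!') = ∈-filterᵇ⁻ (not ∘ side) {V H} y'∈ in
      f xH x! xH' x!' yH (not-true⁻ y!) yH' (not-true⁻ y!') e e')
  where
  in₁ : ∀ {x} → x ∈V H → side x ≡ true → x ∈ V₁ H side
  in₁ = ∈-filterᵇ⁺ side
  in₂ : ∀ {x} → x ∈V H → side x ≡ false → x ∈ V₂ H side
  in₂ x e = ∈-filterᵇ⁺ (not ∘ side) x (not-true e)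

∧-true⁺ : ∀ {a b} → a ≡ true → b ≡ true → a ∧ b ≡ true
∧-true⁺ refl refl = refl

-- The marker recovers its neighbours: a vertex of `A` with a neighbour across is adjacent to m, and
-- conversely a vertex adjacent to m sees the neighbour t that m has in the connected graph `B`.
piece-≅ : ∀ {m H A B} W W' → IsJoin m H A B → Good A → Good B → Big B →
          (∀ {x} → x ∈ W → x ∈V A × x ≢ m) → (∀ {x} → x ∈V A → x ≢ m → x ∈ W) →
          (∀ {x} → x ∈ W' → x ∈V B × x ≢ m) → (∀ {x} → x ∈V B → x ≢ m → x ∈ W') →
          withMarker H W W' m ≅ A
piece-≅ {m} {H} {A} {B} W W' j gA gB bB w⁻ w⁺ w'⁻ w'⁺ = (λ _ → to) , (λ _ → from) , adjEq
  where
  open IsJoin j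
  P = withMarker H W W' m
  to : ∀ {x} → x ∈V P → x ∈V A
  to (here refl) = mA
  to (there x∈) = proj₁ (w⁻ x∈)
  from : ∀ {x} → x ∈V A → x ∈V P
  from {x} x∈ with x ≟ m
  ... | yes e = here e
  ... | no n = there (w⁺ x∈ n)
  two = big-but bB m
  nb = neighbour {B} (gconn gB) mB (TwoBut.c₁∈ two) (TwoBut.c₁≢m two ∘ ≡-sym)
  t∈ = proj₁ (proj₂ nb)
  mt = proj₂ (proj₂ nb)
  t≢m = adj⇒≢ gB mB mt ∘ ≡-sym
  attach : ∀ {y} → y ∈ W → adjTo H W' y ≡ ladj A y m
  attach {y} y∈ with w⁻ y∈
  ... | yA , y≢ = bool-ext
    (λ e → let (w , w∈ , e') = adjTo⁻ H W' e
               (wB , w≢) = w'⁻ w∈ in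
           proj₁ (∧-true⁻ (trans (≡-sym (adjAB yA y≢ wB w≢)) e')))
    (λ e → adjTo⁺ H (w'⁺ t∈ t≢m) (trans (adjAB yA y≢ t∈ t≢m) (∧-true⁺ e mt)))
  adjEq : ∀ x y → x ∈V P → y ∈V P → ladj P x y ≡ ladj A x y
  adjEq x y (here refl) (here refl) = trans (marker-loop H W W' m) (≡-sym (girr gA mA))
  adjEq x y (here refl) (there y∈) =
    trans (marker-row H W W' m (proj₂ (w⁻ y∈))) (trans (attach y∈) (gsym gA (proj₁ (w⁻ y∈)) mA))
  adjEq x y (there x∈) (here refl) = trans (marker-column H W W' m (proj₂ (w⁻ x∈))) (attach x∈)
  adjEq x y (there x∈) (there y∈) = let (a , n) = w⁻ x∈
                                        (b , n') = w⁻ y∈ in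
    trans (unmarked H W W' m n n') (adjA a n b n')

module _ {m H A B} (j : IsJoin m H A B) (gA : Good A) (gB : Good B) (bA : Big A) (bB : Big B) where
  open IsJoin j
  sideOf : ℕ → Bool
  sideOf x = does (x ∈? V A)
  private
    inside : ∀ {x} → x ∈V A → sideOf x ≡ true
    inside {x} = dec-true (x ∈? V A)
    outside : ∀ {x} → x ∈V B → x ≢ m → sideOf x ≡ false
    outside {x} xB n = dec-false (x ∈? V A) (λ xA → n (sep xA xB))
    inside⁻ : ∀ {x} → x ∈V H → sideOf x ≡ true → x ∈V A × x ≢ m
    inside⁻ x∈ e with out x∈
    ... | inj₁ p = p
    ... | inj₂ (xB , n) = ⊥-elim (true≢false e (outside xB n))
    outside⁻ : ∀ {x} → x ∈V H → sideOf x ≡ false → x ∈V B × x ≢ m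
    outside⁻ x∈ e with out x∈
    ... | inj₁ (xA , _) = ⊥-elim (true≢false (inside xA) e)
    ... | inj₂ p = p
    module a = TwoBut (big-but bA m)
    module b = TwoBut (big-but bB m)

  join-split : IsSplit H sideOf
  join-split = mk-split sideOf
    (inA a.c₁∈ a.c₁≢m) (inside a.c₁∈) (inA a.c₂∈ a.c₂≢m) (inside a.c₂∈) a.c₁≢c₂
    (inB b.c₁∈ b.c₁≢m) (outside b.c₁∈ b.c₁≢m) (inB b.c₂∈ b.c₂≢m) (outside b.c₂∈ b.c₂≢m) b.c₁≢c₂
    (λ x x! x' x'! y y! y' y'! e e' →
      let (xA , xm) = inside⁻ x x! ; (xA' , xm') = inside⁻ x' x'!
          (yB , ym) = outside⁻ y y! ; (yB' , ym') = outside⁻ y' y'! in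
      trans (adjAB xA xm yB ym)
        (∧-true⁺ (proj₁ (∧-true⁻ (trans (≡-sym (adjAB xA xm yB' ym')) e)))
                 (trans (gsym gB mB yB) (proj₁ (∧-true⁻ (trans (≡-sym (adjBA yB ym xA' xm')) e'))))))
    (gsym (good-join j gA gB bA bB))

  private
    w₁⁻ : ∀ {x} → x ∈ V₁ H sideOf → x ∈V A × x ≢ m
    w₁⁻ p = let (a , b) = ∈-filterᵇ⁻ sideOf {V H} p in inside⁻ a b
    w₁⁺ : ∀ {x} → x ∈V A → x ≢ m → x ∈ V₁ H sideOf
    w₁⁺ x n = ∈-filterᵇ⁺ sideOf (inA x n) (inside x)
    w₂⁻ : ∀ {x} → x ∈ V₂ H sideOf → x ∈V B × x ≢ m
    w₂⁻ p = let (a , b) = ∈-filterᵇ⁻ (not ∘ sideOf) {V H} p in outside⁻ a (not-true⁻ b)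
    w₂⁺ : ∀ {x} → x ∈V B → x ≢ m → x ∈ V₂ H sideOf
    w₂⁺ x n = ∈-filterᵇ⁺ (not ∘ sideOf) (inB x n) (not-true (outside x n))

  join-piece₁ : piece₁ H sideOf m ≅ A
  join-piece₁ = piece-≅ (V₁ H sideOf) (V₂ H sideOf) j gA gB bB w₁⁻ w₁⁺ w₂⁻ w₂⁺

  join-piece₂ : piece₂ H sideOf m ≅ B
  join-piece₂ = piece-≅ (V₂ H sideOf) (V₁ H sideOf) (join-swap j) gB gA bA w₂⁻ w₂⁺ w₁⁻ w₁⁺

≋-++ : ∀ {D D' E E'} → D ≋ D' → E ≋ E' → (D ++ E) ≋ (D' ++ E')
≋-++ (X , p , q) (Y , p' , q') = X ++ Y , Pointwise.++⁺ p p' , Permₚ.++⁺ q q'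

≋-perm : ∀ {D E F} → D ≋ E → E ↭ F → D ≋ F
≋-perm (X , p , q) r = X , p , ↭-trans q r

-- The splits are carried out in place, from the root of the tree of joins down, inside a list with
-- surroundings `pre` and `post`. Labels shared with the surroundings must be vertices of `H`; a
-- marker of a join is not one, hence it is fresh. Since `withMarker` builds its own copies of the
-- pieces, nodes agree up to `_≅_` only.
rep-steps : ∀ {H D} → Rep H D → ∀ {H'} → H ≅ H' → ∀ pre post →
            (∀ {x} → Occurs x D → Occurs x (pre ++ post) → x ∈V H) →
            ∃ λ D₀ → Star Step (pre ++ H' ∷ post) (pre ++ D₀ ++ post) × D₀ ≋ D
rep-steps {H} (leaf {K = K} g e) {H'} i pre post fr =
  [ H' ] , ε , [ K ] , ≅-trans {H'} {H} {K} (≅-sym {H} {H'} i) e ∷ [] , ↭-refl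
rep-steps {H} (join {m} {A = A} {B} {D} {E} {F} j a b r s sp q) {H'} i pre post fr =
  D₀ ++ E₀ , subst (Star Step (pre ++ H' ∷ post)) assoc' 
    (split pre post H' side m isS fresh ◅ proj₁ (proj₂ left) ◅◅ right-steps) ,
  ≋-perm (≋-++ eqD eqE) (↭-sym q)
  where
  module j = IsJoin j
  j₁ = join-≅H i j
  gA = rep-good r
  gB = rep-good s
  side = sideOf j₁ gA gB a b
  isS = join-split j₁ gA gB a b
  P₁ = piece₁ H' side m
  P₂ = piece₂ H' side m
  A≅P₁ : A ≅ P₁
  A≅P₁ = ≅-sym {P₁} {A} (join-piece₁ j₁ gA gB a b)
  B≅P₂ : B ≅ P₂
  B≅P₂ = ≅-sym {P₂} {B} (join-piece₂ j₁ gA gB a b)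
  drop-mid' : ∀ {x K} → Occurs x (pre ++ K ∷ post) → x ∈V K ⊎ Occurs x (pre ++ post)
  drop-mid' {K = K} o with occ-perm (shift K pre post) o
  ... | here z = inj₁ z
  ... | there z = inj₂ z
  fresh : ¬ Occurs m (pre ++ H' ∷ post)
  fresh o with drop-mid' o
  ... | inj₁ z = IsJoin.out≢ j₁ z refl
  ... | inj₂ z = j.out≢ (fr (occˡ q (rep-V r j.mA)) z) refl
  fr₁ : ∀ {x} → Occurs x D → Occurs x (pre ++ P₂ ∷ post) → x ∈V A
  fr₁ o o' with drop-mid' o'
  ... | inj₁ z = subst (_∈V A) (≡-sym (sp o (rep-V s (proj₁ (proj₂ B≅P₂) _ z)))) j.mA
  ... | inj₂ z with j.out (fr (occˡ q o) z)
  ... | inj₁ (p , _) = p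
  ... | inj₂ (p , _) = subst (_∈V A) (≡-sym (sp o (rep-V s p))) j.mA
  left = rep-steps r A≅P₁ pre (P₂ ∷ post) fr₁
  D₀ = proj₁ left
  eqD : D₀ ≋ D
  eqD = proj₂ (proj₂ left)
  fr₂ : ∀ {x} → Occurs x E → Occurs x ((pre ++ D₀) ++ post) → x ∈V B
  fr₂ o o' with Anyₚ.++⁻ (pre ++ D₀) o'
  ... | inj₁ z with Anyₚ.++⁻ pre z
  ...   | inj₂ oD = subst (_∈V B) (≡-sym (sp (occ-≋ eqD oD) o)) j.mB
  ...   | inj₁ y with j.out (fr (occʳ D q o) (Anyₚ.++⁺ˡ y))
  ...     | inj₁ (p , _) = subst (_∈V B) (≡-sym (sp (rep-V r p) o)) j.mB
  ...     | inj₂ (p , _) = p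
  fr₂ o o' | inj₂ z with j.out (fr (occʳ D q o) (Anyₚ.++⁺ʳ pre z))
  ... | inj₁ (p , _) = subst (_∈V B) (≡-sym (sp (rep-V r p) o)) j.mB
  ... | inj₂ (p , _) = p
  right = rep-steps s B≅P₂ (pre ++ D₀) post fr₂
  E₀ = proj₁ right
  eqE : E₀ ≋ E
  eqE = proj₂ (proj₂ right)
  right-steps : Star Step (pre ++ D₀ ++ P₂ ∷ post) ((pre ++ D₀) ++ E₀ ++ post)
  right-steps = subst (λ Z → Star Step Z ((pre ++ D₀) ++ E₀ ++ post)) 
    (Listₚ.++-assoc pre D₀ (P₂ ∷ post)) (proj₁ (proj₂ right))
  assoc' : (pre ++ D₀) ++ E₀ ++ post ≡ pre ++ (D₀ ++ E₀) ++ post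
  assoc' = trans (Listₚ.++-assoc pre D₀ (E₀ ++ post)) (cong (pre ++_) (≡-sym (Listₚ.++-assoc D₀ E₀ post)))

toFin?-toℕ : ∀ {k} (i : Fin k) → toFin? k (toℕ i) ≡ just i
toFin?-toℕ Fin.zero = refl
toFin?-toℕ (Fin.suc i) rewrite toFin?-toℕ i = refl

base-adj : ∀ G u v → ladj (base G) (toℕ u) (toℕ v) ≡ adj G u v
base-adj G u v rewrite toFin?-toℕ u | toFin?-toℕ v = refl

base∈ : ∀ G u → toℕ u ∈V base G
base∈ G u = ∈-map⁺ toℕ (∈-allFin u)

base∈⁻ : ∀ G {x} → x ∈V base G → ∃ λ u → x ≡ toℕ u
base∈⁻ G x∈ = let (u , _ , e) = ∈-map⁻ toℕ {xs = allFin (n G)} x∈ in u , e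

base-good : ∀ G → Connected G → Good (base G)
base-good G conn = record { gsym = sy ; girr = ir ; gconn = cn }
  where
  sy : ∀ {x y} → x ∈V base G → y ∈V base G → ladj (base G) x y ≡ ladj (base G) y x
  sy x∈ y∈ with base∈⁻ G x∈ | base∈⁻ G y∈
  ... | u , refl | v , refl = trans (base-adj G u v) (trans (Defs.sym G u v) (≡-sym (base-adj G v u)))
  ir : ∀ {x} → x ∈V base G → ladj (base G) x x ≡ false
  ir x∈ with base∈⁻ G x∈
  ... | u , refl = trans (base-adj G u u) (irrefl G u)
  walk : ∀ {u v k} → WalkIn G (Everything G) u v k → Star (EdgeOn (base G) (_∈V base G)) (toℕ u) (toℕ v)
  walk (here _) = ε
  walk (step {u} {w} _ e s) = edge (base∈ G u) (base∈ G w) (trans (base-adj G u w) e) ◅ walk s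
  cn : ConnOn (base G) (_∈V base G)
  cn x∈ y∈ with base∈⁻ G x∈ | base∈⁻ G y∈
  ... | u , refl | v , refl = walk (proj₂ (conn u v))

base-unique : ∀ G → Unique (V (base G))
base-unique G = Uniqueₚ.map⁺ Finₚ.toℕ-injective (Uniqueₚ.allFin⁺ (n G))

decomposition-rep : ∀ G {D} → Connected G → SplitDecomposition G D → Rep (base G) D
decomposition-rep G conn (D₀ , ss , e) =
  rep-≈D (proj₁ (steps-rep (leaf (base-good G conn) ≅-refl) (base-unique G ∷ []) ss)) e

rep-decomposition : ∀ G {D} → Rep (base G) D → SplitDecomposition G D
rep-decomposition G r with rep-steps r {base G} ≅-refl [] [] (λ _ ())
... | D₀ , ss , e rewrite Listₚ.++-identityʳ D₀ = D₀ , ss , ≋⇒≈D e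

-- If `K` were a star, putting it in place of `A` and `B` would give a nice decomposition from which
-- `D` arises by a single `Step`.
standard-reduced : ∀ G {D A B R m K} → Connected G → IsStandard G D → D ↭ A ∷ B ∷ R →
                   IsJoin m K A B → ¬ IsStar K
standard-reduced G {D} {A} {B} {R} {m} {K} conn (dec , nice , min) p j st =
  min (K ∷ R , rep-decomposition G (merge rep p mA mB bA bB gA gB j) , nice' ,
       _ , _ , split [] R K (sideOf j gA gB bA bB) m (join-split j gA gB bA bB) fresh , ε ,
       ≋⇒≈D (A ∷ B ∷ R , join-piece₁ j gA gB bA bB ∷ join-piece₂ j gA gB bA bB ∷
             Pointwise.refl (λ {H} → ≅-refl {H}) , ↭-sym p))
  where
  open IsJoin j
  rep = decomposition-rep G conn dec
  goods = All-resp-↭ p (rep-allGood rep)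
  gA = All.head goods
  gB = All.head (All.tail goods)
  bA = node-big rep p
  bB = node-big rep (↭-trans p (swap A B ↭-refl))
  nice' : NiceNodes (K ∷ R)
  nice' = inj₂ (inj₂ st) ∷ All.tail (All.tail (All-resp-↭ p nice))
  fresh : ¬ Occurs m (K ∷ R)
  fresh (here z) = out≢ z refl
  fresh (there o) = marker-twice rep p mA mB o

-- Existence of standard decompositions and of prunings

label-bound : ∀ (xs : List ℕ) → ∃ λ b → ∀ {x} → x ∈ xs → x < b
label-bound [] = 0 , λ ()
label-bound (y ∷ xs) with label-bound xs
... | b , f = suc y + b , λ { (here refl) → ℕₚ.m≤m+n _ b
                            ; (there x∈) → ℕₚ.≤-trans (f x∈) (ℕₚ.m≤n+m b (suc y)) }

occ-bound : ∀ D → ∃ λ b → ∀ {x} → Occurs x D → x < b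
occ-bound [] = 0 , λ ()
occ-bound (H ∷ D) with label-bound (V H) | occ-bound D
... | a , f | b , g = a + b , λ { (here x∈) → ℕₚ.≤-trans (f x∈) (ℕₚ.m≤m+n a b)
                                ; (there o) → ℕₚ.≤-trans (g o) (ℕₚ.m≤n+m b a) }

fresh-label : ∀ D → ∃ λ m → ¬ Occurs m D
fresh-label D = let (b , f) = occ-bound D in b , λ o → ℕₚ.<-irrefl refl (f o)

-- A measure for splitting. Pieces have at least three vertices, so on them the subtraction of 3 is
-- exact; sides of sizes a and b contribute a + b - 4 after the split, against a + b - 3 before.
excess : List LGraph → ℕ
excess [] = 0
excess (H ∷ D) = (length (V H) ∸ 3) + excess D

excess-++ : ∀ D E → excess (D ++ E) ≡ excess D + excess E
excess-++ [] E = refl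
excess-++ (H ∷ D) E = trans (cong ((length (V H) ∸ 3) +_) (excess-++ D E)) (≡-sym (ℕₚ.+-assoc (length (V H) ∸ 3) _ _))

length-sides : ∀ (p : ℕ → Bool) xs → length (filterᵇ p xs) + length (filterᵇ (not ∘ p) xs) ≡ length xs
length-sides p [] = refl
length-sides p (x ∷ xs) with p x
... | true = cong suc (length-sides p xs)
... | false = trans (ℕₚ.+-suc _ _) (cong suc (length-sides p xs))

pieces-excess : ∀ {a b c} → 2 ≤ a → 2 ≤ b → a + b ≡ c → (suc a ∸ 3) + (suc b ∸ 3) < c ∸ 3
pieces-excess {suc (suc a)} {suc (suc b)} (s≤s (s≤s _)) (s≤s (s≤s _)) refl
  rewrite ℕₚ.+-suc a (suc b) | ℕₚ.+-suc a b = ℕₚ.≤-refl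

step-excess : ∀ {D D'} → Step D D' → excess D' < excess D
step-excess (split pre post H side m (l₁ , l₂ , _) _)
  rewrite excess-++ pre (piece₁ H side m ∷ piece₂ H side m ∷ post) | excess-++ pre (H ∷ post) =
  ℕₚ.+-monoʳ-< (excess pre) (subst (_< (length (V H) ∸ 3) + excess post)
    (ℕₚ.+-assoc (suc (length (V₁ H side)) ∸ 3) _ _)
    (ℕₚ.+-monoˡ-< (excess post) (pieces-excess l₁ l₂ (length-sides side (V H)))))

-- Having a split is a statement about functions on all labels and is not decided here, hence the
-- double negation.
prime-or-split : ∀ D → ¬ ¬ (All Prime D ⊎ ∃ λ pre → ∃ λ H → ∃ λ post → ∃ λ side →
                              D ≡ pre ++ H ∷ post × IsSplit H side)
prime-or-split [] k = k (inj₁ [])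
prime-or-split (H ∷ D) k = ¬¬-excluded-middle {A = Σ (ℕ → Bool) (IsSplit H)} λ
  { (yes (side , s)) → k (inj₂ ([] , H , D , side , refl , s))
  ; (no ¬s) → prime-or-split D λ
    { (inj₁ ps) → k (inj₁ (¬s ∷ ps))
    ; (inj₂ (pre , K , post , side , refl , s)) → k (inj₂ (H ∷ pre , K , post , side , refl , s)) } }

steps-to-prime : ∀ b {D₀} D → Star Step D₀ D → excess D ≤ b → ¬ ¬ ∃ λ D' → Star Step D₀ D' × All Prime D'
steps-to-prime b D ss le k = prime-or-split D λ
  { (inj₁ ps) → k (D , ss , ps)
  ; (inj₂ (pre , H , post , side , refl , s)) →
      let (m , fr) = fresh-label (pre ++ H ∷ post)
          st = split pre post H side m s fr in
      descend b st (ss ◅◅ st ◅ ε) (ℕₚ.≤-trans (step-excess st) le) k }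
  where
  descend : ∀ b {D D' D₀} → Step D D' → Star Step D₀ D' → suc (excess D') ≤ b →
            ¬ ¬ ∃ λ D' → Star Step D₀ D' × All Prime D'
  descend (suc b) {D' = D'} st ss (s≤s le) = steps-to-prime b D' ss le

step-length : ∀ {D D'} → Step D D' → length D < length D'
step-length (split pre post H side m _ _)
  rewrite Listₚ.length-++ pre {H ∷ post} | Listₚ.length-++ pre {piece₁ H side m ∷ piece₂ H side m ∷ post} =
  ℕₚ.+-monoʳ-< (length pre) ℕₚ.≤-refl

steps-length : ∀ {D D'} → Star Step D D' → length D ≤ length D'
steps-length ε = ℕₚ.≤-refl
steps-length (s ◅ ss) = ℕₚ.≤-trans (ℕₚ.<⇒≤ (step-length s)) (steps-length ss)

-- A nice decomposition that is not standard strictly refines another nice one. Each `Step` adds a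
-- node, so the coarser one is shorter and the descent ends; the empty list cannot occur, since the
-- steps start from one node.
coarsest : ∀ b G D → length D ≤ b → SplitDecomposition G D → NiceNodes D → ¬ ¬ ∃ (IsStandard G)
coarsest zero G (_ ∷ _) () _ _
coarsest zero G [] _ (D₀ , ss , e) _ k =
  case ℕₚ.≤-trans (steps-length ss) (ℕₚ.≤-reflexive (≈D-length e)) of λ ()
coarsest (suc b) G D le dec nice k =
  k (D , dec , nice , λ (D' , dec' , nice' , D₁ , D₂ , st , ss , e) →
    coarsest b G D'
      (ℕₚ.≤-pred (ℕₚ.≤-trans (step-length st) (ℕₚ.≤-trans (steps-length ss)
        (ℕₚ.≤-trans (ℕₚ.≤-reflexive (≈D-length e)) le))))
      dec' nice' k)

standard-exists : ∀ G → ¬ ¬ ∃ (IsStandard G)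
standard-exists G k = steps-to-prime _ [ base G ] ε ℕₚ.≤-refl λ (D , ss , ps) →
  coarsest _ G D ℕₚ.≤-refl (D , ss , ↭⇒≈D ↭-refl) (All.map inj₁ ps) k

pruning-exists : ∀ b D → length D ≤ b → ¬ ¬ ∃ (IsPruning D)
pruning-exists b D le k = ¬¬-excluded-middle {A = ∃ (PruneStep D)} λ
  { (no h) → k (D , ε , h)
  ; (yes (D' , L , e , lu)) → shorter b (ℕₚ.≤-trans (ℕₚ.≤-reflexive (≡-sym (≈D-length e))) le)
      λ (P , ss , h) → k (P , (L , e , lu) ◅ ss , h) }
  where
  shorter : ∀ b {D'} → suc (length D') ≤ b → ¬ ¬ ∃ (IsPruning D')
  shorter (suc b) {D'} (s≤s le) = pruning-exists b D' le

-- Prime distance hereditary graphs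

data Walk (H : LGraph) (P : ℕ → Set) : ℕ → ℕ → ℕ → Set where
  nil  : ∀ {x} → Walk H P x x 0
  cons : ∀ {x y z k} → EdgeOn H P x y → Walk H P y z k → Walk H P x z (suc k)

star-walk : ∀ {H P x y} → Star (EdgeOn H P) x y → ∃ (Walk H P x y)
star-walk ε = 0 , nil
star-walk (e ◅ s) = let (k , w) = star-walk s in suc k , cons e w

walk-mono : ∀ {H P Q x y k} → (∀ {z} → P z → Q z) → Walk H P x y k → Walk H Q x y k
walk-mono f nil = nil
walk-mono f (cons (edge a b e) w) = cons (edge (f a) (f b) e) (walk-mono f w)

-- Distance heredity of a labelled graph, read classically and stated without naming distances.
DHL : LGraph → Set
DHL H = ∀ (S : List ℕ) → (∀ {x} → x ∈ S → x ∈V H) → ConnOn H (_∈ S) →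
        ∀ {u v d} → u ∈ S → v ∈ S → Walk H (_∈V H) u v d → ¬ ¬ ∃ λ k → k ≤ d × Walk H (_∈ S) u v k

-- The sets to which `DHL` is applied grow by one vertex at a time, each attached to an earlier one;
-- walks to the root keep them connected.
record Web (H : LGraph) (S : List ℕ) (r : ℕ) : Set where
  field
    root   : r ∈ S
    within : ∀ {x} → x ∈ S → x ∈V H
    toRoot : ∀ {x} → x ∈ S → Star (EdgeOn H (_∈ S)) x r
open Web

web-one : ∀ {H r} → r ∈V H → Web H [ r ] r
web-one r∈ = record { root = here refl ; within = λ { (here refl) → r∈ } ; toRoot = λ { (here refl) → ε } }

web-add : ∀ {H S r p q} → Web H S r → p ∈V H → q ∈ S → ladj H p q ≡ true → Web H (p ∷ S) r
web-add w p∈ q∈ e = record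
  { root = there (root w)
  ; within = λ { (here refl) → p∈ ; (there x∈) → within w x∈ }
  ; toRoot = λ { (here refl) → edge (here refl) (there q∈) e ◅ star-mono there (toRoot w q∈)
               ; (there x∈) → star-mono there (toRoot w x∈) } }

star-reverse : ∀ {H P x y} → Good H → (∀ {z} → P z → z ∈V H) → Star (EdgeOn H P) x y → Star (EdgeOn H P) y x
star-reverse g f ε = ε
star-reverse g f (edge a b e ◅ s) = star-reverse g f s ◅◅ edge b a (trans (gsym g (f b) (f a)) e) ◅ ε

web-conn : ∀ {H S r} → Good H → Web H S r → ConnOn H (_∈ S)
web-conn g w x∈ y∈ = toRoot w x∈ ◅◅ star-reverse g (within w) (toRoot w y∈)

least : ∀ (Q : ℕ → Set) k → Q k → ¬ ¬ ∃ λ m → Q m × (∀ j → Q j → m ≤ j)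
least Q k qk h = go k k qk ℕₚ.≤-refl
  where
  go : ∀ b k → Q k → k ≤ b → ⊥
  go b k qk le = h (k , qk , λ j qj → ℕₚ.≮⇒≥ (λ lt → below b j qj (ℕₚ.≤-trans lt le)))
    where
    below : ∀ b j → Q j → suc j ≤ b → ⊥
    below (suc b) j qj (s≤s le) = go b j qj le

override : ∀ {A : Set} → ℕ → A → (ℕ → A) → ℕ → A
override y a f z = ifDec (z ≟ y) a (f z)

-- Double negation passes through finitely many choices. This yields the distances from a vertex and
-- the characteristic functions of undecided sets as functions; the initial `A` is the value off the
-- list.
choice : ∀ {A : Set} → A → (R : ℕ → A → Set) (xs : List ℕ) → (∀ {x} → x ∈ xs → ¬ ¬ ∃ (R x)) →
         ¬ ¬ ∃ λ (f : ℕ → A) → ∀ {x} → x ∈ xs → R x (f x)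
choice a₀ R [] h k = k ((λ _ → a₀) , λ ())
choice a₀ R (y ∷ xs) h k = h (here refl) λ (a , ra) → choice a₀ R xs (h ∘ there) λ (f , rf) →
  k (override y a f , good a f ra rf)
  where
  good : ∀ a f → R y a → (∀ {x} → x ∈ xs → R x (f x)) → ∀ {x} → x ∈ y ∷ xs → R x (override y a f x)
  good a f ra rf {x} x∈ with x ≟ y
  good a f ra rf x∈ | yes refl = ra
  good a f ra rf (here e) | no n = ⊥-elim (n e)
  good a f ra rf (there x∈) | no n = rf x∈

argmax : ∀ (d : ℕ → ℕ) {xs : List ℕ} {z} → z ∈ xs → ∃ λ x → x ∈ xs × (∀ {y} → y ∈ xs → d y ≤ d x)
argmax d {y ∷ []} _ = y , here refl , λ { (here refl) → ℕₚ.≤-refl }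
argmax d {y ∷ xs@(_ ∷ _)} _ with argmax d {xs} (here refl)
... | x , x∈ , mx with ℕₚ.≤-total (d y) (d x)
... | inj₁ le = x , there x∈ , λ { (here refl) → le ; (there z) → mx z }
... | inj₂ le = y , here refl , λ { (here refl) → ℕₚ.≤-refl ; (there z) → ℕₚ.≤-trans (mx z) le }

prime-no-split : ∀ {H} → Prime H → Good H → (P : ℕ → Set) → ∀ {a b c d} →
                 a ∈V H → P a → b ∈V H → P b → a ≢ b →
                 c ∈V H → ¬ P c → d ∈V H → ¬ P d → c ≢ d →
                 (∀ {x x' y y'} → x ∈V H → P x → x' ∈V H → P x' →
                   y ∈V H → ¬ P y → y' ∈V H → ¬ P y' →
                   ladj H x y' ≡ true → ladj H y x' ≡ true → ladj H x y ≡ true) → ⊥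
prime-no-split {H} pr g P a pa b pb ab c pc d pd cd cond =
  choice true (λ x t → (t ≡ true → P x) × (t ≡ false → ¬ P x)) (V H)
    (λ {x} _ k → ¬¬-excluded-middle {A = P x} λ
      { (yes p) → k (true , (λ _ → p) , λ ()) ; (no p) → k (false , (λ ()) , λ _ → p) })
    λ (side , ok) →
      let isT : ∀ {x} → x ∈V H → P x → side x ≡ true
          isT x∈ p = ≢false (λ e → proj₂ (ok x∈) e p)
          isF : ∀ {x} → x ∈V H → ¬ P x → side x ≡ false
          isF x∈ p = ≢true (λ e → p (proj₁ (ok x∈) e)) in
      pr (side , mk-split side a (isT a pa) b (isT b pb) ab c (isF c pc) d (isF d pd) cd
        (λ x x! x' x'! y y! y' y'! → cond x (proj₁ (ok x) x!) x' (proj₁ (ok x') x'!)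
           y (proj₂ (ok y) y!) y' (proj₂ (ok y') y'!))
        (gsym g))

module Layers {H : LGraph} (g : Good H) (dh : DHL H) (pr : Prime H) {u : ℕ} (u∈ : u ∈V H) (d : ℕ → ℕ)
  (dwalk : ∀ {v} → v ∈V H → Walk H (_∈V H) v u (d v))
  (dmin : ∀ {v k} → v ∈V H → Walk H (_∈V H) v u k → d v ≤ k) where

  infix 4 _~_
  _~_ : ℕ → ℕ → Set
  x ~ y = ladj H x y ≡ true

  ~sym : ∀ {x y} → x ∈V H → y ∈V H → x ~ y → y ~ x
  ~sym x∈ y∈ e = trans (gsym g y∈ x∈) e

  ~irr : ∀ {x} → x ∈V H → ¬ x ~ x
  ~irr x∈ e = adj⇒≢ g x∈ e refl

  d-edge : ∀ {x y} → x ∈V H → y ∈V H → x ~ y → d x ≤ suc (d y)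
  d-edge x∈ y∈ e = dmin x∈ (cons (edge x∈ y∈ e) (dwalk y∈))

  du : d u ≡ 0
  du = ℕₚ.n≤0⇒n≡0 (dmin u∈ nil)

  d0 : ∀ {v} → v ∈V H → d v ≡ 0 → v ≡ u
  d0 {v} v∈ e with d v | dwalk v∈
  d0 v∈ refl | _ | nil = refl

  parent : ∀ {v j} → v ∈V H → d v ≡ suc j → ∃ λ t → t ∈V H × v ~ t × d t ≡ j
  parent {v} {j} v∈ e with d v in eq | dwalk v∈
  parent {v} v∈ refl | _ | cons {y = t} (edge _ t∈ vt) w = t , t∈ , vt ,
    ℕₚ.≤-antisym (dmin t∈ w) (ℕₚ.≤-pred (subst (_≤ suc (d t)) eq (d-edge v∈ t∈ vt)))

  chain : ∀ j {v} → v ∈V H → d v ≡ j → ∃ λ S → Web H S u × v ∈ S × (∀ {p} → p ∈ S → p ≡ v ⊎ d p < j)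
  chain zero v∈ e with d0 v∈ e
  ... | refl = [ u ] , web-one u∈ , here refl , λ { (here refl) → inj₁ refl }
  chain (suc j) v∈ e with parent v∈ e
  ... | t , t∈ , vt , e' with chain j t∈ e'
  ... | S , w , t∈S , low = _ , web-add w v∈ t∈S vt , here refl , λ
    { (here refl) → inj₁ refl
    ; (there p) → inj₂ ([ (λ { refl → s≤s (ℕₚ.≤-reflexive e') }) , ℕₚ.m≤n⇒m≤1+n ]′ (low p)) }

  -- In a connected set meeting the layers up to i only in t and in vertices below t,
  -- a shortest walk to u must leave layer i + 1 through t.
  gate : ∀ {S y t i} → Web H S u → y ∈ S → d y ≡ suc i →
         (∀ {p} → p ∈ S → suc i ≤ d p ⊎ p ≡ t ⊎ d p < i) → y ~ t
  gate {S} {y} {t} {i} w y∈ e low = ≢false λ nadj →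
    dh S (within w) (web-conn g w) y∈ (root w) (dwalk (within w y∈)) (contra nadj)
    where
    contra : ladj H y t ≡ false → ¬ ∃ λ k → k ≤ d y × Walk H (_∈ S) y u k
    contra nadj (_ , _ , nil) = case trans (≡-sym du) e of λ ()
    contra nadj (suc k , le , cons {y = s} (edge _ s∈ ys) wk) with low s∈
    ... | inj₁ hi = ℕₚ.<-irrefl refl (ℕₚ.≤-trans hi (ℕₚ.≤-trans (dmin (within w s∈) (walk-mono (within w) wk))
                      (ℕₚ.≤-pred (subst (suc k ≤_) e le))))
    ... | inj₂ (inj₁ refl) = true≢false ys nadj
    ... | inj₂ (inj₂ lt) = ℕₚ.<-irrefl refl (ℕₚ.≤-trans (s≤s lt)
                             (subst (_≤ suc (d s)) e (d-edge (within w y∈) (within w s∈) ys)))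

  -- `gate` for the chain from s to u together with x and y: s is the only vertex of its layer
  -- there, so y must leave its layer through s.
  same-layer : ∀ {x y s i} → x ∈V H → y ∈V H → x ~ y → d x ≡ suc i → d y ≡ suc i →
               s ∈V H → d s ≡ i → x ~ s → y ~ s
  same-layer {i = i} x∈ y∈ xy ex ey s∈ es xs with chain i s∈ es
  ... | S , w , s∈S , low = gate (web-add (web-add w x∈ s∈S xs) y∈ (here refl) (~sym x∈ y∈ xy))
    (here refl) ey λ
    { (here refl) → inj₁ (ℕₚ.≤-reflexive (≡-sym ey))
    ; (there (here refl)) → inj₁ (ℕₚ.≤-reflexive (≡-sym ex))
    ; (there (there p)) → inj₂ (low p) }

  -- `gate` for the chain from t to u together with s, x and s': the way from s' to u by x and s has
  -- length above the distance, so s' must see t itself.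
  co-parents : ∀ {x s s' t i} → x ∈V H → s ∈V H → s' ∈V H → t ∈V H →
               d x ≡ suc (suc i) → d s ≡ suc i → d s' ≡ suc i → d t ≡ i → x ~ s → x ~ s' → s ~ t → s' ~ t
  co-parents {i = i} x∈ s∈ s'∈ t∈ ex es es' et xs xs' st with chain i t∈ et
  ... | S , w , t∈S , low =
    gate (web-add (web-add (web-add w s∈ t∈S st) x∈ (here refl) xs) s'∈ (here refl) (~sym x∈ s'∈ xs'))
      (here refl) es' λ
      { (here refl) → inj₁ (ℕₚ.≤-reflexive (≡-sym es'))
      ; (there (here refl)) → inj₁ (ℕₚ.≤-trans (ℕₚ.n≤1+n _) (ℕₚ.≤-reflexive (≡-sym ex)))
      ; (there (there (here refl))) → inj₁ (ℕₚ.≤-reflexive (≡-sym es))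
      ; (there (there (there p))) → inj₂ (low p) }

  -- Distance heredity at distance two: a connected set containing x and w must contain a common
  -- neighbour of theirs.
  no-middle : ∀ {S r x w s} → Web H S r → x ∈ S → w ∈ S → x ≢ w → ¬ x ~ w → s ∈V H → x ~ s → s ~ w →
              (∀ {q} → q ∈ S → x ~ q → q ~ w → ⊥) → ⊥
  no-middle {S} {x = x} {w} W x∈ w∈ x≢w xw s∈ xs sw none =
    dh S (within W) (web-conn g W) x∈ w∈
      (cons (edge (within W x∈) s∈ xs) (cons (edge s∈ (within W w∈) sw) nil)) contra
    where
    contra : ¬ ∃ λ k → k ≤ 2 × Walk H (_∈ S) x w k
    contra (_ , _ , nil) = x≢w refl
    contra (_ , _ , cons (edge _ _ e) nil) = xw e
    contra (_ , _ , cons (edge _ q e) (cons (edge _ _ e') nil)) = none q e e'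
    contra (_ , s≤s (s≤s ()) , cons _ (cons _ (cons _ _)))

  module Last {x i : ℕ} (x∈ : x ∈V H) (ex : d x ≡ suc (suc i))
              (mx : ∀ {y} → y ∈V H → d y ≤ suc (suc i)) where

    diff : ∀ {a b k l} → d a ≡ k → d b ≡ l → k ≢ l → a ≢ b
    diff ea eb n refl = n (trans (≡-sym ea) eb)

    near-top : ∀ {a b} → a ∈V H → b ∈V H → a ~ b → d a ≡ suc (suc i) → d b ≡ suc i ⊎ d b ≡ suc (suc i)
    near-top {a} {b} a∈ b∈ ab ea with ℕₚ.m≤n⇒m<n∨m≡n (mx b∈)
    ... | inj₂ e = inj₂ e
    ... | inj₁ lt = inj₁ (ℕₚ.≤-antisym (ℕₚ.≤-pred lt) (ℕₚ.≤-pred (subst (_≤ suc (d b)) ea (d-edge a∈ b∈ ab))))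

    same-down : ∀ {a b s} → a ∈V H → b ∈V H → a ~ b → d a ≡ suc (suc i) → d b ≡ suc (suc i) →
                s ∈V H → d s ≡ suc i → ladj H a s ≡ ladj H b s
    same-down a∈ b∈ ab ea eb s∈ es =
      bool-ext (same-layer a∈ b∈ ab ea eb s∈ es) (same-layer b∈ a∈ (~sym a∈ b∈ ab) eb ea s∈ es)

    -- With x in the last layer, one of three sets is a side of a split: the vertices C of the last layer
    -- with the same parents as x, the parents of x together with the vertices W below them, or {u, x}.
    s₀ : ℕ
    s₀ = proj₁ (parent x∈ ex)
    s₀∈ : s₀ ∈V H
    s₀∈ = proj₁ (proj₂ (parent x∈ ex))
    xs₀ : x ~ s₀
    xs₀ = proj₁ (proj₂ (proj₂ (parent x∈ ex)))
    es₀ : d s₀ ≡ suc i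
    es₀ = proj₂ (proj₂ (proj₂ (parent x∈ ex)))

    C : ℕ → Set
    C y = d y ≡ suc (suc i) × (∀ {s} → s ∈V H → d s ≡ suc i → ladj H y s ≡ ladj H x s)

    -- By `same-layer`, a neighbour of `C` in the last layer belongs to `C`. So `C` is left only
    -- towards the parents of x, each of which sees all of `C`; with a second member, `C` is a side
    -- of a split, as u and `s₀` lie outside.
    no-C : ∀ {y} → y ∈V H → C y → y ≢ x → ⊥
    no-C y∈ cy y≢x = prime-no-split pr g C x∈ (ex , λ _ _ → refl) y∈ cy (y≢x ∘ ≡-sym)
      u∈ (λ (e , _) → case trans (≡-sym du) e of λ ())
      s₀∈ (λ (e , _) → case trans (≡-sym es₀) e of λ ())
      (diff du es₀ λ ())
      λ { a∈ (ea , fa) a'∈ (ea' , fa') b∈ nb b'∈ nb' ab' ba' →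
          case near-top a'∈ b∈ (~sym b∈ a'∈ ba') ea' of λ
          { (inj₁ eb) → trans (fa b∈ eb) (trans (≡-sym (fa' b∈ eb)) (~sym b∈ a'∈ ba'))
          ; (inj₂ eb) → ⊥-elim (nb (eb , λ s es → trans (same-down b∈ a'∈ ba' eb ea' s es) (fa' s es))) } }

    x-top : ∀ {b} → b ∈V H → d b ≡ suc (suc i) → ¬ x ~ b
    x-top {b} b∈ eb xb = no-C b∈ (eb , λ s es → ≡-sym (same-down x∈ b∈ xb ex eb s es))
                              (λ { refl → ~irr x∈ xb })

    W : ℕ → Set
    W y = (d y ≡ suc i × x ~ y) ⊎
          (d y ≡ suc (suc i) × (∀ {s} → s ∈V H → d s ≡ suc i → y ~ s → x ~ s))

    exit : ∀ {a b} → a ∈V H → W a → b ∈V H → ¬ W b → a ~ b → d a ≡ suc i × x ~ a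
    exit a∈ (inj₁ p) b∈ nb ab = p
    exit a∈ (inj₂ (ea , fa)) b∈ nb ab with near-top a∈ b∈ ab ea
    ... | inj₁ eb = ⊥-elim (nb (inj₁ (eb , fa b∈ eb ab)))
    ... | inj₂ eb = ⊥-elim (nb (inj₂ (eb , λ s es bs → fa s es (trans (same-down a∈ b∈ ab ea eb s es) bs))))

    -- All parents of x have the same neighbours b outside `W`. For b one layer below them this is
    -- `co-parents`. Otherwise x and b have the common neighbour a', while a path from x to b by a
    -- and a vertex of layer i contains no common neighbour of theirs, contrary to `no-middle`.
    module _ {a a' b} (a∈ : a ∈V H) (ea : d a ≡ suc i) (xa : x ~ a)
                      (a'∈ : a' ∈V H) (ea' : d a' ≡ suc i) (xa' : x ~ a')
                      (b∈ : b ∈V H) (nb : ¬ W b) (a'b : a' ~ b) (nab : ¬ a ~ b) where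
      below : d b ≡ i → ⊥
      below eb = nab (co-parents x∈ a'∈ a∈ b∈ ex ea' ea eb xa' xa a'b)

      x≁down : ∀ {t} → t ∈V H → d t ≡ i → ¬ x ~ t
      x≁down {t} t∈ et xt = ℕₚ.<-irrefl refl
        (subst (λ z → suc (suc i) ≤ suc z) et (subst (_≤ suc (d t)) ex (d-edge x∈ t∈ xt)))

      level : d b ≡ suc i → ⊥
      level eb with parent b∈ eb
      ... | t , t∈ , bt , et =
        no-middle (web-add (web-add (web-add (web-one b∈) t∈ (here refl) (~sym b∈ t∈ bt))
          a∈ (here refl) at) x∈ (here refl) xa)
          (here refl) (there (there (there (here refl)))) (diff ex eb λ ()) xb a'∈ xa' a'b λ
          { (here refl) xq _ → ~irr x∈ xq
          ; (there (here refl)) _ qb → nab qb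
          ; (there (there (here refl))) xq _ → x≁down t∈ et xq
          ; (there (there (there (here refl)))) xq _ → xb xq }
        where
        xb : ¬ x ~ b
        xb e = nb (inj₁ (eb , e))
        a't = same-layer b∈ a'∈ (~sym a'∈ b∈ a'b) eb ea' t∈ et bt
        at = co-parents x∈ a'∈ a∈ t∈ ex ea' ea et xa' xa a't

      above : d b ≡ suc (suc i) → ⊥
      above eb = nb (inj₂ (eb , λ {z} z∈ ez bz → ≢false λ xz → clash z∈ ez bz (λ e → true≢false e xz)))
        where
        clash : ∀ {z} → z ∈V H → d z ≡ suc i → b ~ z → ¬ x ~ z → ⊥
        clash {z} z∈ ez bz xz with parent a'∈ ea'
        ... | t , t∈ , a't , et =
          no-middle (web-add (web-add (web-add (web-add (web-one b∈) z∈ (here refl) (~sym b∈ z∈ bz))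
            t∈ (here refl) (~sym z∈ t∈ zt)) a∈ (here refl) at) x∈ (here refl) xa)
            (here refl) (there (there (there (there (here refl))))) (λ { refl → nab (~sym x∈ a∈ xa) })
            (x-top b∈ eb) a'∈ xa' a'b λ
            { (here refl) xq _ → ~irr x∈ xq
            ; (there (here refl)) _ qb → nab qb
            ; (there (there (here refl))) xq _ → x≁down t∈ et xq
            ; (there (there (there (here refl)))) xq _ → xz xq
            ; (there (there (there (there (here refl))))) xq _ → x-top b∈ eb xq }
          where
          zt = co-parents b∈ a'∈ z∈ t∈ eb ea' ez et (~sym a'∈ b∈ a'b) bz a't
          at = co-parents x∈ a'∈ a∈ t∈ ex ea' ea et xa' xa a't

      same-exit : ⊥
      same-exit with ℕₚ.m≤n⇒m<n∨m≡n (mx b∈)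
      ... | inj₂ eb = above eb
      ... | inj₁ lt with ℕₚ.m≤n⇒m<n∨m≡n (ℕₚ.≤-pred lt)
      ... | inj₂ eb = level eb
      ... | inj₁ lt' = below (ℕₚ.≤-antisym (ℕₚ.≤-pred lt')
                         (ℕₚ.≤-pred (subst (_≤ suc (d b)) ea' (d-edge a'∈ b∈ a'b))))

    -- By `exit` the edges leaving `W` start at parents of x, and by `same-exit` these agree outside
    -- `W`. The other side of the split has the two vertices u and o.
    no-W : ∀ {o} → o ∈V H → ¬ W o → o ≢ u → ⊥
    no-W o∈ now o≢u = prime-no-split pr g W x∈ (inj₂ (ex , λ _ _ → id)) s₀∈ (inj₁ (es₀ , xs₀))
      (diff ex es₀ λ ())
      u∈ (λ { (inj₁ (e , _)) → case trans (≡-sym du) e of λ () ; (inj₂ (e , _)) → case trans (≡-sym du) e of λ () })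
      o∈ now (o≢u ∘ ≡-sym)
      λ a∈ wa a'∈ wa' b∈ nb b'∈ nb' ab' ba' → ≢false λ nab →
        let a'b = ~sym b∈ a'∈ ba'
            (ea , xa) = exit a∈ wa b'∈ nb' ab'
            (ea' , xa') = exit a'∈ wa' b∈ nb a'b in
        same-exit a∈ ea xa a'∈ ea' xa' b∈ nb a'b (λ e → true≢false e nab)

    -- A parent of `s₀` lies in layer i, hence outside `W`, so it can only be u.
    i≡0 : i ≡ 0
    i≡0 with parent s₀∈ es₀
    ... | t , t∈ , _ , et with t ≟ u
    ... | yes refl = trans (≡-sym et) du
    ... | no t≢u = ⊥-elim (no-W t∈ (λ { (inj₁ (e , _)) → ℕₚ.1+n≢n (≡-sym (trans (≡-sym et) e))
                                      ; (inj₂ (e , _)) → ℕₚ.m≢1+m+n i {1}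
                                          (trans (trans (≡-sym et) e) (cong suc (ℕₚ.+-comm 1 i))) }) t≢u)

    -- A vertex of layer 1 not adjacent to x would lie outside `W`. So u and x both have exactly
    -- layer 1 as neighbourhood, and they form a side of a split unless `s₀` is the only other
    -- vertex. What is left is a path on three vertices, the star with centre `s₀`.
    module Depth2 (i0 : i ≡ 0) where
      layer₁ : ∀ {v} → v ∈V H → d v ≡ 1 → x ~ v × u ~ v
      layer₁ {v} v∈ e = ≢false (λ nadj → no-W v∈
                          (λ { (inj₁ (_ , xv)) → true≢false xv nadj
                             ; (inj₂ (e' , _)) → case trans (≡-sym e) e' of λ () }) (diff e du λ ())) ,
                        uv (parent v∈ e)
        where
        uv : (∃ λ t → t ∈V H × v ~ t × d t ≡ 0) → u ~ v
        uv (t , t∈ , vt , et) with d0 t∈ et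
        ... | refl = ~sym v∈ u∈ vt
      layer₁ˣ : ∀ {v} → v ∈V H → x ~ v → d v ≡ 1
      layer₁ˣ v∈ xv with near-top x∈ v∈ xv ex
      ... | inj₁ e = trans e (cong suc i0)
      ... | inj₂ e = ⊥-elim (x-top v∈ e xv)
      layer₁ᵘ : ∀ {v} → v ∈V H → u ~ v → d v ≡ 1
      layer₁ᵘ {v} v∈ uv with d v in e | subst (λ z → d v ≤ suc z) du (d-edge v∈ u∈ (~sym u∈ v∈ uv))
      ... | zero | _ = ⊥-elim (~irr u∈ (subst (u ~_) (d0 v∈ e) uv))
      ... | suc zero | _ = refl
      ... | suc (suc _) | s≤s ()

      P : ℕ → Set
      P v = v ≡ u ⊎ v ≡ x
      P⇒~ : ∀ {a v} → v ∈V H → d v ≡ 1 → P a → a ~ v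
      P⇒~ v∈ e (inj₁ refl) = proj₂ (layer₁ v∈ e)
      P⇒~ v∈ e (inj₂ refl) = proj₁ (layer₁ v∈ e)
      ~⇒layer₁ : ∀ {a v} → v ∈V H → P a → a ~ v → d v ≡ 1
      ~⇒layer₁ v∈ (inj₁ refl) = layer₁ᵘ v∈
      ~⇒layer₁ v∈ (inj₂ refl) = layer₁ˣ v∈

      no-P : ∀ {c e} → c ∈V H → ¬ P c → e ∈V H → ¬ P e → c ≢ e → ⊥
      no-P c∈ pc e∈ pe ce = prime-no-split pr g P u∈ (inj₁ refl) x∈ (inj₂ refl) (diff du ex λ ())
        c∈ pc e∈ pe ce
        λ a∈ pa a'∈ pa' b∈ _ _ _ _ ba' → P⇒~ b∈ (~⇒layer₁ b∈ pa' (~sym b∈ a'∈ ba')) pa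

      es₁ : d s₀ ≡ 1
      es₁ = trans es₀ (cong suc i0)
      ¬Ps₀ : ¬ P s₀
      ¬Ps₀ (inj₁ e) = diff es₁ du (λ ()) e
      ¬Ps₀ (inj₂ e) = diff es₀ ex (λ ()) e
      all-P : ∀ {v} → v ∈V H → v ≢ s₀ → P v
      all-P {v} v∈ n with v ≟ u | v ≟ x
      ... | yes e | _ = inj₁ e
      ... | no _ | yes e = inj₂ e
      ... | no a | no b = ⊥-elim (no-P v∈ [ a , b ]′ s₀∈ ¬Ps₀ n)

      is-star : IsStar H
      is-star = s₀ , s₀∈ , λ p q p∈ q∈ p≢q → centre p q p∈ q∈ ,
        λ { (inj₁ refl) → ~sym q∈ s₀∈ (P⇒~ s₀∈ es₁ (all-P q∈ (p≢q ∘ ≡-sym)))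
          ; (inj₂ refl) → P⇒~ s₀∈ es₁ (all-P p∈ p≢q) }
        where
        d≢1 : ∀ {v} → P v → d v ≢ 1
        d≢1 (inj₁ refl) e = case trans (≡-sym du) e of λ ()
        d≢1 (inj₂ refl) e = case trans (≡-sym ex) e of λ ()
        centre : ∀ p q → p ∈V H → q ∈V H → p ~ q → p ≡ s₀ ⊎ q ≡ s₀
        centre p q p∈ q∈ pq with p ≟ s₀ | q ≟ s₀
        ... | yes e | _ = inj₁ e
        ... | no _ | yes e = inj₂ e
        ... | no np | no nq = ⊥-elim (d≢1 (all-P q∈ nq) (~⇒layer₁ q∈ (all-P p∈ np) pq))

    star : IsStar H
    star = Depth2.is-star i≡0

-- A non-adjacent pair u, w puts w at distance at least two from u. `Layers` is then run from u,
-- with a vertex at maximal distance as x.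
prime-DH : ∀ {H} → Good H → DHL H → Prime H → ¬ ¬ (Clique H ⊎ IsStar H)
prime-DH {H} g dh pr k = k (inj₁ λ u w u∈ w∈ u≢w → ≢false λ uw → deep u∈ w∈ u≢w uw)
  where
  deep : ∀ {u w} → u ∈V H → w ∈V H → u ≢ w → ladj H u w ≡ false → ⊥
  deep {u} {w} u∈ w∈ u≢w uw =
    choice 0 (λ v m → Walk H (_∈V H) v u m × (∀ j → Walk H (_∈V H) v u j → m ≤ j)) (V H)
      (λ v∈ → let (m , wk) = star-walk (gconn g v∈ u∈) in least (Walk H (_∈V H) _ u) m wk)
      λ (d , dok) → run d (proj₁ ∘ dok) (λ v∈ → proj₂ (dok v∈) _)
    where
    run : (d : ℕ → ℕ) → (∀ {v} → v ∈V H → Walk H (_∈V H) v u (d v)) →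
          (∀ {v m} → v ∈V H → Walk H (_∈V H) v u m → d v ≤ m) → ⊥
    run d dwalk dmin = finish (argmax d w∈)
      where
      open Layers g dh pr u∈ d dwalk dmin
      far : ∀ {j} → d w ≡ j → 2 ≤ j
      far {zero} e = ⊥-elim (u≢w (≡-sym (d0 w∈ e)))
      far {suc zero} e with parent w∈ e
      ... | t , t∈ , wt , et with d0 t∈ et
      ... | refl = ⊥-elim (true≢false (~sym w∈ u∈ wt) uw)
      far {suc (suc _)} e = s≤s (s≤s z≤n)
      finish : (∃ λ x → x ∈V H × (∀ {y} → y ∈V H → d y ≤ d x)) → ⊥
      finish (x , x∈ , mx) = at-depth (d x) refl
        where
        at-depth : ∀ j → d x ≡ j → ⊥
        at-depth j e with ℕₚ.≤-trans (far refl) (subst (d w ≤_) e (mx w∈))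
        at-depth (suc (suc i)) e | s≤s (s≤s _) =
          k (inj₂ (Last.star x∈ e (λ y∈ → subst (d _ ≤_) e (mx y∈))))

-- Asteroidal triples from three leaves

emb-walk : ∀ {A H} (e : Emb A H) → ∀ {x y k} → Walk A (_∈V A) x y k →
           Walk H (_∈V H) (Emb.f e x) (Emb.f e y) k
emb-walk e nil = nil
emb-walk e (cons (edge a b c) w) =
  cons (edge (Emb.f∈ e a) (Emb.f∈ e b) (trans (Emb.f-adj e a b) c)) (emb-walk e w)

emb-walk⁻ : ∀ {A H} (e : Emb A H) {S} → (∀ {x} → x ∈ S → x ∈V A) →
            ∀ {x y x' y' k} → x ∈ S → y ∈ S → x' ≡ Emb.f e x → y' ≡ Emb.f e y →
            Walk H (_∈ map (Emb.f e) S) x' y' k → Walk A (_∈ S) x y k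
emb-walk⁻ e sub x∈ y∈ p q nil with Emb.f-inj e (sub x∈) (sub y∈) (trans (≡-sym p) q)
... | refl = nil
emb-walk⁻ e sub x∈ y∈ refl q (cons (edge a b c) w) with ∈-map⁻ (Emb.f e) b
... | z , z∈ , refl = cons (edge x∈ z∈ (trans (≡-sym (Emb.f-adj e (sub x∈) (sub z∈))) c))
                           (emb-walk⁻ e sub z∈ y∈ refl q w)

DHL-emb : ∀ {A H} → Emb A H → DHL H → DHL A
DHL-emb {A} {H} e dh S sub conn u∈ v∈ w k =
  dh (map e.f S) sub' conn' (∈-map⁺ e.f u∈) (∈-map⁺ e.f v∈) (emb-walk e w)
    λ (l , le , w') → k (l , le , emb-walk⁻ e sub u∈ v∈ refl refl w')
  where
  module e = Emb e
  sub' : ∀ {x} → x ∈ map e.f S → x ∈V H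
  sub' x∈ with ∈-map⁻ e.f x∈
  ... | z , z∈ , refl = e.f∈ (sub z∈)
  conn' : ConnOn H (_∈ map e.f S)
  conn' x∈ y∈ with ∈-map⁻ e.f x∈ | ∈-map⁻ e.f y∈
  ... | _ , a , refl | _ , b , refl = emb-star e (_∈ S) (_∈ map e.f S) sub (∈-map⁺ e.f) (conn a b)

module _ (G : Graph) (dh : DistanceHereditary G) where
  private
    subset : List ℕ → Subset.Subset (n G)
    subset S = Vec.tabulate (λ i → does (toℕ i ∈? S))
    subset⁺ : ∀ {S} i → toℕ i ∈ S → i Subset.∈ subset S
    subset⁺ {S} i i∈ = Vecₚ.lookup⇒[]= i (subset S)
      (trans (Vecₚ.lookup∘tabulate (λ i → does (toℕ i ∈? S)) i) (dec-true (toℕ i ∈? S) i∈))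
    subset⁻ : ∀ {S} i → i Subset.∈ subset S → toℕ i ∈ S
    subset⁻ {S} i i∈ with toℕ i ∈? S in eq
    ... | yes p = p
    ... | no q = ⊥-elim (true≢false (trans (≡-sym (Vecₚ.lookup∘tabulate (λ i → does (toℕ i ∈? S)) i))
                                           (Vecₚ.[]=⇒lookup i∈))
                                    (dec-false (toℕ i ∈? S) q))

  -- Classically there is a least length of a walk within `S`; by distance heredity it is least
  -- among all walks of `G`, hence at most d.
  DHL-base : DHL (base G)
  DHL-base S sub conn {u} {v} {d} u∈ v∈ w k with base∈⁻ G (sub u∈) | base∈⁻ G (sub v∈)
  ... | i , refl | j , refl =
    let (l , wl) = star-walk (conn u∈ v∈) in
    least (WalkIn G (Subset._∈ subset S) i j) l (to v∈ refl refl wl) λ (d₀ , w₀ , mn) →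
      k (d₀ , proj₂ (proj₂ (dh (subset S) conn' i j (subset⁺ i u∈) (subset⁺ j v∈) d₀) (w₀ , mn)) d (all refl refl w) ,
         from w₀)
    where
    all : ∀ {x y i j k} → x ≡ toℕ i → y ≡ toℕ j → Walk (base G) (_∈V base G) x y k → WalkIn G (Everything G) i j k
    all refl q nil with Finₚ.toℕ-injective q
    ... | refl = here tt
    all refl q (cons (edge a b e) w) with base∈⁻ G b
    ... | z , refl = step tt (trans (≡-sym (base-adj G _ z)) e) (all refl q w)
    to : ∀ {x y i j k} → y ∈ S → x ≡ toℕ i → y ≡ toℕ j → Walk (base G) (_∈ S) x y k →
         WalkIn G (Subset._∈ subset S) i j k
    to {i = i} y∈ refl q nil with Finₚ.toℕ-injective q
    ... | refl = here (subset⁺ i y∈)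
    to {i = i} y∈ refl q (cons (edge a b e) w) with base∈⁻ G (sub b)
    ... | z , refl = step (subset⁺ i a) (trans (≡-sym (base-adj G i z)) e) (to y∈ refl q w)
    from : ∀ {i j k} → WalkIn G (Subset._∈ subset S) i j k → Walk (base G) (_∈ S) (toℕ i) (toℕ j) k
    from (here _) = nil
    from (step {u = i} {w = z} a e w) =
      cons (edge (subset⁻ i a) (subset⁻ z (start w)) (trans (base-adj G i z) e)) (from w)
      where
      start : ∀ {i j k} → WalkIn G (Subset._∈ subset S) i j k → i Subset.∈ subset S
      start (here p) = p
      start (step p _ _) = p
    conn' : ConnectedIn G (subset S)
    conn' x y x∈ y∈ = let (l , wl) = star-walk (conn (subset⁻ x x∈) (subset⁻ y y∈)) in
                      l , to (subset⁻ y y∈) refl refl wl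

node-emb-side : ∀ {m H A B D E K} → Glue m H A B D E → Emb K A → Emb K H
node-emb-side {B = B} g e =
  let module g = Glue g
      b = big-but g.bb _
      (t , t∈ , mt) = neighbour {B} (gconn (rep-good g.s)) g.mB (TwoBut.c₁∈ b) (TwoBut.c₁≢m b ∘ ≡-sym) in
  emb-trans e (joinEmb g.j (rep-good g.r) (rep-good g.s) t∈ mt)

-- At each join the marker is represented by one of its neighbours on the other side. Thus nodes
-- inherit distance heredity.
node-emb : ∀ {H D K R} → Rep H D → D ↭ K ∷ R → Emb K H
node-emb {H} {K = K} (leaf g e) p with ↭-singleton-inv (↭-sym p)
... | refl = emb-≅ {K} {H} (≅-sym {H} {K} e)
node-emb (join {D = D} j a b r s sp q) p with pick D (↭-trans (↭-sym p) q)
... | inj₁ (_ , d , _) = node-emb-side (glue j a b r s sp) (node-emb r d)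
... | inj₂ (_ , d , _) = node-emb-side (glue-swap (glue j a b r s sp)) (node-emb s d)

Simple : LGraph → Set
Simple H = Clique H ⊎ IsStar H

simple-≅ : ∀ {A B} → A ≅ B → Simple A → Simple B
simple-≅ (to , from , e) (inj₁ cl) =
  inj₁ λ x y x∈ y∈ n → trans (≡-sym (e x y (from x x∈) (from y y∈))) (cl x y (from x x∈) (from y y∈) n)
simple-≅ (to , from , e) (inj₂ (c , c∈ , f)) =
  inj₂ (c , to c c∈ , λ x y x∈ y∈ n →
    let (f₁ , f₂) = f x y (from x x∈) (from y y∈) n
        q = e x y (from x x∈) (from y y∈) in
    (λ a → f₁ (trans q a)) , λ a → trans (≡-sym q) (f₂ a))

All-pointwise : ∀ {P : LGraph → Set} {D E} → (∀ {A B} → A ≅ B → P A → P B) →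
                Pointwise _≅_ D E → All P D → All P E
All-pointwise f [] [] = []
All-pointwise f (_∷_ {x = A} {y = B} e p) (a ∷ as) = f {A} {B} e a ∷ All-pointwise f p as

All-≈D : ∀ {P : LGraph → Set} {D E} → (∀ {A B} → A ≅ B → P A → P B) → D ≈D E → All P D → All P E
All-≈D {P} f d ps with ≈D⇒≋ d
... | X , p , q = All-resp-↭ q (All-pointwise {P} f p ps)

Simples : List LGraph → Set
Simples = All (λ H → ¬ ¬ Simple H)

simples-≈D : ∀ {D E} → D ≈D E → Simples D → Simples E
simples-≈D = All-≈D {λ H → ¬ ¬ Simple H} (λ {A} {B} e h k → h (k ∘ simple-≅ {A} {B} e))

All-picks : ∀ {P : LGraph → Set} D → (∀ {K R} → D ↭ K ∷ R → P K) → All P D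
All-picks [] f = []
All-picks (K ∷ D) f = f ↭-refl ∷ All-picks D (λ {L} p → f (↭-trans (prep K p) (swap K L ↭-refl)))

standard-simples : ∀ G {D} → Connected G → DistanceHereditary G → IsStandard G D → Simples D
standard-simples G {D} conn dh (dec , nice , _) = All-picks D λ p k →
  case All.head (All-resp-↭ p nice) of λ
    { (inj₁ pr) → prime-DH (All.head (All-resp-↭ p (rep-allGood r))) (DHL-emb (node-emb r p) (DHL-base G dh)) pr k
    ; (inj₂ s) → k s }
  where r = decomposition-rep G conn dec

-- The form of minimality that passes to sublists, hence through pruning. It speaks of stars because
-- the obstruction next to a leaf star is a star centred at the common marker.
Reduced : List LGraph → Set
Reduced D = ∀ {A B R m K} → D ↭ A ∷ B ∷ R → IsJoin m K A B → ¬ IsStar K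

Avoid : LGraph → ℕ → ℕ → Set
Avoid H z w = w ∈V H × w ≢ z × ladj H z w ≡ false

record ATL (H : LGraph) (x y z : ℕ) : Set where
  field
    x∈ : x ∈V H
    y∈ : y ∈V H
    z∈ : z ∈V H
    x≢y : x ≢ y
    y≢z : y ≢ z
    x≢z : x ≢ z
    xy : Star (EdgeOn H (Avoid H z)) x y
    yz : Star (EdgeOn H (Avoid H x)) y z
    xz : Star (EdgeOn H (Avoid H y)) x z

NoATL : LGraph → Set
NoATL H = ∀ {x y z} → ¬ ATL H x y z

noATL-emb : ∀ {A H} → Emb A H → NoATL H → NoATL A
noATL-emb {A} {H} e h t = h record
  { x∈ = e.f∈ x∈ ; y∈ = e.f∈ y∈ ; z∈ = e.f∈ z∈
  ; x≢y = x≢y ∘ e.f-inj x∈ y∈ ; y≢z = y≢z ∘ e.f-inj y∈ z∈ ; x≢z = x≢z ∘ e.f-inj x∈ z∈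
  ; xy = push' z∈ xy ; yz = push' x∈ yz ; xz = push' y∈ xz }
  where
  module e = Emb e
  open ATL t
  push' : ∀ {z a b} → z ∈V A → Star (EdgeOn A (Avoid A z)) a b →
          Star (EdgeOn H (Avoid H (e.f z))) (e.f a) (e.f b)
  push' {z} z∈ = emb-star e (Avoid A z) (Avoid H (e.f z)) proj₁
    (λ (w∈ , n , q) → e.f∈ w∈ , n ∘ e.f-inj w∈ z∈ , trans (e.f-adj z∈ w∈) q)

noATL-base : ∀ G → ATFree G → NoATL (base G)
noATL-base G h t with base∈⁻ G (ATL.x∈ t) | base∈⁻ G (ATL.y∈ t) | base∈⁻ G (ATL.z∈ t)
... | i , refl | j , refl | k , refl =
  h i j k (x≢y ∘ cong toℕ , y≢z ∘ cong toℕ , x≢z ∘ cong toℕ ,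
           walk (x≢y ∘ cong toℕ) xy , walk (y≢z ∘ cong toℕ) yz , walk (x≢z ∘ cong toℕ) xz)
  where
  open ATL t
  avoid : ∀ {z w} → Avoid (base G) (toℕ z) (toℕ w) → AvoidN G z w
  avoid {z} {w} (_ , n , e) = n ∘ cong toℕ , trans (≡-sym (base-adj G z w)) e
  go : ∀ {z a b x y} → x ≡ toℕ a → y ≡ toℕ b → AvoidN G z b → Star (EdgeOn (base G) (Avoid (base G) (toℕ z))) x y →
       ∃ (WalkIn G (AvoidN G z) a b)
  go refl q av ε with Finₚ.toℕ-injective q
  ... | refl = 0 , here av
  go {a = a} refl q av (edge p p' e ◅ s) with base∈⁻ G (proj₁ p')
  ... | w , refl = let (l , r) = go refl q av s in suc l , step (avoid p) (trans (≡-sym (base-adj G a w)) e) r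
  -- `WalkIn` also asks its last vertex to avoid z. This is read off the last edge, which exists as
  -- the ends differ.
  last : ∀ {z b x} → x ≢ toℕ b → Star (EdgeOn (base G) (Avoid (base G) (toℕ z))) x (toℕ b) → AvoidN G z b
  last nq ε = ⊥-elim (nq refl)
  last {b = b} nq (_◅_ {j = y} (edge _ p _) s) with y ≟ toℕ b
  ... | yes refl = avoid p
  ... | no nq' = last nq' s
  walk : ∀ {z a b} → a ≢ b → Star (EdgeOn (base G) (Avoid (base G) (toℕ z))) (toℕ a) (toℕ b) →
         ∃ (WalkIn G (AvoidN G z) a b)
  walk nq s = go refl refl (last (nq ∘ Finₚ.toℕ-injective) s) s

Minus : LGraph → ℕ → ℕ → Set
Minus H x y = y ∈V H × y ≢ x

minus-side : ∀ {m H A B D E D' K x} → Glue m H A B D E → D ↭ K ∷ D' → x ∈V H → x ∈V K →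
             (x ∈V A → ConnOn A (Minus A x)) → ConnOn H (Minus H x)
minus-side {m} {H} {A} {B} {x = x} g d x∈ xK ih y∈ z∈ =
  star-mono [ (λ ((p , n) , n') → g.inA p n' , n) , (λ (p , n) → g.inB p n , x≢B p) ]′
    (join-conn (Minus A x) g.j (rep-good g.r) (rep-good g.s) proj₁ (g.mA , x≢m ∘ ≡-sym) other (ih xA) g.bb
      (sort y∈) (sort z∈))
  where
  module g = Glue g
  x≢m : x ≢ m
  x≢m = g.out≢ x∈
  x∉B : ¬ x ∈V B
  x∉B p = x≢m (g.sp (occ-here d xK) (rep-V g.s p))
  x≢B : ∀ {y} → y ∈V B → y ≢ x
  x≢B p refl = x∉B p
  xA : x ∈V A
  xA = [ proj₁ , ⊥-elim ∘ x∉B ∘ proj₁ ]′ (g.out x∈)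
  other : ∃ λ s → Minus A x s × s ≢ m
  other with big-but g.ba m
  ... | twoBut {a} {b} a∈ b∈ am bm ab with a ≟ x
  ... | no n = a , (a∈ , n) , am
  ... | yes refl = b , (b∈ , ab ∘ ≡-sym) , bm
  sort : ∀ {y} → Minus H x y → (Minus A x y × y ≢ m) ⊎ (y ∈V B × y ≢ m)
  sort (p , n) = Sum.map (λ (a , n') → (a , n) , n') id (g.out p)

-- Whether x is a cut vertex is visible in its node: at each join the other side stays whole and is
-- attached through a marker different from x.
rep-minus : ∀ {H D K R x} → Rep H D → D ↭ K ∷ R → x ∈V H → x ∈V K →
            ConnOn K (Minus K x) → ConnOn H (Minus H x)
rep-minus {H} {K = K} {x = x} (leaf g e) p x∈ xK c (a , n) (b , n') with ↭-singleton-inv (↭-sym p)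
... | refl = emb-star (emb-≅ {K} {H} (≅-sym {H} {K} e)) (Minus K x) (Minus H x) proj₁
               (λ (q , r) → proj₁ (proj₂ e) _ q , r) (c (proj₁ e _ a , n) (proj₁ e _ b , n'))
rep-minus (join {D = D} j a b r s sp q) p x∈ xK c with pick D (↭-trans (↭-sym p) q)
... | inj₁ (_ , d , _) = minus-side (glue j a b r s sp) d x∈ xK (λ xA → rep-minus r d xA xK c)
... | inj₂ (_ , d , _) =
  minus-side (glue-swap (glue j a b r s sp)) d x∈ xK (λ xA → rep-minus s d xA xK c)

simple-minus : ∀ {K x} → Good K → Clique K ⊎ (∃ λ c → c ≢ x × c ∈V K × (∀ y → y ∈V K → y ≢ c → ladj K c y ≡ true)) →
               ConnOn K (Minus K x)
simple-minus g (inj₁ cl) {y} {z} (a , n) (b , n') with y ≟ z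
... | yes refl = ε
... | no yz = edge (a , n) (b , n') (cl y z a b yz) ◅ ε
simple-minus {K} {x} g (inj₂ (c , cx , c∈ , f)) {y} {z} (a , n) (b , n') = to y (a , n) ◅◅ from z (b , n')
  where
  from : ∀ y → Minus K x y → Star (EdgeOn K (Minus K x)) c y
  from y (a , n) with y ≟ c
  ... | yes refl = ε
  ... | no yc = edge (c∈ , cx) (a , n) (f y a yc) ◅ ε
  to : ∀ y → Minus K x y → Star (EdgeOn K (Minus K x)) y c
  to y p = star-reverse g proj₁ (from y p)

-- In `A` only the centre c sees the marker, and in `B` every vertex sees it; so across the join c
-- sees everything and no other vertex of `A` sees anything.
star-star-join : ∀ {m c H A B} → IsJoin m H A B → Good A → Good B → c ≢ m → c ∈V A →
                 (∀ x y → x ∈V A → y ∈V A → x ≢ y →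
                   (ladj A x y ≡ true → x ≡ c ⊎ y ≡ c) × (x ≡ c ⊎ y ≡ c → ladj A x y ≡ true)) →
                 (∀ x y → x ∈V B → y ∈V B → x ≢ y →
                   (ladj B x y ≡ true → x ≡ m ⊎ y ≡ m) × (x ≡ m ⊎ y ≡ m → ladj B x y ≡ true)) →
                 IsStar H
star-star-join {m} {c} {H} {A} {B} j gA gB c≢m c∈ fA fB = c , inA c∈ c≢m , prop
  where
  open IsJoin j
  c≢B : ∀ {y} → y ∈V B → y ≢ c
  c≢B yB refl = c≢m (sep c∈ yB)
  prop : ∀ x y → x ∈V H → y ∈V H → x ≢ y →
         (ladj H x y ≡ true → x ≡ c ⊎ y ≡ c) × (x ≡ c ⊎ y ≡ c → ladj H x y ≡ true)
  prop x y x∈ y∈ xy with out x∈ | out y∈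
  ... | inj₁ (xA , n) | inj₁ (yA , n') rewrite adjA xA n yA n' = fA x y xA yA xy
  ... | inj₁ (xA , n) | inj₂ (yB , n') rewrite adjAB xA n yB n' =
    (λ e → [ inj₁ , (λ e' → ⊥-elim (c≢m (≡-sym e'))) ]′ (proj₁ (fA x m xA mA n) (proj₁ (∧-true⁻ e)))) ,
    λ { (inj₁ e) → ∧-true⁺ (proj₂ (fA x m xA mA n) (inj₁ e)) (proj₂ (fB m y mB yB (n' ∘ ≡-sym)) (inj₁ refl))
      ; (inj₂ e) → ⊥-elim (c≢B yB e) }
  ... | inj₂ (xB , n) | inj₁ (yA , n') rewrite adjBA xB n yA n' =
    (λ e → [ (λ e' → ⊥-elim (c≢m (≡-sym e'))) , inj₂ ]′
      (proj₁ (fA m y mA yA (n' ∘ ≡-sym)) (proj₂ (∧-true⁻ {ladj B x m} e)))) ,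
    λ { (inj₂ e) → ∧-true⁺ (proj₂ (fB x m xB mB n) (inj₂ refl)) (proj₂ (fA m y mA yA (n' ∘ ≡-sym)) (inj₂ e))
      ; (inj₁ e) → ⊥-elim (c≢B xB e) }
  ... | inj₂ (xB , n) | inj₂ (yB , n') rewrite adjB xB n yB n' =
    (λ e → ⊥-elim ([ n , n' ]′ (proj₁ (fB x y xB yB xy) e))) ,
    [ (λ e → ⊥-elim (c≢B xB e)) , (λ e → ⊥-elim (c≢B yB e)) ]′

-- What one leaf contributes to an asteroidal triple: a vertex p of its own, and paths missing the
-- closed neighbourhood of p between any two vertices outside the leaf.
record Pendant (H L : LGraph) (m : ℕ) : Set where
  field
    {p}  : ℕ
    p∈H  : p ∈V H
    p∈L  : p ∈V L
    p≢m  : p ≢ m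
    away : ∀ {a b} → a ∈V H → ¬ a ∈V L → b ∈V H → ¬ b ∈V L → Star (EdgeOn H (Avoid H p)) a b

leaf-pendant : ∀ {H D L R} → Rep H D → D ↭ L ∷ R → (l : Attached L R) → Simples D → Reduced D →
               ¬ ∃ (PruneStep D) → ¬ ¬ Pendant H L (Attached.at l)
leaf-pendant {H} {D} {L} {R} r p l@(attached {m} m∈ o only) simp red unp k =
  All.head simp' on-L
  where
  simp' = All-resp-↭ p simp
  goods = All-resp-↭ p (rep-allGood r)
  gL = All.head goods
  module D = Detached (detach r p l)
  module j = IsJoin D.isJoin
  unpruned : ¬ (∀ y → y ∈V L → y ≢ m → ladj L m y ≡ true)
  unpruned univ = unp (R , L , ↭⇒≈D p , m , m∈ , o , (λ x x∈ ox → only x∈ ox) , univ)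
  on-L : ¬ Simple L
  on-L (inj₁ cl) = unpruned (λ y y∈ n → cl m y m∈ y∈ (n ∘ ≡-sym))
  on-L (inj₂ (c , c∈ , f)) with c ≟ m
  ... | yes refl = unpruned (λ y y∈ n → proj₂ (f c y c∈ y∈ (n ∘ ≡-sym)) (inj₁ refl))
  ... | no c≢m with occ-pick (rep-V D.rep j.mB)
  ... | K , R' , q , mK = All.head (All-resp-↭ q (All.tail simp')) (on-K pend)
    where
    gK = All.head (All-resp-↭ q (All.tail goods))
    pend : ∃ λ p → p ∈V L × p ≢ m × p ≢ c
    pend with big-but D.bigL m
    ... | twoBut {a} {b} a∈ b∈ am bm ab with a ≟ c
    ... | no n = a , a∈ , am , n
    ... | yes refl = b , b∈ , bm , ab ∘ ≡-sym
    on-K : (∃ λ p → p ∈V L × p ≢ m × p ≢ c) → ¬ Simple K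
    on-K (v , v∈ , v≢m , v≢c) sK = k record
      { p∈H = j.inA v∈ v≢m ; p∈L = v∈ ; p≢m = v≢m
      -- Outside `L` lies the rest without its marker. It is connected since the node `K` is so
      -- without the marker, and it misses the neighbourhood of v because v does not see the marker.
      ; away = λ a na b nb → Star.map
          (λ { (edge c d e) → edge (avoid c) (avoid d) (trans (j.adjB (proj₁ c) (proj₂ c) (proj₁ d) (proj₂ d)) e) })
          (rep-minus D.rep q j.mB mK (simple-minus gK (hub sK)) (inside a na) (inside b nb)) }
      where
      vm : ladj L v m ≡ false
      vm = ≢true λ e → [ v≢c , c≢m ∘ ≡-sym ]′ (proj₁ (f v m v∈ m∈ v≢m) e)
      avoid : ∀ {w} → Minus D.rest m w → Avoid H v w
      avoid (w∈ , wm) = j.inB w∈ wm , (λ { refl → v≢m (j.sep v∈ w∈) }) ,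
        trans (j.adjAB v∈ v≢m w∈ wm) (cong (_∧ ladj D.rest m _) vm)
      inside : ∀ {a} → a ∈V H → ¬ a ∈V L → Minus D.rest m a
      inside a na = [ (λ (z , _) → ⊥-elim (na z)) , id ]′ (j.out a)
      merged : IsJoin m (joinL m L K) L K
      merged = joinL-isJoin m∈ mK (λ xL xK → only xL (occ-here q xK))
      hub : Simple K → Clique K ⊎ (∃ λ c → c ≢ m × c ∈V K × (∀ y → y ∈V K → y ≢ c → ladj K c y ≡ true))
      hub (inj₁ cl) = inj₁ cl
      hub (inj₂ (c' , c'∈ , f')) with c' ≟ m
      ...   | no n = inj₂ (c' , n , c'∈ , λ y y∈ yn → proj₂ (f' c' y c'∈ y∈ (yn ∘ ≡-sym)) (inj₁ refl))
      ...   | yes refl = ⊥-elim (red (↭-trans p (prep L q)) merged (star-star-join merged gL gK c≢m c∈ f f'))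

record ThreeLeaves (D : List LGraph) : Set where
  constructor threeLeaves
  field
    {L₁ L₂ L₃} : LGraph
    {R} : List LGraph
    perm : D ↭ L₁ ∷ L₂ ∷ L₃ ∷ R
    a₁ : Attached L₁ (L₂ ∷ L₃ ∷ R)
    a₂ : Attached L₂ (L₁ ∷ L₃ ∷ R)
    a₃ : Attached L₃ (L₁ ∷ L₂ ∷ R)

-- A pendant vertex differs from the marker of its leaf and so lies in neither of the other two
-- leaves; `away` for each leaf therefore joins the pendant vertices of the others.
three-leaves-AT : ∀ {H D} → Rep H D → Simples D → Reduced D → ¬ ∃ (PruneStep D) → NoATL H → ¬ ThreeLeaves D
three-leaves-AT {H} r simp red unp noAT (threeLeaves {L₁} {L₂} {L₃} {R} p a₁ a₂ a₃) =
  leaf-pendant r p a₁ simp red unp λ p₁ →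
  leaf-pendant r (↭-trans p (swap L₁ L₂ ↭-refl)) a₂ simp red unp λ p₂ →
  leaf-pendant r (↭-trans p (↭-trans (prep L₁ (swap L₂ L₃ ↭-refl)) (swap L₁ L₃ ↭-refl))) a₃ simp red unp λ p₃ →
  let module p₁ = Pendant p₁
      module p₂ = Pendant p₂
      module p₃ = Pendant p₃
      n12 : ¬ p₁.p ∈V L₂
      n12 z = p₁.p≢m (Attached.only a₁ p₁.p∈L (here z))
      n13 : ¬ p₁.p ∈V L₃
      n13 z = p₁.p≢m (Attached.only a₁ p₁.p∈L (there (here z)))
      n21 : ¬ p₂.p ∈V L₁
      n21 z = p₂.p≢m (Attached.only a₂ p₂.p∈L (here z))
      n23 : ¬ p₂.p ∈V L₃
      n23 z = p₂.p≢m (Attached.only a₂ p₂.p∈L (there (here z)))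
      n31 : ¬ p₃.p ∈V L₁
      n31 z = p₃.p≢m (Attached.only a₃ p₃.p∈L (here z))
      n32 : ¬ p₃.p ∈V L₂
      n32 z = p₃.p≢m (Attached.only a₃ p₃.p∈L (there (here z)))
  in noAT {p₁.p} {p₂.p} {p₃.p} record
    { x∈ = p₁.p∈H ; y∈ = p₂.p∈H ; z∈ = p₃.p∈H
    ; x≢y = λ e → n12 (subst (_∈V L₂) (≡-sym e) p₂.p∈L)
    ; y≢z = λ e → n23 (subst (_∈V L₃) (≡-sym e) p₃.p∈L)
    ; x≢z = λ e → n13 (subst (_∈V L₃) (≡-sym e) p₃.p∈L)
    ; xy = p₃.away p₁.p∈H n13 p₂.p∈H n23
    ; yz = p₁.away p₂.p∈H n21 p₃.p∈H n31
    ; xz = p₂.away p₁.p∈H n12 p₃.p∈H n32 }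

-- Trees with at most two leaves

reduced-≈D : ∀ {D L D'} → D ≈D (L ∷ D') → Reduced D → Reduced D'
reduced-≈D {L = L} d red {A} {B} {R} p j st with ≈D⇒≋ d
... | X , e , q with ↭-Pointwise
  (↭-trans q (↭-trans (prep L p) (↭-trans (swap L A ↭-refl) (prep A (swap L B ↭-refl))))) (pointwise-sym e)
... | _ , a ∷ b ∷ _ , q' = red q' (join-swap (join-≅ (join-swap (join-≅ j a)) b)) st

record Pruned (H L : LGraph) (D' : List LGraph) : Set where
  field
    {m}      : ℕ
    detached : Detached m H L D'
    good     : Good L
    univ     : ∀ y → y ∈V L → y ≢ m → ladj L m y ≡ true

prune-rep : ∀ {H D D'} → Rep H D → (s : PruneStep D D') → Pruned H (proj₁ s) D'
prune-rep r (L , d , m , m∈ , o , only , univ) = record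
  { detached = detach r' ↭-refl (attached m∈ o (λ x∈ → only _ x∈))
  ; good = All.head (rep-allGood r') ; univ = univ }
  where r' = rep-≈D r d

record Pruning (P : List LGraph) : Set where
  field
    {top}   : LGraph
    rep     : Rep top P
    noATL   : NoATL top
    simples : Simples P
    reduced : Reduced P

-- The pruned list decomposes the rest, in which the marker is an ordinary vertex. A neighbour of
-- the marker in the removed leaf represents it in `H`, so no asteroidal triple appears.
prune-pruning : ∀ {H D D'} → Rep H D → NoATL H → Simples D → Reduced D → PruneStep D D' → Pruning D'
prune-pruning r na si re s@(L , d , _) = record
  { rep = Detached.rep P.detached
  ; noATL = noATL-emb (joinEmb (join-swap j) (rep-good (Detached.rep P.detached)) P.good
                        (proj₁ (proj₂ nb)) (proj₂ (proj₂ nb))) na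
  ; simples = All.tail (simples-≈D d si)
  ; reduced = reduced-≈D d re }
  where
  module P = Pruned (prune-rep r s)
  j = Detached.isJoin P.detached
  b = big-but (Detached.bigL P.detached) P.m
  nb = neighbour {L} (gconn P.good) (IsJoin.mA j) (TwoBut.c₁∈ b) (TwoBut.c₁≢m b ∘ ≡-sym)

prunes-pruning : ∀ {H D P} → Rep H D → NoATL H → Simples D → Reduced D → Star PruneStep D P → Pruning P
prunes-pruning r na si re ε = record { rep = r ; noATL = na ; simples = si ; reduced = re }
prunes-pruning r na si re (s ◅ ss) = prunes-pruning rep noATL simples reduced ss
  where open Pruning (prune-pruning r na si re s)

-- The inductive counterpart of the index condition in `IsPathTree`; `chain-indexed` and
-- `indexed-chain` translate.
data Chain : List LGraph → Set where
  one  : ∀ {q} → Chain [ q ]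
  link : ∀ {q q' Q x} → x ∈V q → x ∈V q' → (∀ {y} → y ∈V q → ¬ Occurs y Q) → Chain (q' ∷ Q) → Chain (q ∷ q' ∷ Q)

chain-snoc : ∀ X {a b x} → Chain (X ++ [ a ]) → x ∈V a → x ∈V b → (∀ {y} → y ∈V b → ¬ Occurs y X) →
             Chain (X ++ a ∷ b ∷ [])
chain-snoc [] c xa xb d = link xa xb (λ _ ()) one
chain-snoc (q ∷ []) (link p p' f c) xa xb d = link p p'
  (λ { y (here z) → d z (here y) ; y (there ()) }) (chain-snoc [] c xa xb λ _ ())
chain-snoc (q ∷ q' ∷ X) {a} {b} (link p p' f c) xa xb d =
  link p p' disj (chain-snoc (q' ∷ X) c xa xb (λ y o → d y (there o)))
  where
  disj : ∀ {y} → y ∈V q → ¬ Occurs y (X ++ a ∷ b ∷ [])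
  disj y o with Anyₚ.++⁻ X o
  ... | inj₁ z = f y (Anyₚ.++⁺ˡ z)
  ... | inj₂ (here z) = f y (Anyₚ.++⁺ʳ X (here z))
  ... | inj₂ (there (here z)) = d z (here y)

chain-reverse : ∀ {Q} → Chain Q → Chain (reverse Q)
chain-reverse one = one
chain-reverse (link {q} {q'} {Q} p p' f c) =
  subst Chain (≡-sym (trans (Listₚ.unfold-reverse q (q' ∷ Q))
                        (trans (cong (_++ [ q ]) (Listₚ.unfold-reverse q' Q))
                          (Listₚ.++-assoc (reverse Q) [ q' ] [ q ]))))
    (chain-snoc (reverse Q) (subst Chain (Listₚ.unfold-reverse q' Q) (chain-reverse c)) p' p
      (λ y o → f y (occ-perm (↭-reverse Q) o)))

occ-split : ∀ {x} (D : List LGraph) → Occurs x D → ∃ λ pre → ∃ λ K → ∃ λ post → D ≡ pre ++ K ∷ post × x ∈V K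
occ-split (K ∷ D) (here x∈) = [] , K , D , refl , x∈
occ-split (L ∷ D) (there o) with occ-split D o
... | pre , K , post , refl , x∈ = L ∷ pre , K , post , refl , x∈

attached-more : ∀ {L K R S} → (∀ {x} → x ∈V K → x ∈V L → ⊥) → R ↭ K ∷ S → Attached L S → Attached L R
attached-more d p (attached m∈ o only) = attached m∈ (occ-there p o) λ x∈ ox →
  case occ-perm p ox of λ { (here xK) → ⊥-elim (d xK x∈) ; (there o') → only x∈ o' }

three-leaves-swap : ∀ {D} (t : ThreeLeaves D) → ∃ λ (t' : ThreeLeaves D) → ThreeLeaves.L₁ t' ≡ ThreeLeaves.L₂ t
three-leaves-swap (threeLeaves {L₁} {L₂} p a₁ a₂ a₃) =
  threeLeaves (↭-trans p (swap L₁ L₂ ↭-refl)) a₂ a₁ (attached-perm (swap L₁ L₂ ↭-refl) a₃) , refl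

three-leaves-rotate : ∀ {D} (t : ThreeLeaves D) → ∃ λ (t' : ThreeLeaves D) → ThreeLeaves.L₁ t' ≡ ThreeLeaves.L₃ t
three-leaves-rotate (threeLeaves {L₁} {L₂} {L₃} p a₁ a₂ a₃) =
  threeLeaves (↭-trans p (↭-trans (prep L₁ (swap L₂ L₃ ↭-refl)) (swap L₁ L₃ ↭-refl))) a₃
    (attached-perm (swap L₂ L₃ ↭-refl) a₁) (attached-perm (swap L₁ L₃ ↭-refl) a₂) , refl

first-attached : ∀ {H q Q} → Rep H (q ∷ Q) → 1 ≤ length Q → Chain (q ∷ Q) → Attached q Q
first-attached r () one
first-attached r _ (link p p' f c) = attached p (here p') λ y → λ
  { (here y') → share-one r ↭-refl y y' p p' ; (there o) → ⊥-elim (f y o) }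

module _ {H D L R} (r : Rep H D) (p : D ↭ L ∷ R) (l : Attached L R) where
  private
    module D = Detached (detach r p l)
    m = Attached.at l
    m∈H' : m ∈V D.rest
    m∈H' = IsJoin.mB D.isJoin
    only-m : ∀ K → ¬ m ∈V K → (∀ {x} → x ∈V K → Occurs x R) → ∀ {x} → x ∈V L → x ∈V K → ⊥
    only-m K nm o xL xK with Attached.only l xL (o xK)
    ... | refl = nm xK

  regrow-at-leaf : (t : ThreeLeaves R) → m ∈V ThreeLeaves.L₁ t → ThreeLeaves D
  regrow-at-leaf (threeLeaves {L₁} {L₂} {L₃} {S} q a₁ a₂ a₃) m∈ = threeLeaves {R = L₁ ∷ S}
    (↭-trans p (prep L (↭-trans q rot)))
    (attached-perm (↭-trans q rot) l)
    (attached-more (only-m L₂ (u ∘ here) (occ-perm (↭-sym q) ∘ there ∘ here)) ↭-refl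
      (attached-perm (swap L₁ L₃ ↭-refl) a₂))
    (attached-more (only-m L₃ (u ∘ there ∘ here) (occ-perm (↭-sym q) ∘ there ∘ there ∘ here)) ↭-refl
      (attached-perm (swap L₁ L₂ ↭-refl) a₃))
    where
    rot : L₁ ∷ L₂ ∷ L₃ ∷ S ↭ L₂ ∷ L₃ ∷ L₁ ∷ S
    rot = ↭-trans (swap L₁ L₂ ↭-refl) (prep L₂ (swap L₁ L₃ ↭-refl))
    u : ¬ Occurs m (L₂ ∷ L₃ ∷ S)
    u = rep-unique D.rep q m∈H' m∈

  -- The marker m of the added leaf `L` lies in one node of `R`. If that node is one of the three
  -- leaves, `L` takes its place as a leaf; otherwise all three remain leaves.
  regrow : ThreeLeaves R → ThreeLeaves D
  regrow t@(threeLeaves {L₁} {L₂} {L₃} {S} q a₁ a₂ a₃) with m ∈? V L₁ | m ∈? V L₂ | m ∈? V L₃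
  ... | yes m∈ | _ | _ = regrow-at-leaf t m∈
  ... | no _ | yes m∈ | _ = let (t' , e) = three-leaves-swap t in regrow-at-leaf t' (subst (m ∈V_) (≡-sym e) m∈)
  ... | no _ | no _ | yes m∈ = let (t' , e) = three-leaves-rotate t in regrow-at-leaf t' (subst (m ∈V_) (≡-sym e) m∈)
  ... | no n₁ | no n₂ | no n₃ = threeLeaves {R = L ∷ S}
    (↭-trans p (↭-trans (prep L q) (↭-trans (swap L L₁ ↭-refl) (prep L₁ (mv L₂ L₃)))))
    (attached-more (only-m L₁ n₁ (occ-perm (↭-sym q) ∘ here)) (↭-sym (mv L₂ L₃)) a₁)
    (attached-more (only-m L₂ n₂ (occ-perm (↭-sym q) ∘ there ∘ here)) (↭-sym (mv L₁ L₃)) a₂)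
    (attached-more (only-m L₃ n₃ (occ-perm (↭-sym q) ∘ there ∘ there ∘ here)) (↭-sym (mv L₁ L₂)) a₃)
    where
    mv : ∀ A B → L ∷ A ∷ B ∷ S ↭ A ∷ B ∷ L ∷ S
    mv A B = ↭-trans (swap L A ↭-refl) (prep A (swap L B ↭-refl))

  extend-front : ∀ {K post} → R ↭ K ∷ post → m ∈V K → Chain (K ∷ post) → Chain (L ∷ K ∷ post)
  extend-front {K} {post} q m∈ c = link (Attached.at∈ l) m∈ disj c
    where
    disj : ∀ {y} → y ∈V L → ¬ Occurs y post
    disj y o with Attached.only l y (occ-there q o)
    ... | refl = rep-unique D.rep q m∈H' m∈ o

  extend-middle : ∀ {q₁ pre K Z q₂} → R ↭ q₁ ∷ pre ++ K ∷ Z ++ [ q₂ ] → m ∈V K →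
                  Chain (q₁ ∷ pre ++ K ∷ Z ++ [ q₂ ]) → ThreeLeaves D
  extend-middle {q₁} {pre} {K} {Z} {q₂} q m∈ c = threeLeaves {R = M}
    (↭-trans p (prep L toM)) (attached-perm toM l)
    (attached-more (only-m q₁ m∉q₁ (occ-perm (↭-sym q) ∘ here)) ↭-refl (attached-perm endM front))
    (attached-more (only-m q₂ m∉q₂ (occ-perm (↭-sym toM) ∘ there ∘ here)) ↭-refl
      (attached-perm (↭-reverse (q₁ ∷ M)) back))
    where
    M = pre ++ K ∷ Z
    eqM : pre ++ K ∷ Z ++ [ q₂ ] ≡ M ++ [ q₂ ]
    eqM = ≡-sym (Listₚ.++-assoc pre (K ∷ Z) [ q₂ ])
    endM : pre ++ K ∷ Z ++ [ q₂ ] ↭ q₂ ∷ M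
    endM = subst (_↭ q₂ ∷ M) (≡-sym eqM) (Permₚ.++-comm M [ q₂ ])
    toM : R ↭ q₁ ∷ q₂ ∷ M
    toM = ↭-trans q (prep q₁ endM)
    toK : R ↭ K ∷ q₁ ∷ q₂ ∷ pre ++ Z
    toK = ↭-trans toM (↭-trans (prep q₁ (prep q₂ (shift K pre Z)))
            (↭-trans (prep q₁ (swap q₂ K ↭-refl)) (swap q₁ K ↭-refl)))
    u : ¬ Occurs m (q₁ ∷ q₂ ∷ pre ++ Z)
    u = rep-unique D.rep toK m∈H' m∈
    m∉q₁ : ¬ m ∈V q₁
    m∉q₁ z = u (here z)
    m∉q₂ : ¬ m ∈V q₂
    m∉q₂ z = u (there (here z))
    nonempty : ∀ pre {X : List LGraph} → 1 ≤ length (pre ++ K ∷ X)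
    nonempty [] = s≤s z≤n
    nonempty (_ ∷ _) = s≤s z≤n
    front : Attached q₁ (pre ++ K ∷ Z ++ [ q₂ ])
    front = first-attached (rep-perm q D.rep) (nonempty pre) c
    revEq : reverse (q₁ ∷ pre ++ K ∷ Z ++ [ q₂ ]) ≡ q₂ ∷ reverse (q₁ ∷ M)
    revEq = trans (cong (λ T → reverse (q₁ ∷ T)) eqM) (Listₚ.reverse-++ (q₁ ∷ M) [ q₂ ])
    back : Attached q₂ (reverse (q₁ ∷ M))
    back = first-attached
             (rep-perm (↭-trans toM (↭-trans (swap q₁ q₂ ↭-refl) (prep q₂ (↭-sym (↭-reverse (q₁ ∷ M)))))) D.rep)
             (subst (1 ≤_) (≡-sym (Listₚ.length-reverse (q₁ ∷ M))) (s≤s z≤n))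
             (subst Chain revEq (chain-reverse c))

IsChain : List LGraph → Set
IsChain D = ∃ λ Q → Q ↭ D × Chain Q

-- A leaf at either end prolongs the path, after a reversal if that end is the last one. A leaf at
-- an inner node is a third leaf besides the two ends.
extend-chain : ∀ {H D L R} → Rep H D → D ↭ L ∷ R → Attached L R → IsChain R → IsChain D ⊎ ThreeLeaves D
extend-chain {L = L} {R} r p l (Q , q , c) with occ-split Q (occ-perm (↭-sym q) (Attached.occ l))
... | [] , K , post , refl , m∈ =
  inj₁ (L ∷ K ∷ post , ↭-trans (prep L q) (↭-sym p) , extend-front r p l (↭-sym q) m∈ c)
... | q₁ ∷ pre , K , post , refl , m∈ with initLast post
... | [] = inj₁ (L ∷ K ∷ reverse (q₁ ∷ pre) , ↭-trans (prep L qr) (↭-sym p) ,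
                 extend-front r p l (↭-sym qr) m∈ (subst Chain revEq (chain-reverse c)))
  where
  revEq : reverse ((q₁ ∷ pre) ++ [ K ]) ≡ K ∷ reverse (q₁ ∷ pre)
  revEq = Listₚ.reverse-++ (q₁ ∷ pre) [ K ]
  qr : K ∷ reverse (q₁ ∷ pre) ↭ R
  qr = ↭-trans (subst (_↭ (q₁ ∷ pre) ++ [ K ]) revEq (↭-reverse ((q₁ ∷ pre) ++ [ K ]))) q
... | Z ∷ʳ′ q₂ = inj₂ (extend-middle r p l {pre = pre} {Z = Z} (↭-sym q) m∈ c)

chain-or-three-leaves : ∀ b {H D} → Rep H D → length D ≤ b → IsChain D ⊎ ThreeLeaves D
chain-or-three-leaves b {D = []} r _ = ⊥-elim (case rep-nonempty r of λ ())
chain-or-three-leaves b {D = K ∷ []} r _ = inj₁ ([ K ] , ↭-refl , one)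
chain-or-three-leaves (suc b) {D = D@(_ ∷ _ ∷ _)} r le
  with leaf-avoiding r (s≤s (s≤s z≤n)) (proj₂ (rep-has-vertex r (s≤s (s≤s z≤n))))
... | L , R , p , l , _
  with chain-or-three-leaves b (Detached.rep (detach r p l)) (ℕₚ.≤-pred (subst (_≤ suc b) (↭-length p) le))
... | inj₂ t = inj₂ (regrow r p l t)
... | inj₁ c = extend-chain r p l c

PathIndexed : List LGraph → Set
PathIndexed Q = ∀ i j → (TreeAdj Q i j → Consecutive i j) × (Consecutive i j → TreeAdj Q i j)

lookup-occ : ∀ {x} (Q : List LGraph) i → x ∈V lookup Q i → Occurs x Q
lookup-occ (q ∷ Q) Fin.zero x∈ = here x∈
lookup-occ (q ∷ Q) (Fin.suc i) x∈ = there (lookup-occ Q i x∈)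

chain-indexed : ∀ {Q} → Chain Q → PathIndexed Q
chain-indexed {_ ∷ _} c Fin.zero Fin.zero = (λ (n , _) → ⊥-elim (n refl)) , λ { (inj₁ ()) ; (inj₂ ()) }
chain-indexed (link p p' f c) Fin.zero (Fin.suc Fin.zero) =
  (λ _ → inj₁ refl) , λ _ → (λ ()) , _ , p , p'
chain-indexed (link {Q = Q} p p' f c) Fin.zero (Fin.suc (Fin.suc j)) =
  (λ (_ , x , x∈ , x∈') → ⊥-elim (f x∈ (lookup-occ Q j x∈'))) , λ { (inj₁ ()) ; (inj₂ ()) }
chain-indexed (link p p' f c) (Fin.suc Fin.zero) Fin.zero =
  (λ _ → inj₂ refl) , λ _ → (λ ()) , _ , p' , p
chain-indexed (link {Q = Q} p p' f c) (Fin.suc (Fin.suc i)) Fin.zero =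
  (λ (_ , x , x∈ , x∈') → ⊥-elim (f x∈' (lookup-occ Q i x∈))) , λ { (inj₁ ()) ; (inj₂ ()) }
chain-indexed (link p p' f c) (Fin.suc i) (Fin.suc j) =
  let (to , from) = chain-indexed c i j in
  (λ (n , s) → Sum.map (cong suc) (cong suc) (to (n ∘ cong Fin.suc , s))) ,
  λ k → let (n , s) = from (Sum.map ℕₚ.suc-injective ℕₚ.suc-injective k) in (n ∘ Finₚ.suc-injective) , s

indexed-chain : ∀ q Q → PathIndexed (q ∷ Q) → Chain (q ∷ Q)
indexed-chain q [] h = one
indexed-chain q (q' ∷ Q) h with proj₂ (h Fin.zero (Fin.suc Fin.zero)) (inj₁ refl)
... | _ , x , x∈ , x∈' = link x∈ x∈' disj (indexed-chain q' Q λ i j →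
  let (to , from) = h (Fin.suc i) (Fin.suc j) in
  (λ (n , s) → Sum.map ℕₚ.suc-injective ℕₚ.suc-injective (to (n ∘ Finₚ.suc-injective , s))) ,
  λ k → let (n , s) = from (Sum.map (cong suc) (cong suc) k) in (n ∘ cong Fin.suc) , s)
  where
  disj : ∀ {y} → y ∈V q → ¬ Occurs y Q
  disj y∈ o with Any.index o | Anyₚ.lookup-index o
  ... | i | y∈' with proj₁ (h Fin.zero (Fin.suc (Fin.suc i))) ((λ ()) , _ , y∈ , y∈')
  ... | inj₁ ()
  ... | inj₂ ()

ATFree⇒path : ∀ G → Connected G → DistanceHereditary G → ATFree G → PrunedTreeIsPath G
ATFree⇒path G conn dh at D P st@(dec , _) (ss , stuck)
  with prunes-pruning (decomposition-rep G conn dec) (noATL-base G at) (standard-simples G conn dh st)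
         (standard-reduced G conn st) ss
... | pr with chain-or-three-leaves _ (Pruning.rep pr) ℕₚ.≤-refl
... | inj₁ (Q , q , c) = Q , ↭⇒≈D (↭-sym q) , chain-indexed c
... | inj₂ t = ⊥-elim (three-leaves-AT pr.rep pr.simples pr.reduced stuck pr.noATL t)
  where module pr = Pruning pr

-- Permutation diagrams

-- A model of the subgraph on `W`, so that segments can be added one at a time. By `sound` distinct
-- vertices of `W` have distinct positions on each line; `SegmentsIntersect` allows ties.
record Diagram (H : LGraph) (W : List ℕ) : Set where
  field
    top bot : ℕ → ℕ

  Cross : ℕ → ℕ → Set
  Cross x y = (top x < top y × bot y < bot x) ⊎ (top y < top x × bot x < bot y)
  Order : ℕ → ℕ → Set
  Order x y = (top x < top y × bot x < bot y) ⊎ (top y < top x × bot y < bot x)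

  field
    sound : ∀ {x y} → x ∈ W → y ∈ W → x ≢ y →
            (ladj H x y ≡ true → Cross x y) × (ladj H x y ≡ false → Order x y)

  TopMax : ℕ → Set
  TopMax t = ∀ {w} → w ∈ W → w ≢ t → top w < top t

open Diagram using (TopMax)

flip : ∀ {H W} → Diagram H W → Diagram H W
flip D = record { top = D.bot ; bot = D.top ; sound = λ x y n → let (c , o) = D.sound x y n in
                    Sum.swap ∘ Sum.map swap-× swap-× ∘ c ,
                    Sum.map swap-× swap-× ∘ o }
  where module D = Diagram D

diagram-⊆ : ∀ {H W W'} → (∀ {x} → x ∈ W' → x ∈ W) → Diagram H W → Diagram H W'
diagram-⊆ f D = record { top = D.top ; bot = D.bot ; sound = λ x y → D.sound (f x) (f y) }
  where module D = Diagram D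

-- Doubling the positions makes room for a new endpoint directly beside an old one.
dbl : ℕ → ℕ
dbl x = x + x

dbl-gap : ∀ {a b} → a < b → suc (dbl a) < dbl b
dbl-gap {a} {b} lt = ℕₚ.≤-trans (s≤s (ℕₚ.≤-reflexive (≡-sym (ℕₚ.+-suc a a)))) (ℕₚ.+-mono-≤ lt lt)

override-at : ∀ {A : Set} y (a : A) f → override y a f y ≡ a
override-at y a f with y ≟ y
... | yes _ = refl
... | no n = ⊥-elim (n refl)

override-≢ : ∀ {A : Set} {y} (a : A) f {z} → z ≢ y → override y a f z ≡ f z
override-≢ {y = y} a f {z} n with z ≟ y
... | yes e = ⊥-elim (n e)
... | no _ = refl

record Placed (f : ℕ → ℕ) (W : List ℕ) (t v : ℕ) : Set where
  field
    g    : ℕ → ℕ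
    mono : ∀ {x y} → x ∈ W → y ∈ W → f x < f y → g x < g y
    lo   : ∀ {x} → x ∈ W → f x < f t → g x < g v
    hi   : ∀ {x} → x ∈ W → f t < f x → g v < g x

module _ (f : ℕ → ℕ) {W : List ℕ} {t v : ℕ} (v∉ : ¬ v ∈ W) where
  private
    ≢v : ∀ {x} → x ∈ W → x ≢ v
    ≢v x∈ refl = v∉ x∈

  just-after : t ∈ W → Σ (Placed f W t v) λ p → Placed.g p t < Placed.g p v
  just-after t∈ = record { g = g ; mono = mono ; lo = lo ; hi = hi } , tv
    where
    h : ℕ → ℕ
    h x = dbl (f x)
    g = override v (suc (dbl (f t))) h
    gv = override-at v (suc (dbl (f t))) h
    g≢ : ∀ {x} → x ∈ W → g x ≡ h x
    g≢ x∈ = override-≢ (suc (dbl (f t))) h (≢v x∈)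
    mono : ∀ {x y} → x ∈ W → y ∈ W → f x < f y → g x < g y
    mono x∈ y∈ lt rewrite g≢ x∈ | g≢ y∈ = ℕₚ.<-trans (ℕₚ.n<1+n _) (dbl-gap lt)
    lo : ∀ {x} → x ∈ W → f x < f t → g x < g v
    lo x∈ lt rewrite g≢ x∈ | gv = ℕₚ.<-trans (ℕₚ.<-trans (ℕₚ.n<1+n _) (dbl-gap lt)) (ℕₚ.n<1+n _)
    hi : ∀ {x} → x ∈ W → f t < f x → g v < g x
    hi x∈ lt rewrite g≢ x∈ | gv = dbl-gap lt
    tv : g t < g v
    tv rewrite g≢ t∈ | gv = ℕₚ.≤-refl

  just-before : t ∈ W → Σ (Placed f W t v) λ p → Placed.g p v < Placed.g p t
  just-before t∈ = record { g = g ; mono = mono ; lo = lo ; hi = hi } , vt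
    where
    h : ℕ → ℕ
    -- The old endpoints take odd positions, so that the even place just before t exists even when t
    -- is at 0.
    h x = suc (dbl (f x))
    g = override v (dbl (f t)) h
    gv = override-at v (dbl (f t)) h
    g≢ : ∀ {x} → x ∈ W → g x ≡ h x
    g≢ x∈ = override-≢ (dbl (f t)) h (≢v x∈)
    mono : ∀ {x y} → x ∈ W → y ∈ W → f x < f y → g x < g y
    mono x∈ y∈ lt rewrite g≢ x∈ | g≢ y∈ = ℕₚ.<-trans (dbl-gap lt) (ℕₚ.n<1+n _)
    lo : ∀ {x} → x ∈ W → f x < f t → g x < g v
    lo x∈ lt rewrite g≢ x∈ | gv = dbl-gap lt
    hi : ∀ {x} → x ∈ W → f t < f x → g v < g x
    hi x∈ lt rewrite g≢ x∈ | gv = ℕₚ.<-trans (ℕₚ.<-trans (ℕₚ.n<1+n _) (dbl-gap lt)) (ℕₚ.n<1+n _)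
    vt : g v < g t
    vt rewrite g≢ t∈ | gv = ℕₚ.≤-refl

  at-end : Σ (ℕ → ℕ) λ g → (∀ {x y} → x ∈ W → y ∈ W → f x < f y → g x < g y) × (∀ {x} → x ∈ W → g x < g v)
  at-end = g , mono , last
    where
    b = label-bound (map f W)
    g = override v (proj₁ b) f
    gv = override-at v (proj₁ b) f
    g≢ : ∀ {x} → x ∈ W → g x ≡ f x
    g≢ x∈ = override-≢ (proj₁ b) f (≢v x∈)
    mono : ∀ {x y} → x ∈ W → y ∈ W → f x < f y → g x < g y
    mono x∈ y∈ lt rewrite g≢ x∈ | g≢ y∈ = lt
    last : ∀ {x} → x ∈ W → g x < g v
    last x∈ rewrite g≢ x∈ | gv = proj₂ b (∈-map⁺ f x∈)

module _ {H : LGraph} (symH : ∀ {x y} → x ∈V H → y ∈V H → ladj H x y ≡ ladj H y x)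
         {W : List ℕ} (W⊆ : ∀ {x} → x ∈ W → x ∈V H) {v : ℕ} (v∈ : v ∈V H) where

  extend-sound : (D : Diagram H W) (g h : ℕ → ℕ) →
    (∀ {x y} → x ∈ W → y ∈ W → Diagram.top D x < Diagram.top D y → g x < g y) →
    (∀ {x y} → x ∈ W → y ∈ W → Diagram.bot D x < Diagram.bot D y → h x < h y) →
    (∀ {w} → w ∈ W → w ≢ v →
       (ladj H v w ≡ true → (g v < g w × h w < h v) ⊎ (g w < g v × h v < h w)) ×
       (ladj H v w ≡ false → (g v < g w × h v < h w) ⊎ (g w < g v × h w < h v))) →
    Σ (Diagram H (v ∷ W)) λ D' → Diagram.top D' ≡ g × Diagram.bot D' ≡ h
  extend-sound D g h mg mh new = record { top = g ; bot = h ; sound = snd } , refl , refl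
    where
    module D = Diagram D
    snd : ∀ {x y} → x ∈ v ∷ W → y ∈ v ∷ W → x ≢ y →
          (ladj H x y ≡ true → (g x < g y × h y < h x) ⊎ (g y < g x × h x < h y)) ×
          (ladj H x y ≡ false → (g x < g y × h x < h y) ⊎ (g y < g x × h y < h x))
    snd (here refl) (here refl) n = ⊥-elim (n refl)
    snd (here refl) (there y∈) n = new y∈ (n ∘ ≡-sym)
    snd (there x∈) (here refl) n =
      let (c , o) = new x∈ n
          s = symH v∈ (W⊆ x∈) in
      Sum.swap ∘ c ∘ trans s , Sum.swap ∘ o ∘ trans s
    snd (there x∈) (there y∈) n =
      let (c , o) = D.sound x∈ y∈ n in
      Sum.map (λ (a , b) → mg x∈ y∈ a , mh y∈ x∈ b) (λ (a , b) → mg y∈ x∈ a , mh x∈ y∈ b) ∘ c ,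
      Sum.map (λ (a , b) → mg x∈ y∈ a , mh x∈ y∈ b) (λ (a , b) → mg y∈ x∈ a , mh y∈ x∈ b) ∘ o

  -- The new segment runs beside that of t. On the top line it always comes before t, so that t
  -- stays last there; on the bottom line it comes after t if the twins are adjacent and before t if
  -- not.
  twin : (D : Diagram H W) → ¬ v ∈ W → ∀ {t} → t ∈ W →
         (∀ {w} → w ∈ W → w ≢ t → ladj H v w ≡ ladj H t w) →
         Σ (Diagram H (v ∷ W)) λ D' → TopMax D t → TopMax D' t
  twin D v∉ {t} t∈ tw with ladj H v t in vt
  ... | true with just-before (Diagram.top D) {W} {t} {v} v∉ t∈ | just-after (Diagram.bot D) {W} {t} {v} v∉ t∈
  ... | T , vt< | B , tv< with extend-sound D (Placed.g T) (Placed.g B) (Placed.mono T) (Placed.mono B) new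
    where
    module D = Diagram D
    module T = Placed T
    module B = Placed B
    new : ∀ {w} → w ∈ W → w ≢ v → (ladj H v w ≡ true → _) × (ladj H v w ≡ false → _)
    new {w} w∈ n with w ≟ t
    ... | yes refl = (λ _ → inj₁ (vt< , tv<)) , λ e → ⊥-elim (true≢false vt e)
    ... | no n' = let (c , o) = D.sound t∈ w∈ (n' ∘ ≡-sym)
                      s = ≡-sym (tw w∈ n') in
      Sum.map (λ (a , b) → T.hi w∈ a , B.lo w∈ b) (λ (a , b) → T.lo w∈ a , B.hi w∈ b) ∘ c ∘ trans s ,
      Sum.map (λ (a , b) → T.hi w∈ a , B.hi w∈ b) (λ (a , b) → T.lo w∈ a , B.lo w∈ b) ∘ o ∘ trans s
  ... | D' , refl , refl = D' , λ mx → λ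
    { (here refl) _ → vt< ; (there w∈) n → Placed.mono T w∈ t∈ (mx w∈ n) }
  twin D v∉ {t} t∈ tw | false
    with just-before (Diagram.top D) {W} {t} {v} v∉ t∈ | just-before (Diagram.bot D) {W} {t} {v} v∉ t∈
  ... | T , vt< | B , vt<' with extend-sound D (Placed.g T) (Placed.g B) (Placed.mono T) (Placed.mono B) new
    where
    module D = Diagram D
    module T = Placed T
    module B = Placed B
    new : ∀ {w} → w ∈ W → w ≢ v → (ladj H v w ≡ true → _) × (ladj H v w ≡ false → _)
    new {w} w∈ n with w ≟ t
    ... | yes refl = (λ e → ⊥-elim (true≢false e vt)) , λ e → inj₁ (vt< , vt<')
    ... | no n' = let (c , o) = D.sound t∈ w∈ (n' ∘ ≡-sym)
                      s = ≡-sym (tw w∈ n') in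
      Sum.map (λ (a , b) → T.hi w∈ a , B.lo w∈ b) (λ (a , b) → T.lo w∈ a , B.hi w∈ b) ∘ c ∘ trans s ,
      Sum.map (λ (a , b) → T.hi w∈ a , B.hi w∈ b) (λ (a , b) → T.lo w∈ a , B.lo w∈ b) ∘ o ∘ trans s
  ... | D' , refl , refl = D' , λ mx → λ
    { (here refl) _ → vt< ; (there w∈) n → Placed.mono T w∈ t∈ (mx w∈ n) }

  -- If t ends last on one line, a new segment can be made to end just before t on that line
  -- and last on the other line, so that it crosses t only.
  pendant : (D : Diagram H W) → ¬ v ∈ W → ∀ {t} → t ∈ W → TopMax D t → ladj H v t ≡ true →
            (∀ {w} → w ∈ W → w ≢ t → ladj H v w ≡ false) →
            Σ (Diagram H (v ∷ W)) λ D' → TopMax D' t × TopMax (flip D') v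
  pendant D v∉ {t} t∈ mx vt none
    with just-before (Diagram.top D) {W} {t} {v} v∉ t∈ | at-end (Diagram.bot D) {W} {t} {v} v∉
  ... | T , vt< | B , monoB , lastB with extend-sound D (Placed.g T) B (Placed.mono T) monoB new
    where
    new : ∀ {w} → w ∈ W → w ≢ v → (ladj H v w ≡ true → _) × (ladj H v w ≡ false → _)
    new {w} w∈ n with w ≟ t
    ... | yes refl = (λ _ → inj₁ (vt< , lastB w∈)) , λ e → ⊥-elim (true≢false vt e)
    ... | no n' = (λ e → ⊥-elim (true≢false e (none w∈ n'))) , λ _ → inj₂ (Placed.lo T w∈ (mx w∈ n') , lastB w∈)
  ... | D' , refl , refl = D' ,
    (λ { (here refl) _ → vt< ; (there w∈) n → Placed.mono T w∈ t∈ (mx w∈ n) }) ,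
    λ { (here refl) n → ⊥-elim (n refl) ; (there w∈) _ → lastB w∈ }

-- A partial diagram with an active vertex t. Ending last on the top line is what lets `pendant` add
-- neighbours of t alone.
record Act (H : LGraph) (t : ℕ) (W : List ℕ) : Set where
  constructor act
  field
    sub  : ∀ {x} → x ∈ W → x ∈V H
    t∈   : t ∈ W
    dia  : Diagram H W
    tmax : TopMax dia t

record Dia (H : LGraph) (t : ℕ) (W : List ℕ) : Set where
  constructor dia
  field
    sub  : ∀ {x} → x ∈ W → x ∈V H
    t∈   : t ∈ W
    get  : Diagram H W

TwinOf : LGraph → ℕ → ℕ → Set
TwinOf H t v = v ∈V H × (∀ {w} → w ∈V H → w ≢ t → w ≢ v → ladj H v w ≡ ladj H t w)

PendantAt : LGraph → ℕ → ℕ → Set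
PendantAt H t v = v ∈V H × ladj H v t ≡ true × (∀ {w} → w ∈V H → w ≢ t → w ≢ v → ladj H v w ≡ false)

apart : ∀ {v w} {W : List ℕ} → ¬ v ∈ W → w ∈ W → w ≢ v
apart v∉ w∈ refl = v∉ w∈

cons-sub : ∀ {v W} {H : LGraph} → v ∈V H → (∀ {x} → x ∈ W → x ∈V H) → ∀ {x} → x ∈ v ∷ W → x ∈V H
cons-sub v∈ f (here refl) = v∈
cons-sub v∈ f (there x∈) = f x∈

module _ {H : LGraph} (g : Good H) {t v : ℕ} {W : List ℕ} where
  act-twin : Act H t W → TwinOf H t v → ¬ v ∈ W → Act H t (v ∷ W)
  act-twin (act sub t∈ D mx) (v∈ , tw) v∉ =
    let (D' , mx') = twin (gsym g) sub v∈ D v∉ t∈ (λ w∈ n → tw (sub w∈) n (apart v∉ w∈)) in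
    act (cons-sub {H = H} v∈ sub) (there t∈) D' (mx' mx)

  dia-twin : Dia H t W → TwinOf H t v → ¬ v ∈ W → Dia H t (v ∷ W)
  dia-twin (dia sub t∈ D) (v∈ , tw) v∉ =
    dia (cons-sub {H = H} v∈ sub) (there t∈)
      (proj₁ (twin (gsym g) sub v∈ D v∉ t∈ (λ w∈ n → tw (sub w∈) n (apart v∉ w∈))))

  act-pendant : Act H t W → PendantAt H t v → ¬ v ∈ W → Act H t (v ∷ W)
  act-pendant (act sub t∈ D mx) (v∈ , e , none) v∉ =
    let (D' , mx' , _) = pendant (gsym g) sub v∈ D v∉ t∈ mx e (λ w∈ n → none (sub w∈) n (apart v∉ w∈)) in
    act (cons-sub {H = H} v∈ sub) (there t∈) D' mx'

  -- The added pendant vertex ends last on the bottom line, so exchanging the two lines makes it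
  -- active.
  act-move : Act H t W → v ∈V H → ladj H v t ≡ true → (∀ {w} → w ∈ W → w ≢ t → ladj H v w ≡ false) →
             ¬ v ∈ W → Act H v (v ∷ W)
  act-move (act sub t∈ D mx) v∈ e none v∉ =
    let (D' , _ , mx') = pendant (gsym g) sub v∈ D v∉ t∈ mx e none in
    act (cons-sub {H = H} v∈ sub) (here refl) (flip D') mx'

add-all : (X : List ℕ → Set) (ok : ℕ → Set) → (∀ {W v} → X W → ok v → ¬ v ∈ W → X (v ∷ W)) →
          ∀ vs {W} → X W → (∀ {v} → v ∈ vs → ¬ v ∈ W → ok v) →
          ∃ λ W' → X W' × (∀ {v} → v ∈ vs → v ∈ W')
add-all X ok st [] x f = _ , x , λ ()
add-all X ok st vs x f = let (W' , x' , c , _) = go vs x f in W' , x' , c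
  where
  go : ∀ vs {W} → X W → (∀ {v} → v ∈ vs → ¬ v ∈ W → ok v) →
       ∃ λ W' → X W' × (∀ {v} → v ∈ vs → v ∈ W') × (∀ {v} → v ∈ W → v ∈ W')
  go [] x f = _ , x , (λ ()) , id
  go (v ∷ vs) {W} x f with v ∈? W
  ... | yes v∈ = let (W' , x' , c , i) = go vs x (f ∘ there) in
                 W' , x' , (λ { (here refl) → i v∈ ; (there z) → c z }) , i
  ... | no v∉ = let (W' , x' , c , i) = go vs (st x (f (here refl) v∉) v∉) (λ z n → f (there z) (n ∘ there)) in
                W' , x' , (λ { (here refl) → i (here refl) ; (there z) → c z }) , i ∘ there

act-full : ∀ {H t W} → t ∈V H → Act H t W → (∀ {v} → v ∈V H → v ∈ W) → Act H t (V H)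
act-full t∈ (act _ _ D mx) c = act id t∈ (diagram-⊆ c D) (mx ∘ c)

fill-twins : ∀ {H t W} → Good H → Act H t W → (∀ {v} → v ∈V H → ¬ v ∈ W → TwinOf H t v) → Act H t (V H)
fill-twins {H} {t} g a f = let (_ , x , c) = add-all (Act H t) (TwinOf H t) (act-twin g) (V H) a f in
  act-full (Act.sub a (Act.t∈ a)) x c

fill-pendants : ∀ {H t W} → Good H → Act H t W → (∀ {v} → v ∈V H → ¬ v ∈ W → PendantAt H t v) → Act H t (V H)
fill-pendants {H} {t} g a f = let (_ , x , c) = add-all (Act H t) (PendantAt H t) (act-pendant g) (V H) a f in
  act-full (Act.sub a (Act.t∈ a)) x c

fill-diagram : ∀ {H t W} → Good H → Dia H t W → (∀ {v} → v ∈V H → ¬ v ∈ W → TwinOf H t v) → Diagram H (V H)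
fill-diagram {H} {t} g a f = let (_ , x , c) = add-all (Dia H t) (TwinOf H t) (dia-twin g) (V H) a f in
  diagram-⊆ c (Dia.get x)

-- A node q hung onto a diagram drawn on W₀: port tells which vertices of q see the part h of W₀.
record Hung (H : LGraph) (q : ℕ → Set) (W₀ : List ℕ) (port h : ℕ → Bool) : Set where
  field
    q∈    : ∀ {v} → q v → v ∈V H
    q∉    : ∀ {v} → q v → ¬ v ∈ W₀
    sorts : ∀ {v} → v ∈V H → q v ⊎ v ∈ W₀
    see   : ∀ {v w} → q v → w ∈ W₀ → ladj H v w ≡ port v ∧ h w

-- A node seen from its marker. `uniform` covers the clique (b true) and the star centred at the
-- marker (b false); `starry` is a star with the marker as a leaf, whose centre alone sees the
-- marker.
data Shape (H : LGraph) (q : ℕ → Set) (port : ℕ → Bool) : Set where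
  uniform : ∀ b → (∀ {v} → q v → port v ≡ true) → (∀ {v w} → q v → q w → v ≢ w → ladj H v w ≡ b) → Shape H q port
  starry  : ∀ c → q c → port c ≡ true → (∀ {v} → q v → v ≢ c → port v ≡ false) →
            (∀ {v} → q v → v ≢ c → ladj H v c ≡ true) →
            (∀ {v w} → q v → q w → v ≢ c → w ≢ c → v ≢ w → ladj H v w ≡ false) → Shape H q port

uniform-twin : ∀ {H q W₀ port h} → Hung H q W₀ port h → ∀ {b a v} → (∀ {v} → q v → port v ≡ true) →
               (∀ {v w} → q v → q w → v ≢ w → ladj H v w ≡ b) → q a → v ∈V H → ¬ v ∈ a ∷ W₀ → TwinOf H a v
uniform-twin {H} {q} {W₀} {port} {h} hu {b} {a} {v} pt un qa v∈ v∉ = v∈ , tw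
  where
  module hu = Hung hu
  qv : q v
  qv = [ id , (λ z → ⊥-elim (v∉ (there z))) ]′ (hu.sorts v∈)
  tw : ∀ {w} → w ∈V H → w ≢ a → w ≢ v → ladj H v w ≡ ladj H a w
  tw w∈ na nv with hu.sorts w∈
  ... | inj₁ qw = trans (un qv qw (nv ∘ ≡-sym)) (≡-sym (un qa qw (na ∘ ≡-sym)))
  ... | inj₂ w₀ = trans (hu.see qv w₀) (trans (cong (_∧ h _) (trans (pt qv) (≡-sym (pt qa)))) (≡-sym (hu.see qa w₀)))

-- One vertex of the node first takes over the place of the marker. In the uniform case this is a
-- itself, and the others are its twins. In a star it is the centre c: if a is c, the others are
-- pendant at it; if not, a is hung on c and made active, and the remaining vertices are twins of a.
hung-act : ∀ {H q W₀ port h a} → Good H → Hung H q W₀ port h → Shape H q port →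
           (∀ {r} → q r → port r ≡ true → Act H r (r ∷ W₀)) → q a → Act H a (V H)
hung-act g hu (uniform b pt un) start qa = fill-twins g (start qa (pt qa)) (uniform-twin hu pt un qa)
hung-act {H} {q} {W₀} {port} {h} {a} g hu (starry c qc pc pt sc sn) start qa with a ≟ c
... | yes refl = fill-pendants g (start qa pc) λ {v} v∈ v∉ → pend v∈ v∉
  where
  module hu = Hung hu
  pend : ∀ {v} → v ∈V H → ¬ v ∈ a ∷ W₀ → PendantAt H a v
  pend {v} v∈ v∉ = v∈ , sc qv va , none
    where
    qv : q v
    qv = [ id , (λ z → ⊥-elim (v∉ (there z))) ]′ (hu.sorts v∈)
    va : v ≢ a
    va refl = v∉ (here refl)
    none : ∀ {w} → w ∈V H → w ≢ a → w ≢ v → ladj H v w ≡ false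
    none w∈ na nv with hu.sorts w∈
    ... | inj₁ qw = sn qv qw va na (nv ∘ ≡-sym)
    ... | inj₂ w₀ = trans (hu.see qv w₀) (cong (_∧ h _) (pt qv va))
... | no ac = fill-twins g moved λ {v} v∈ v∉ → tw v∈ v∉
  where
  module hu = Hung hu
  moved : Act H a (a ∷ c ∷ W₀)
  moved = act-move g (start qc pc) (hu.q∈ qa) (sc qa ac)
    (λ { (here e) n → ⊥-elim (n e) ; (there w₀) _ → trans (hu.see qa w₀) (cong (_∧ h _) (pt qa ac)) })
    (λ { (here e) → ac e ; (there z) → hu.q∉ qa z })
  tw : ∀ {v} → v ∈V H → ¬ v ∈ a ∷ c ∷ W₀ → TwinOf H a v
  tw {v} v∈ v∉ = v∈ , same
    where
    qv : q v
    qv = [ id , (λ z → ⊥-elim (v∉ (there (there z)))) ]′ (hu.sorts v∈)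
    vc : v ≢ c
    vc refl = v∉ (there (here refl))
    same : ∀ {w} → w ∈V H → w ≢ a → w ≢ v → ladj H v w ≡ ladj H a w
    same {w} w∈ na nv with hu.sorts w∈
    ... | inj₂ w₀ = trans (hu.see qv w₀) (trans 
        (cong (_∧ h _) (trans (pt qv vc) (≡-sym (pt qa ac)))) (≡-sym (hu.see qa w₀)))
    ... | inj₁ qw with w ≟ c
    ... | yes refl = trans (sc qv vc) (≡-sym (sc qa ac))
    ... | no wc = trans (sn qv qw vc wc (nv ∘ ≡-sym)) (≡-sym (sn qa qw ac wc (na ∘ ≡-sym)))

singleton-act : ∀ {H t} → t ∈V H → Act H t [ t ]
singleton-act t∈ = act (λ { (here refl) → t∈ }) (here refl)
  (record { top = id ; bot = id ; sound = λ { (here refl) (here refl) n → ⊥-elim (n refl) } })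
  (λ { (here refl) n → ⊥-elim (n refl) })

-- A single node is hung onto the empty diagram. There `see` is vacuous, so `port` can be chosen to
-- fit the shape.
simple-act : ∀ {H a} → Good H → Simple H → a ∈V H → Act H a (V H)
simple-act {H} {a} g s a∈ = [ clique , star ]′ s
  where
  hung : ∀ port → Hung H (_∈V H) [] port (λ _ → true)
  hung port = record { q∈ = id ; q∉ = λ _ () ; sorts = inj₁ ; see = λ _ () }
  clique : Clique H → Act H a (V H)
  clique cl = hung-act g (hung (λ _ → true)) (uniform true (λ _ → refl) (λ v w n → cl _ _ v w n))
                (λ r _ → singleton-act r) a∈
  star : IsStar H → Act H a (V H)
  star (c , c∈ , f) = hung-act g (hung (λ v → does (v ≟ c)))
    (starry c c∈ (dec-true (c ≟ c) refl) (λ _ n → dec-false (_ ≟ c) n) (λ v n → proj₂ (f _ c v c∈ n) (inj₂ refl))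
      (λ v w nv nw n → ≢true λ e → [ nv , nw ]′ (proj₁ (f _ _ v w n) e)))
    (λ r _ → singleton-act r) a∈

module _ {m H L B} (j : IsJoin m H L B) (gL : Good L) (gB : Good B) where
  open IsJoin j
  W₀ : List ℕ
  W₀ = filter (λ x → ¬? (x ≟ m)) (V B)

  OnNode : ℕ → Set
  OnNode v = v ∈V L × v ≢ m

  private
    W₀⁺ : ∀ {x} → x ∈V B → x ≢ m → x ∈ W₀
    W₀⁺ = ∈-filter⁺ (λ x → ¬? (x ≟ m))
    W₀⁻ : ∀ {x} → x ∈ W₀ → x ∈V B × x ≢ m
    W₀⁻ = ∈-filter⁻ (λ x → ¬? (x ≟ m)) {xs = V B}

  join-hung : Hung H OnNode W₀ (λ v → ladj L v m) (ladj B m)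
  join-hung = record
    { q∈ = λ (a , n) → inA a n
    ; q∉ = λ (a , n) z → n (sep a (proj₁ (W₀⁻ z)))
    ; sorts = λ v → Sum.map id (λ (b , n) → W₀⁺ b n) (out v)
    ; see = λ (a , n) z → adjAB a n (proj₁ (W₀⁻ z)) (proj₂ (W₀⁻ z)) }

  join-shape : Simple L → Shape H OnNode (λ v → ladj L v m)
  join-shape (inj₁ cl) = uniform true (λ (v , n) → cl _ _ v mA n)
    (λ (v , n) (w , n') vw → trans (adjA v n w n') (cl _ _ v w vw))
  join-shape (inj₂ (c , c∈ , f)) with c ≟ m
  ... | yes refl = uniform false (λ (v , n) → proj₂ (f _ _ v mA n) (inj₂ refl))
    (λ (v , n) (w , n') vw → trans (adjA v n w n') (≢true λ e → [ n , n' ]′ (proj₁ (f _ _ v w vw) e)))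
  ... | no cm = starry c (c∈ , cm) (proj₂ (f _ _ c∈ mA cm) (inj₁ refl))
    (λ (v , n) vc → ≢true λ e → [ vc , cm ∘ ≡-sym ]′ (proj₁ (f _ _ v mA n) e))
    (λ (v , n) vc → trans (adjA v n c∈ cm) (proj₂ (f _ _ v c∈ vc) (inj₂ refl)))
    (λ (v , n) (w , n') vc wc vw → trans (adjA v n w n') (≢true λ e → [ vc , wc ]′ (proj₁ (f _ _ v w vw) e)))

  -- The vertex r of L takes the place of the marker.
  module _ {r : ℕ} (r∈ : r ∈V L) (rm : r ≢ m) (port : ladj L r m ≡ true) where
    private
      ρ : ℕ → ℕ
      ρ = swapAt r m
      ρ≢ : ∀ {x} → x ∈ W₀ → ρ x ≡ x
      ρ≢ x∈ = swapAt-≢ (λ { refl → rm (sep r∈ (proj₁ (W₀⁻ x∈))) })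
      ρ∈ : ∀ {x} → x ∈ r ∷ W₀ → ρ x ∈V B
      ρ∈ (here refl) rewrite swapAt-m r m = mB
      ρ∈ (there x∈) rewrite ρ≢ x∈ = proj₁ (W₀⁻ x∈)
      ρ-inj : ∀ {x y} → x ∈ r ∷ W₀ → y ∈ r ∷ W₀ → x ≢ y → ρ x ≢ ρ y
      ρ-inj (here refl) (here refl) n _ = n refl
      ρ-inj (here refl) (there y∈) n e = proj₂ (W₀⁻ y∈) (trans (≡-sym (ρ≢ y∈)) (trans (≡-sym e) (swapAt-m r m)))
      ρ-inj (there x∈) (here refl) n e = proj₂ (W₀⁻ x∈) (trans (≡-sym (ρ≢ x∈)) (trans e (swapAt-m r m)))
      ρ-inj (there x∈) (there y∈) n e = n (trans (≡-sym (ρ≢ x∈)) (trans e (ρ≢ y∈)))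
      ρ-adj : ∀ {x y} → x ∈ r ∷ W₀ → y ∈ r ∷ W₀ → x ≢ y → ladj H x y ≡ ladj B (ρ x) (ρ y)
      ρ-adj (here refl) (here refl) n = ⊥-elim (n refl)
      ρ-adj (here refl) (there y∈) n rewrite swapAt-m r m | ρ≢ y∈ =
        trans (adjAB r∈ rm (proj₁ (W₀⁻ y∈)) (proj₂ (W₀⁻ y∈))) (cong (_∧ ladj B m _) port)
      ρ-adj (there x∈) (here refl) n rewrite swapAt-m r m | ρ≢ x∈ =
        trans (adjBA (proj₁ (W₀⁻ x∈)) (proj₂ (W₀⁻ x∈)) r∈ rm)
          (trans (cong (ladj B _ m ∧_) (trans (gsym gL mA r∈) port)) (Boolₚ.∧-identityʳ _))
      ρ-adj (there x∈) (there y∈) n rewrite ρ≢ x∈ | ρ≢ y∈ =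
        adjB (proj₁ (W₀⁻ x∈)) (proj₂ (W₀⁻ x∈)) (proj₁ (W₀⁻ y∈)) (proj₂ (W₀⁻ y∈))

    replace : (D : Diagram B (V B)) → Σ (Diagram H (r ∷ W₀)) λ D' → TopMax D m → TopMax D' r
    replace D = record
      { top = D.top ∘ ρ ; bot = D.bot ∘ ρ
      ; sound = λ x y n → let (c , o) = D.sound (ρ∈ x) (ρ∈ y) (ρ-inj x y n)
                              s = ≡-sym (ρ-adj x y n) in c ∘ trans s , o ∘ trans s } ,
      λ mx {w} w∈ n → subst (λ z → D.top (ρ w) < D.top z) (≡-sym (swapAt-m r m))
        (mx (ρ∈ w∈) (λ e → ρ-inj w∈ (here refl) n (trans e (≡-sym (swapAt-m r m)))))
      where module D = Diagram D

    replaced⊆ : ∀ {x} → x ∈ r ∷ W₀ → x ∈V H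
    replaced⊆ (here refl) = inA r∈ rm
    replaced⊆ (there x∈) = let (b , n) = W₀⁻ x∈ in inB b n

  join-act : Good H → Simple L → Act B m (V B) → ∀ {a} → a ∈V L → a ≢ m → Act H a (V H)
  join-act gH s (act _ _ D mx) a∈ am = hung-act gH join-hung (join-shape s)
    (λ (r∈ , rm) port → let (D' , mx') = replace r∈ rm port D in
      act (replaced⊆ r∈ rm port) (here refl) D' (mx' mx))
    (a∈ , am)

  join-diagram : Good H → Simple L → (∀ y → y ∈V L → y ≢ m → ladj L m y ≡ true) → Big L →
                 Diagram B (V B) → Diagram H (V H)
  join-diagram gH s univ bL D =
    fill-diagram gH (dia (replaced⊆ c₁∈ c₁≢m (ports c₁∈ c₁≢m)) (here refl)
      (proj₁ (replace c₁∈ c₁≢m (ports c₁∈ c₁≢m) D)))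
      (twins (join-shape s))
    where
    open TwoBut (big-but bL m)
    ports : ∀ {v} → v ∈V L → v ≢ m → ladj L v m ≡ true
    ports v∈ n = trans (gsym gL v∈ mA) (univ _ v∈ n)
    twins : Shape H OnNode (λ v → ladj L v m) → ∀ {v} → v ∈V H → ¬ v ∈ c₁ ∷ W₀ → TwinOf H c₁ v
    twins (uniform b pt un) = uniform-twin join-hung pt un (c₁∈ , c₁≢m)
    -- In this shape only the centre sees the marker, whereas a universal marker is seen by both
    -- `c₁` and `c₂`.
    twins (starry c (c∈ , _) _ pt _ _) with c₁ ≟ c
    ... | no n = ⊥-elim (true≢false (ports c₁∈ c₁≢m) (pt (c₁∈ , c₁≢m) n))
    ... | yes refl = ⊥-elim (true≢false (ports c₂∈ c₂≢m) (pt (c₂∈ , c₂≢m) (c₁≢c₂ ∘ ≡-sym)))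

-- The active vertex may be any vertex of `H` in the first node; in the recursive call it is the
-- marker shared with the node just detached.
chain-act : ∀ {H q Q a} → Chain (q ∷ Q) → Rep H (q ∷ Q) → All Simple (q ∷ Q) → a ∈V q → a ∈V H → Act H a (V H)
chain-act {H} {q} one r (s ∷ []) a∈ aH =
  simple-act (rep-good r) (simple-≅ {q} {H} (≅-sym {H} {q} (rep-single r ↭-refl)) s) aH
chain-act (link {x = m} p p' f c) r (s ∷ ss) a∈ aH =
  join-act D.isJoin (All.head (rep-allGood r)) (rep-good D.rep) (rep-good r) s
    (chain-act c D.rep ss p' (IsJoin.mB D.isJoin)) a∈ (IsJoin.out≢ D.isJoin aH)
  where
  l : Attached _ _
  l = attached p (here p') λ { y (here y') → share-one r ↭-refl y y' p p' ; y (there o) → ⊥-elim (f y o) }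
  module D = Detached (detach r ↭-refl l)

chain-diagram : ∀ {H q Q} → Chain (q ∷ Q) → Rep H (q ∷ Q) → All Simple (q ∷ Q) → Diagram H (V H)
chain-diagram {H} {q} one r s with V H in eq
... | [] = record { top = id ; bot = id ; sound = λ () }
... | a ∷ _ = subst (Diagram H) eq (Act.dia (chain-act one r s (proj₁ (rep-single r ↭-refl) a a∈) a∈))
  where
  a∈ : a ∈V H
  a∈ = subst (a ∈_) (≡-sym eq) (here refl)
chain-diagram c@(link {x = m} p p' f _) r s with big-but (node-big r ↭-refl) m
... | twoBut a∈ _ am _ _ = Act.dia (chain-act c r s a∈ (IsJoin.inA (Detached.isJoin (detach r ↭-refl l)) a∈ am))
  where
  l : Attached _ _
  l = attached p (here p') λ { y (here y') → share-one r ↭-refl y y' p p' ; y (there o) → ⊥-elim (f y o) }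

prunes-diagram : ∀ {H D P} → Rep H D → All Simple D → Star PruneStep D P →
                 (∀ {H'} → Rep H' P → All Simple P → Diagram H' (V H')) → Diagram H (V H)
prunes-diagram r s ε k = k r s
prunes-diagram {H} r s (st@(L , d , _) ◅ ss) k =
  join-diagram (Detached.isJoin P.detached) P.good (rep-good rep') (rep-good r) (All.head s') P.univ
    (Detached.bigL P.detached) (prunes-diagram rep' (All.tail s') ss k)
  where
  module P = Pruned (prune-rep r st)
  rep' = Detached.rep P.detached
  s' = All-≈D {Simple} (λ {A} {B} → simple-≅ {A} {B}) d s

diagram-permutation : ∀ G → Diagram (base G) (V (base G)) → PermutationGraph G
diagram-permutation G D = D.top ∘ toℕ , D.bot ∘ toℕ , λ u v n →
  let (c , o) = D.sound (base∈ G u) (base∈ G v) (n ∘ Finₚ.toℕ-injective) in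
  (λ e → crossing (c (trans (base-adj G u v) e))) ,
  λ i → ≢false λ e → i (o (trans (base-adj G u v) e))
  where
  module D = Diagram D
  crossing : ∀ {a b c d : ℕ} → (a < b × c < d) ⊎ (b < a × d < c) → ¬ ((a < b × d < c) ⊎ (b < a × c < d))
  crossing (inj₁ (p , q)) (inj₁ (_ , q')) = ℕₚ.<-asym q q'
  crossing (inj₁ (p , q)) (inj₂ (p' , _)) = ℕₚ.<-asym p p'
  crossing (inj₂ (p , q)) (inj₁ (p' , _)) = ℕₚ.<-asym p p'
  crossing (inj₂ (p , q)) (inj₂ (_ , q')) = ℕₚ.<-asym q q'

¬¬-All : ∀ {P : LGraph → Set} {D} → All (λ H → ¬ ¬ P H) D → ¬ ¬ All P D
¬¬-All [] k = k []
¬¬-All (p ∷ ps) k = p λ a → ¬¬-All ps λ as → k (a ∷ as)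

path⇒¬¬permutation : ∀ G → Connected G → DistanceHereditary G → PrunedTreeIsPath G → ¬ ¬ PermutationGraph G
path⇒¬¬permutation G conn dh h k =
  standard-exists G λ (D , st) → pruning-exists _ D ℕₚ.≤-refl λ (P , pr) →
  ¬¬-All (standard-simples G conn dh st) λ s → k (diagram-permutation G
    (prunes-diagram (decomposition-rep G conn (proj₁ st)) s (proj₁ pr) (λ r s' → drawn (h D P st pr) r s')))
  where
  drawn : ∀ {P H'} → IsPathTree P → Rep H' P → All Simple P → Diagram H' (V H')
  drawn {H' = H'} (Q , e , idx) r s = go Q idx (rep-≈D r e) (All-≈D {Simple} (λ {A} {B} → simple-≅ {A} {B}) e s)
    where
    go : ∀ Q → PathIndexed Q → Rep H' Q → All Simple Q → Diagram H' (V H')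
    go [] _ r _ = ⊥-elim (case rep-nonempty r of λ ())
    go (q ∷ Q) idx r s = chain-diagram (indexed-chain q Q idx) r s

-- Permutation models

-- A position is replaced by the number of vertices strictly before it. Ties stay ties, so the order
-- is both preserved and reflected, as `SegmentsIntersect` requires.
module Rank {k : ℕ} (f : Fin k → ℕ) where
  private
    count : ∀ b → List (Fin k) → ℕ
    count b [] = 0
    count b (u ∷ us) = ifDec (f u <? b) (suc (count b us)) (count b us)
    count-bound : ∀ b us → count b us ≤ length us
    count-bound b [] = z≤n
    count-bound b (u ∷ us) with f u <? b
    ... | yes _ = s≤s (count-bound b us)
    ... | no _ = ℕₚ.m≤n⇒m≤1+n (count-bound b us)
    count-mono : ∀ {b c} us → b ≤ c → count b us ≤ count c us
    count-mono [] le = z≤n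
    count-mono {b} {c} (u ∷ us) le with f u <? b | f u <? c
    ... | yes _ | yes _ = s≤s (count-mono us le)
    ... | yes p | no q = ⊥-elim (q (ℕₚ.≤-trans p le))
    ... | no _ | yes _ = ℕₚ.m≤n⇒m≤1+n (count-mono us le)
    ... | no _ | no _ = count-mono us le
    count-strict : ∀ {u c} us → u ∈ us → f u < c → count (f u) us < count c us
    count-strict {u} {c} (u ∷ us) (here refl) lt with f u <? f u | f u <? c
    ... | yes p | _ = ⊥-elim (ℕₚ.<-irrefl refl p)
    ... | no _ | yes _ = s≤s (count-mono us (ℕₚ.<⇒≤ lt))
    ... | no _ | no q = ⊥-elim (q lt)
    count-strict {u} {c} (w ∷ us) (there u∈) lt with f w <? f u | f w <? c
    ... | yes _ | yes _ = s≤s (count-strict us u∈ lt)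
    ... | yes p | no q = ⊥-elim (q (ℕₚ.<-trans p lt))
    ... | no _ | yes _ = ℕₚ.m≤n⇒m≤1+n (count-strict us u∈ lt)
    ... | no _ | no _ = count-strict us u∈ lt

  rank : Fin k → Fin (suc k)
  rank v = fromℕ< {count (f v) (allFin k)} (s≤s (ℕₚ.≤-trans (count-bound (f v) (allFin k))
                                                     (ℕₚ.≤-reflexive (Listₚ.length-tabulate id))))
  private
    rank≡ : ∀ v → toℕ (rank v) ≡ count (f v) (allFin k)
    rank≡ v = Finₚ.toℕ-fromℕ< _

  rank-mono : ∀ {u v} → f u < f v → toℕ (rank u) < toℕ (rank v)
  rank-mono {u} {v} lt rewrite rank≡ u | rank≡ v = count-strict (allFin k) (∈-allFin u) lt

  rank-anti : ∀ {u v} → toℕ (rank u) < toℕ (rank v) → f u < f v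
  rank-anti {u} {v} lt rewrite rank≡ u | rank≡ v =
    ℕₚ.≰⇒> λ le → ℕₚ.<-irrefl refl (ℕₚ.≤-trans lt (count-mono (allFin k) le))

module _ (G : Graph) where
  private
    N = n G
    -- These numbers enumerate the functions from the `N` vertices to `suc N` positions, the range
    -- of `Rank.rank`.
    Code = Fin (suc N ^ N)
    pos : Code → Fin N → ℕ
    pos c = toℕ ∘ finToFun {suc N} {N} c

  IsModel : (Fin N → ℕ) → (Fin N → ℕ) → Set
  IsModel top bot = ∀ u v → u ≢ v →
    (adj G u v ≡ true → SegmentsIntersect G top bot u v) ×
    (SegmentsIntersect G top bot u v → adj G u v ≡ true)

  model-order : ∀ {t b t' b'} → (∀ u v → (t u < t v → t' u < t' v) × (t' u < t' v → t u < t v)) →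
                (∀ u v → (b u < b v → b' u < b' v) × (b' u < b' v → b u < b v)) → IsModel t b → IsModel t' b'
  model-order et eb h u v n =
    let (f , g) = h u v n in
    (λ e s → f e (back s)) , λ s → g (s ∘ forth)
    where
    back = Sum.map (λ (x , y) → proj₂ (et u v) x , proj₂ (eb u v) y) (λ (x , y) → proj₂ (et v u) x , proj₂ (eb v u) y)
    forth = Sum.map (λ (x , y) → proj₁ (et u v) x , proj₁ (eb u v) y) (λ (x , y) → proj₁ (et v u) x , proj₁ (eb v u) y)

  private
    intersect? : ∀ top bot u v → Dec (SegmentsIntersect G top bot u v)
    intersect? top bot u v =
      ¬? (((top u <? top v) ×-dec (bot u <? bot v)) ⊎-dec ((top v <? top u) ×-dec (bot v <? bot u)))

    model? : ∀ top bot → Dec (IsModel top bot)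
    model? top bot = Finₚ.all? λ u → Finₚ.all? λ v → ¬? (u Finₚ.≟ v) →-dec
      (((adj G u v Boolₚ.≟ true) →-dec intersect? top bot u v) ×-dec
       (intersect? top bot u v →-dec (adj G u v Boolₚ.≟ true)))

    code : (Fin N → ℕ) → Code
    code f = funToFin (Rank.rank f)

    code-order : ∀ f u v → (f u < f v → pos (code f) u < pos (code f) v) ×
                           (pos (code f) u < pos (code f) v → f u < f v)
    code-order f u v
      rewrite Finₚ.finToFun-funToFin (Rank.rank f) u | Finₚ.finToFun-funToFin (Rank.rank f) v =
      Rank.rank-mono f , Rank.rank-anti f

  -- Only the relative order of the endpoints matters, which leaves finitely many candidate models.
  permutation-stable : ¬ ¬ PermutationGraph G → PermutationGraph G
  permutation-stable h =
    let (c , d , m) = decidable-stable (Finₚ.any? λ c → Finₚ.any? λ d → model? (pos c) (pos d))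
          (λ k → h λ (top , bot , m) → k (code top , code bot , model-order (code-order top) (code-order bot) m)) in
    pos c , pos d , m

-- Permutation graphs have no asteroidal triple

walk-start : ∀ {G P u v k} → WalkIn G P u v k → P u
walk-start (here p) = p
walk-start (step p _ _) = p

permutation⇒ATFree : ∀ G → PermutationGraph G → ATFree G
permutation⇒ATFree G (top , bot , model) x y z (_ , _ , _ , (_ , xy) , (_ , yz) , (_ , xz)) =
  apartness (sides (walk-start xz))
  where
  Left : Fin (n G) → Fin (n G) → Set
  Left u v = top u < top v × bot u < bot v
  left? : ∀ u v → Dec (Left u v)
  left? u v = (top u <? top v) ×-dec (bot u <? bot v)
  sides : ∀ {z w} → AvoidN G z w → Left w z ⊎ Left z w
  sides {z} {w} (w≢z , zw) with left? w z | left? z w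
  ... | yes l | _ = inj₁ l
  ... | no _ | yes l = inj₂ l
  ... | no a | no b = ⊥-elim (true≢false (proj₂ (model z w (w≢z ∘ ≡-sym)) (λ { (inj₁ l) → b l ; (inj₂ l) → a l })) zw)
  trans-left : ∀ {a b c} → Left a b → Left b c → Left a c
  trans-left (p , q) (p' , q') = ℕₚ.<-trans p p' , ℕₚ.<-trans q q'
  irr-left : ∀ {a} → ¬ Left a a
  irr-left (p , _) = ℕₚ.<-irrefl refl p
  ordered : ∀ {a b} → Left a b ⊎ Left b a → adj G a b ≡ true → ⊥
  ordered {a} {b} s e = proj₁ (model a b λ { refl → [ irr-left , irr-left ]′ s }) e s
  stay-left : ∀ {z u v k} → WalkIn G (AvoidN G z) u v k → Left u z → Left v z
  stay-left (here _) l = l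
  stay-left (step _ e w) l with sides (walk-start w)
  ... | inj₁ l' = stay-left w l'
  ... | inj₂ r = ⊥-elim (ordered (inj₁ (trans-left l r)) e)
  stay-right : ∀ {z u v k} → WalkIn G (AvoidN G z) u v k → Left z u → Left z v
  stay-right (here _) l = l
  stay-right (step _ e w) l with sides (walk-start w)
  ... | inj₂ l' = stay-right w l'
  ... | inj₁ r = ⊥-elim (ordered (inj₂ (trans-left r l)) e)
  -- Say x is left of y. The walk from x to z avoids y, so z is left of y; the walk from y to z
  -- avoids x, so z is right of x. Then z separates x from y, but the walk from x to y avoids z.
  apartness : Left x y ⊎ Left y x → ⊥
  apartness (inj₁ l) =
    let zy = stay-left xz l
        xz' = stay-right yz l
    in irr-left (trans-left zy (stay-left xy xz'))
  apartness (inj₂ l) =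
    let yz' = stay-right xz l
        zx = stay-left yz l
    in irr-left (trans-left yz' (stay-right xy zx))

path⇒permutation : ∀ G → Connected G → DistanceHereditary G → PrunedTreeIsPath G → PermutationGraph G
path⇒permutation G conn dh h = permutation-stable G (path⇒¬¬permutation G conn dh h)

theorem6 : (G : Graph) → Connected G → DistanceHereditary G →
    (PermutationGraph G ⇔ ATFree G) × (PermutationGraph G ⇔ PrunedTreeIsPath G)
theorem6 G conn dh =
  mk⇔ (permutation⇒ATFree G) (path⇒permutation G conn dh ∘ ATFree⇒path G conn dh) ,
  mk⇔ (ATFree⇒path G conn dh ∘ permutation⇒ATFree G) (path⇒permutation G conn dh)
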